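{- Let $k\ge 4$ be an even integer and let $G$ be a finite group of even order. Assume that every prime power dividing $|G|$ either divides $k$ or is relatively prime to $k(k-1)$. Then there are infinitely many integers $v$ for which there exists a $2$-$(v,k,1)$-design whose automorphism group has a subgroup isomorphic to $G$.
   Context: A $2$-$(v,k,1)$-design consists of a set of $v$ points together with a collection of $k$-element subsets of the points (called blocks) such that any two distinct points lie in exactly one block. An automorphism is a permutation of the points mapping the set of blocks onto itself. -}

module Defs where

open import Data.Nat using (ℕ; _∸_; _*_; _^_)
open import Data.Nat.Divisibility using (_∣_)
open import Data.Nat.Coprimality using (Coprime)
open import Data.Nat.Primality using (Prime)
open import Data.Fin using (Fin)
open import Data.Fin.Subset using (Subset; _∈_; ∣_∣)
open import Data.Fin.Permutation using (Permutation′; _⟨$⟩ʳ_; _⟨$⟩ˡ_)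
open import Data.Vec using (tabulate; lookup)
open import Data.Product using (Σ; _×_)
open import Data.Sum using (_⊎_)
open import Relation.Binary.PropositionalEquality using (_≡_; _≢_)
open import Algebra.Structures using (IsGroup)

-- A finite group, presented (up to isomorphism) by a multiplication table on
-- Fin order, with propositional equality.
record FiniteGroup : Set where
  field
    order : ℕ
    _·_   : Fin order → Fin order → Fin order
    e     : Fin order
    inv   : Fin order → Fin order
    isGroup : IsGroup _≡_ _·_ e inv

record Design (v k : ℕ) : Set where
  field
    b      : ℕ
    block  : Fin b → Subset v
    size   : ∀ i → ∣ block i ∣ ≡ k
    pairs  : ∀ (x y : Fin v) → x ≢ y →
             Σ (Fin b) λ i → (x ∈ block i × y ∈ block i) ×
               (∀ j → x ∈ block j → y ∈ block j → j ≡ i)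

image : ∀ {v} → Permutation′ v → Subset v → Subset v
image σ S = tabulate λ y → lookup S (σ ⟨$⟩ˡ y)

IsAutomorphism : ∀ {v k} → Design v k → Permutation′ v → Set
IsAutomorphism D σ =
  (∀ i → Σ (Fin b) λ j → image σ (block i) ≡ block j) ×
  (∀ j → Σ (Fin b) λ i → image σ (block i) ≡ block j)
  where open Design D

HasSubgroupIso : ∀ {v k} → Design v k → FiniteGroup → Set
HasSubgroupIso {v} D G =
  Σ (Fin order → Permutation′ v) λ φ →
    (∀ g → IsAutomorphism D (φ g)) ×
    (∀ g h x → φ (g · h) ⟨$⟩ʳ x ≡ φ g ⟨$⟩ʳ (φ h ⟨$⟩ʳ x)) ×
    (∀ g h → (∀ x → φ g ⟨$⟩ʳ x ≡ φ h ⟨$⟩ʳ x) → g ≡ h)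
  where open FiniteGroup G

PrimePowerCondition : ℕ → ℕ → Set
PrimePowerCondition n k =
  ∀ p a → Prime p → p ^ a ∣ n → (p ^ a ∣ k) ⊎ Coprime (p ^ a) (k * (k ∸ 1))

-- Let V = F^G for a prime field F, with G permuting the coordinates. The design lives on c copies ("layers") of V, on
-- which G acts through V only; its blocks are contained in affine lines of V, that is, consist of points a + t d, and
-- directions d are normalised by κ d = 1 for a homogeneous G-invariant function κ. The field is chosen such that the
-- roots of unity of order |G|! are m-th powers, so κ exists, and everything reduces to choosing scalars t whose
-- differences, for any two given layers, represent each class of F* modulo m-th powers exactly once.
--
-- An element of G may act as -1 on an invariant line, so that a block through two points of one layer exchanged by it
-- is symmetric: such blocks are {(i , a ± β_i d)}, with i in a set of k/2 layers. The sets of layers used are the blocks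
-- of a design with block size k/2 on the layers; two layers then have exactly two classes occupied, because a
-- nonsquare β_i² - β_j² forces β_i - β_j and β_i + β_j into different classes. The other classes are represented by
-- blocks meeting k layers once each, along the blocks of a design with block size k on the layers. Points with the
-- same vector are joined by a block of that design.
--
-- Scalars with prescribed classes of differences exist in all large fields by Wilson's second moment argument. It also
-- gives difference families, whence the two designs on the layers. Primes congruent to 1 modulo M are found as prime
-- divisors of the value of the M-th cyclotomic polynomial at a large multiple of M.
module Submission where

open import Defs
open import Algebra.Bundles using (CommutativeRing; Group; RawRing)
import Algebra.Properties.CommutativeMonoid.Sum
import Algebra.Properties.CommutativeSemiring.Exp
import Algebra.Properties.Group
import Algebra.Properties.Ring
import Algebra.Solver.Ring
open import Algebra.Solver.Ring.AlmostCommutativeRing using (AlmostCommutativeRing; fromCommutativeRing; _-Raw-AlmostCommutative⟶_)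
open import Algebra.Structures using (IsCommutativeRing)
open import Data.Bool using (true)
import Data.Bool.Properties as Bool
open import Data.Empty using (⊥; ⊥-elim)
open import Data.Fin using (Fin; zero; suc; toℕ; inject≤; combine; remQuot; finToFun; funToFin; _↑ˡ_; _↑ʳ_; splitAt) renaming (_≟_ to _≟ᶠ_)
import Data.Fin as Fin
open import Data.Fin.Permutation using (Permutation′; permutation; _⟨$⟩ʳ_; _⟨$⟩ˡ_) renaming (inverseʳ to perm-inverseʳ; inverseˡ to perm-inverseˡ)
open import Data.Fin.Properties using (any?; pigeonhole; toℕ-injective; toℕ<n; toℕ-fromℕ<; injective⇒≤; inject≤-injective; suc-injective; combine-injective; combine-remQuot; remQuot-combine; funToFin-finToFin; finToFun-funToFin; ↑ˡ-injective; ↑ʳ-injective; splitAt-↑ˡ; splitAt-↑ʳ; join-splitAt)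
import Data.Fin.Properties as Fin
open import Data.Fin.Subset using (Subset; ∣_∣)
import Data.Fin.Subset as Subset
open import Data.Fin.Subset.Properties using (⊆-antisym)
open import Data.Integer using (ℤ; -[1+_]) renaming (+_ to pos)
import Data.Integer as ℤ
import Data.Integer.Properties as ℤ
open import Data.List using (List; []; _∷_; map; _++_; filter; deduplicate; length; lookup; allFin; cartesianProduct)
open import Data.List.Membership.Propositional using (_∈_)
open import Data.List.Membership.Propositional.Properties using (∈-deduplicate⁺; ∈-deduplicate⁻; ∈-map⁺; ∈-map⁻; ∈-lookup; ∈-++⁺ˡ; ∈-++⁺ʳ; ∈-++⁻; ∈-filter⁺; ∈-filter⁻; ∈-cartesianProduct⁺; ∈-allFin)
open import Data.List.Relation.Unary.All using (All; []; _∷_)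
import Data.List.Relation.Unary.All as All
open import Data.List.Relation.Unary.Any using (here; there)
import Data.List.Relation.Unary.Any as Any
open import Data.List.Relation.Unary.Any.Properties using (lookup-index)
open import Data.List.Relation.Unary.Unique.DecPropositional.Properties using (deduplicate-!)
open import Data.List.Relation.Unary.Unique.Propositional using (Unique; []; _∷_)
open import Data.Maybe using (Maybe; just; nothing)
open import Data.Nat
open import Data.Nat.Coprimality using (Coprime; coprime-divisor; coprime-Bézout)
import Data.Nat.Coprimality as Coprime
open import Data.Nat.DivMod using (_mod_; m≡m%n+[m/n]*n; m%n<n; m<n⇒m%n≡m; %-distribˡ-+; %-distribˡ-*; [m+kn]%n≡m%n)
open import Data.Nat.Divisibility
open import Data.Nat.GCD using (gcd; gcd[m,n]∣m; gcd[m,n]∣n; gcd-greatest; c*gcd[m,n]≡gcd[cm,cn]; gcd-GCD; module Bézout)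
open import Data.Nat.ListAction using (product)
open import Data.Nat.Primality using (Prime; prime?; prime⇒nonZero; prime⇒nonTrivial; prime⇒irreducible; ¬prime[1])
open import Data.Nat.Primality.Factorisation using (factorise; module PrimeFactorisation)
open import Data.Nat.Properties renaming (suc-injective to ℕ-suc-injective) hiding (_≟_)
open import Data.Nat.Tactic.RingSolver using (solve-∀)
open import Data.Product using (Σ; ∃; _×_; _,_; proj₁; proj₂)
open import Data.Sum using (_⊎_; inj₁; inj₂)
open import Data.Unit using (⊤; tt)
open import Data.Vec using (tabulate)
open import Data.Vec.Properties using ([]=⇒lookup; lookup⇒[]=; lookup∘tabulate; ≡-dec)
open import Function using (_∘_)
open import Relation.Binary.Definitions using (Tri; tri<; tri≈; tri>)
open import Relation.Binary.PropositionalEquality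
open import Relation.Nullary using (¬_; Dec; yes; no; does; contradiction; _×-dec_; _⊎-dec_; ¬?)

-- Finite sums and counting

-- The sizes are forced by counting classes. Within a layer the points with scalars β and -β differ
-- by 2β, and the m classes of 2β have to occur once each, so a layer lies in exactly m blocks of
-- size h = k/2; hence c = 1 + (h - 1) m. Between two layers the one symmetric block takes two
-- classes and leaves m - 2, so each block of the design with block size k carries m - 2 transversal
-- blocks. Thus c dictates m and has to be known before the field of coordinates, and primes are
-- chosen twice: the first is c itself, congruent to 1 modulo a number that admits both designs on
-- the layers and makes m even; the second is q, congruent to 1 modulo 2 m |G|! and large in terms
-- of m. The class of x is the value x^e with e = (q - 1) / m. That e is even makes the class of a
-- difference independent of the order of the two points; that m is even lets the class decide
-- whether x is a square. Exact covering of the pairs rests on the homogeneity of κ alone;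
-- invariance enters with the action of G.

⟦_⟧ : {P : Set} → Dec P → ℕ
⟦ yes _ ⟧ = 1
⟦ no _ ⟧ = 0

⟦⟧-yes : {P : Set} (d : Dec P) → P → ⟦ d ⟧ ≡ 1
⟦⟧-yes (yes _) p = refl
⟦⟧-yes (no ¬p) p = contradiction p ¬p

⟦⟧-no : {P : Set} (d : Dec P) → ¬ P → ⟦ d ⟧ ≡ 0
⟦⟧-no (yes p) ¬p = contradiction p ¬p
⟦⟧-no (no _) ¬p = refl

⟦⟧-pos : {P : Set} (d : Dec P) → 0 < ⟦ d ⟧ → P
⟦⟧-pos (yes p) _ = p

⟦⟧-mono : {P Q : Set} (d : Dec P) (d' : Dec Q) → (P → Q) → ⟦ d ⟧ ≤ ⟦ d' ⟧
⟦⟧-mono (yes p) d' f = ≤-reflexive (sym (⟦⟧-yes d' (f p)))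
⟦⟧-mono (no _) d' f = z≤n

⟦⟧-≤1 : {P : Set} (d : Dec P) → ⟦ d ⟧ ≤ 1
⟦⟧-≤1 (yes _) = ≤-refl
⟦⟧-≤1 (no _) = z≤n

⟦⟧-× : {P Q : Set} (d : Dec P) (d' : Dec Q) → ⟦ d ×-dec d' ⟧ ≡ ⟦ d ⟧ * ⟦ d' ⟧
⟦⟧-× (yes _) (yes _) = refl
⟦⟧-× (yes _) (no _) = refl
⟦⟧-× (no _) d' = refl

∑ : ∀ {n} → (Fin n → ℕ) → ℕ
∑ {zero} f = 0
∑ {suc n} f = f zero + ∑ (f ∘ suc)

∑-cong : ∀ {n} {f g : Fin n → ℕ} → (∀ i → f i ≡ g i) → ∑ f ≡ ∑ g
∑-cong {zero} eq = refl
∑-cong {suc n} eq = cong₂ _+_ (eq zero) (∑-cong (eq ∘ suc))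

∑-+ : ∀ {n} (f g : Fin n → ℕ) → ∑ (λ i → f i + g i) ≡ ∑ f + ∑ g
∑-+ {zero} f g = refl
∑-+ {suc n} f g = trans (cong (f zero + g zero +_) (∑-+ (f ∘ suc) (g ∘ suc)))
  (+-interchange (f zero) (g zero) _ _)
  where
  +-interchange : ∀ a b c d → a + b + (c + d) ≡ a + c + (b + d)
  +-interchange = solve-∀

∑-*ˡ : ∀ {n} c (f : Fin n → ℕ) → ∑ (λ i → c * f i) ≡ c * ∑ f
∑-*ˡ {zero} c f = sym (*-zeroʳ c)
∑-*ˡ {suc n} c f = trans (cong (c * f zero +_) (∑-*ˡ c (f ∘ suc))) (sym (*-distribˡ-+ c (f zero) _))

∑-*ʳ : ∀ {n} (f : Fin n → ℕ) c → ∑ (λ i → f i * c) ≡ ∑ f * c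
∑-*ʳ f c = trans (∑-cong λ i → *-comm (f i) c) (trans (∑-*ˡ c f) (*-comm c (∑ f)))

∑-mono : ∀ {n} {f g : Fin n → ℕ} → (∀ i → f i ≤ g i) → ∑ f ≤ ∑ g
∑-mono {zero} le = z≤n
∑-mono {suc n} le = +-mono-≤ (le zero) (∑-mono (le ∘ suc))

∑-const : ∀ n c → ∑ {n} (λ _ → c) ≡ n * c
∑-const zero c = refl
∑-const (suc n) c = cong (c +_) (∑-const n c)

∑-zero : ∀ {n} {f : Fin n → ℕ} → (∀ i → f i ≡ 0) → ∑ f ≡ 0
∑-zero {zero} eq = refl
∑-zero {suc n} eq = cong₂ _+_ (eq zero) (∑-zero (eq ∘ suc))

∑-swap : ∀ {m n} (f : Fin m → Fin n → ℕ) → ∑ (λ i → ∑ (f i)) ≡ ∑ (λ j → ∑ (λ i → f i j))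
∑-swap {zero} {n} f = sym (∑-zero {n} λ _ → refl)
∑-swap {suc m} f = trans (cong (∑ (f zero) +_) (∑-swap (f ∘ suc))) (sym (∑-+ (f zero) _))

∑-single : ∀ {n} (f : Fin n → ℕ) x → (∀ y → y ≢ x → f y ≡ 0) → ∑ f ≡ f x
∑-single f zero off = trans (cong (f zero +_) (∑-zero (λ i → off (suc i) λ ()))) (+-identityʳ _)
∑-single f (suc x) off =
  cong₂ _+_ (off zero λ ()) (∑-single (f ∘ suc) x (λ y ne → off (suc y) (ne ∘ suc-injective)))

∑-term : ∀ {n} (f : Fin n → ℕ) x → f x ≤ ∑ f
∑-term f zero = m≤m+n _ _
∑-term f (suc x) = ≤-trans (∑-term (f ∘ suc) x) (m≤n+m _ _)

∑-<⇒∃ : ∀ {n} (f g : Fin n → ℕ) → ∑ f < ∑ g → ∃ λ i → f i < g i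
∑-<⇒∃ f g lt with any? (λ i → f i <? g i)
... | yes e = e
... | no ne = contradiction lt (≤⇒≯ (∑-mono λ i → ≮⇒≥ (λ l → ne (i , l))))

count : ∀ {n} {P : Fin n → Set} → (∀ x → Dec (P x)) → ℕ
count P? = ∑ (λ x → ⟦ P? x ⟧)

count-singleton : ∀ {n} {P : Fin n → Set} (P? : ∀ x → Dec (P x)) x → P x → (∀ y → P y → y ≡ x) → count P? ≡ 1
count-singleton P? x px uniq =
  trans (∑-single _ x (λ y ne → ⟦⟧-no (P? y) (ne ∘ uniq y))) (⟦⟧-yes (P? x) px)

count-¬ : ∀ {n} {P : Fin n → Set} (P? : ∀ x → Dec (P x)) → count P? + count (λ x → ¬? (P? x)) ≡ n
count-¬ {n} P? = trans (sym (∑-+ (λ x → ⟦ P? x ⟧) (λ x → ⟦ ¬? (P? x) ⟧))) (trans (∑-cong lem) (trans (∑-const n 1) (*-identityʳ n)))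
  where
  lem : ∀ x → ⟦ P? x ⟧ + ⟦ ¬? (P? x) ⟧ ≡ 1
  lem x with P? x
  ... | yes _ = refl
  ... | no _ = refl

-- Both directions of the numbering are kept as data: blocks through a layer are later numbered by
-- classes, and free classes by block indices, and both passages are used.
record Enumeration {n} (P : Fin n → Set) (c : ℕ) : Set where
  field
    elem : Fin c → Fin n
    elem-injective : ∀ {r s} → elem r ≡ elem s → r ≡ s
    elem-sat : ∀ r → P (elem r)
    index : ∀ x → P x → Fin c
    elem-index : ∀ x px → elem (index x px) ≡ x

open Enumeration

enumerate : ∀ {n} {P : Fin n → Set} (P? : ∀ x → Dec (P x)) → Enumeration P (count P?)
enumerate {zero} P? = record
  { elem = λ () ; elem-injective = λ { {()} } ; elem-sat = λ () ; index = λ () ; elem-index = λ () }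
enumerate {suc n} {P} P? with P? zero | enumerate (P? ∘ suc)
... | yes p0 | E = record
  { elem = el ; elem-injective = λ {r} {s} → inj r s ; elem-sat = sat ; index = ix ; elem-index = eix }
  where
  el : Fin (suc (count (P? ∘ suc))) → Fin (suc n)
  el zero = zero
  el (suc r) = suc (elem E r)
  inj : ∀ r s → el r ≡ el s → r ≡ s
  inj zero zero eq = refl
  inj (suc r) (suc s) eq = cong suc (elem-injective E (suc-injective eq))
  sat : ∀ r → P (el r)
  sat zero = p0
  sat (suc r) = elem-sat E r
  ix : ∀ x → P x → Fin (suc (count (P? ∘ suc)))
  ix zero px = zero
  ix (suc x) px = suc (index E x px)
  eix : ∀ x px → el (ix x px) ≡ x
  eix zero px = refl
  eix (suc x) px = cong suc (elem-index E x px)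
... | no ¬p0 | E = record
  { elem = suc ∘ elem E
  ; elem-injective = elem-injective E ∘ suc-injective
  ; elem-sat = elem-sat E
  ; index = ix
  ; elem-index = eix }
  where
  ix : ∀ x → P x → Fin (count (P? ∘ suc))
  ix zero px = contradiction px ¬p0
  ix (suc x) px = index E x px
  eix : ∀ x px → suc (elem E (ix x px)) ≡ x
  eix zero px = contradiction px ¬p0
  eix (suc x) px = cong suc (elem-index E x px)

-- The hypothesis has the shape of `root-of-unity-bound`, so that a bound on the roots of a
-- polynomial becomes a bound on a count.
count-≤ : ∀ {n} {P : Fin n → Set} (P? : ∀ x → Dec (P x)) c →
  ((g : Fin (suc c) → Fin n) → (∀ {r s} → g r ≡ g s → r ≡ s) → (∀ r → P (g r)) → ⊥) → count P? ≤ c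
count-≤ P? c none with count P? ≤? c
... | yes le = le
... | no nle = ⊥-elim (none (elem E ∘ emb) (inject≤-injective _ _ _ _ ∘ elem-injective E) (elem-sat E ∘ emb))
  where
  E = enumerate P?
  emb : Fin (suc c) → Fin (count P?)
  emb r = inject≤ r (≰⇒> nle)

count-injection : ∀ {n m} {P : Fin n → Set} {Q : Fin m → Set} (P? : ∀ x → Dec (P x)) (Q? : ∀ x → Dec (Q x))
  (f : Fin n → Fin m) → (∀ {x y} → f x ≡ f y → x ≡ y) → (∀ x → P x → Q (f x)) → count P? ≤ count Q?
count-injection P? Q? f inj PQ = injective⇒≤ {f = φ} φ-inj
  where
  E = enumerate P?
  E' = enumerate Q?
  φ : Fin (count P?) → Fin (count Q?)
  φ r = index E' (f (elem E r)) (PQ _ (elem-sat E r))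
  φ-inj : ∀ {r s} → φ r ≡ φ s → r ≡ s
  φ-inj {r} {s} eq = elem-injective E (inj
    (trans (sym (elem-index E' _ _)) (trans (cong (elem E') eq) (elem-index E' _ _))))

count-all : ∀ {n} {P : Fin n → Set} (P? : ∀ x → Dec (P x)) → (∀ x → P x) → count P? ≡ n
count-all {n} P? all = trans (∑-cong (λ x → ⟦⟧-yes (P? x) (all x))) (trans (∑-const n 1) (*-identityʳ n))

-- Finite fields

record FiniteField (q : ℕ) : Set where
  infixl 6 _⊕_
  infixl 7 _⊗_
  infix 8 ⊖_
  field
    _⊕_ _⊗_ : Fin q → Fin q → Fin q
    ⊖_ : Fin q → Fin q
    𝟘 𝟙 : Fin q
    isCommutativeRing : IsCommutativeRing _≡_ _⊕_ _⊗_ ⊖_ 𝟘 𝟙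
    _⁻¹ : Fin q → Fin q
    inverseʳ : ∀ x → x ≢ 𝟘 → x ⊗ x ⁻¹ ≡ 𝟙
    𝟙≢𝟘 : 𝟙 ≢ 𝟘

module Field {q : ℕ} (F : FiniteField q) where
  open FiniteField F public

  R : CommutativeRing _ _
  R = record { isCommutativeRing = isCommutativeRing }

  private
    module R = CommutativeRing R
    module RP = Algebra.Properties.Ring R.ring

  open Algebra.Properties.CommutativeSemiring.Exp R.commutativeSemiring public
    using () renaming (_^_ to _^ᶠ_)
  private
    module Exp = Algebra.Properties.CommutativeSemiring.Exp R.commutativeSemiring
  infixl 6 _⊝_
  _⊝_ : Fin q → Fin q → Fin q
  x ⊝ y = x ⊕ ⊖ y

  ^-distribˡ-+ : ∀ x m n → x ^ᶠ (m + n) ≡ (x ^ᶠ m) ⊗ (x ^ᶠ n)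
  ^-distribˡ-+ = Exp.^-homo-*

  ^-* : ∀ x m n → x ^ᶠ (m * n) ≡ (x ^ᶠ m) ^ᶠ n
  ^-* x m n = sym (Exp.^-assocʳ x m n)

  ^-distrib-⊗ : ∀ x y n → (x ⊗ y) ^ᶠ n ≡ (x ^ᶠ n) ⊗ (y ^ᶠ n)
  ^-distrib-⊗ = Exp.^-distrib-*

  ^-𝟙 : ∀ n → 𝟙 ^ᶠ n ≡ 𝟙
  ^-𝟙 zero = refl
  ^-𝟙 (suc n) = trans (R.*-identityˡ _) (^-𝟙 n)

  private
    natF : ℕ → Fin q
    natF zero = 𝟘
    -- The separate clause for 1 avoids `𝟙 ⊕ 𝟘`, so that the coefficient `con (pos 1)` means `𝟙`
    -- definitionally.
    natF (suc zero) = 𝟙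
    natF (suc (suc n)) = 𝟙 ⊕ natF (suc n)

    natF-suc : ∀ n → natF (suc n) ≡ 𝟙 ⊕ natF n
    natF-suc zero = sym (R.+-identityʳ 𝟙)
    natF-suc (suc n) = refl

    ι : ℤ → Fin q
    ι (pos n) = natF n
    ι -[1+ n ] = ⊖ natF (suc n)

    cancel : ∀ a x y → (a ⊕ x) ⊝ (a ⊕ y) ≡ x ⊝ y
    cancel a x y = begin
      (a ⊕ x) ⊕ ⊖ (a ⊕ y) ≡⟨ cong₂ _⊕_ (R.+-comm a x) (sym (RP.-‿+-comm a y)) ⟩
      (x ⊕ a) ⊕ (⊖ a ⊕ ⊖ y) ≡⟨ R.+-assoc x a _ ⟩
      x ⊕ (a ⊕ (⊖ a ⊕ ⊖ y)) ≡⟨ cong (x ⊕_) (sym (R.+-assoc a _ _)) ⟩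
      x ⊕ ((a ⊕ ⊖ a) ⊕ ⊖ y) ≡⟨ cong (λ t → x ⊕ (t ⊕ ⊖ y)) (R.-‿inverseʳ a) ⟩
      x ⊕ (𝟘 ⊕ ⊖ y) ≡⟨ cong (x ⊕_) (R.+-identityˡ _) ⟩
      x ⊕ ⊖ y ∎
      where open ≡-Reasoning

    ι-⊖ : ∀ m n → ι (m ℤ.⊖ n) ≡ natF m ⊝ natF n
    ι-⊖ zero zero = sym (R.-‿inverseʳ 𝟘)
    ι-⊖ zero (suc n) = sym (R.+-identityˡ _)
    ι-⊖ (suc m) zero = sym (trans (cong (natF (suc m) ⊕_) RP.-0#≈0#) (R.+-identityʳ _))
    ι-⊖ (suc m) (suc n) =
      trans (cong ι (ℤ.[1+m]⊖[1+n]≡m⊖n m n)) (trans (ι-⊖ m n)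
        (trans (sym (cancel 𝟙 _ _)) (sym (cong₂ _⊝_ (natF-suc m) (natF-suc n)))))

    natF-+ : ∀ m n → natF (m + n) ≡ natF m ⊕ natF n
    natF-+ zero n = sym (R.+-identityˡ _)
    natF-+ (suc m) n = trans (natF-suc (m + n)) (trans (cong (𝟙 ⊕_) (natF-+ m n))
      (trans (sym (R.+-assoc _ _ _)) (cong (_⊕ natF n) (sym (natF-suc m)))))

    ι-+ : ∀ i j → ι (i ℤ.+ j) ≡ ι i ⊕ ι j
    ι-+ (pos m) (pos n) = natF-+ m n
    ι-+ (pos m) -[1+ n ] = ι-⊖ m (suc n)
    ι-+ -[1+ m ] (pos n) = trans (ι-⊖ n (suc m)) (R.+-comm _ _)
    ι-+ -[1+ m ] -[1+ n ] = trans (cong (λ t → ⊖ natF (suc t)) (sym (+-suc m n)))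
      (trans (cong ⊖_ (natF-+ (suc m) (suc n))) (sym (RP.-‿+-comm _ _)))

    ι-neg : ∀ i → ι (ℤ.- i) ≡ ⊖ ι i
    ι-neg (pos zero) = sym RP.-0#≈0#
    ι-neg (pos (suc n)) = refl
    ι-neg -[1+ n ] = sym (RP.-‿involutive _)

    ι-*ℕ : ∀ m j → ι (pos m ℤ.* j) ≡ natF m ⊗ ι j
    ι-*ℕ zero j = trans (cong ι (ℤ.*-zeroˡ j)) (sym (R.zeroˡ _))
    ι-*ℕ (suc m) j = begin
      ι (pos (suc m) ℤ.* j) ≡⟨ cong ι (ℤ.suc-* (pos m) j) ⟩
      ι (j ℤ.+ pos m ℤ.* j) ≡⟨ ι-+ j _ ⟩
      ι j ⊕ ι (pos m ℤ.* j) ≡⟨ cong₂ _⊕_ (sym (R.*-identityˡ _)) (ι-*ℕ m j) ⟩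
      𝟙 ⊗ ι j ⊕ natF m ⊗ ι j ≡⟨ sym (R.distribʳ _ _ _) ⟩
      (𝟙 ⊕ natF m) ⊗ ι j ≡⟨ cong (_⊗ ι j) (sym (natF-suc m)) ⟩
      natF (suc m) ⊗ ι j ∎
      where open ≡-Reasoning

    ι-* : ∀ i j → ι (i ℤ.* j) ≡ ι i ⊗ ι j
    ι-* (pos m) j = ι-*ℕ m j
    ι-* -[1+ m ] j = begin
      ι (-[1+ m ] ℤ.* j) ≡⟨ cong ι (sym (ℤ.neg-distribˡ-* (pos (suc m)) j)) ⟩
      ι (ℤ.- (pos (suc m) ℤ.* j)) ≡⟨ ι-neg (pos (suc m) ℤ.* j) ⟩
      ⊖ ι (pos (suc m) ℤ.* j) ≡⟨ cong ⊖_ (ι-*ℕ (suc m) j) ⟩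
      ⊖ (natF (suc m) ⊗ ι j) ≡⟨ RP.-‿distribˡ-* _ _ ⟩
      ⊖ natF (suc m) ⊗ ι j ∎
      where open ≡-Reasoning

    ℤ-raw : RawRing _ _
    ℤ-raw = ℤ.+-*-rawRing

    ACR : AlmostCommutativeRing _ _
    ACR = fromCommutativeRing R

    morphism : ℤ-raw -Raw-AlmostCommutative⟶ ACR
    morphism = record
      { ⟦_⟧ = ι ; +-homo = ι-+ ; *-homo = ι-* ; -‿homo = ι-neg ; 0-homo = refl ; 1-homo = refl }

    coeff? : ∀ i j → Maybe (ι i ≡ ι j)
    coeff? i j with i ℤ.≟ j
    ... | yes eq = just (cong ι eq)
    ... | no _ = nothing

  -- The ring solver, with integer coefficients so that x - x is recognised as zero.
  module Solve = Algebra.Solver.Ring ℤ-raw ACR morphism coeff?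
  open Solve public using (solve; _:=_; _:+_; _:*_; _:-_; :-_; con)

  ⊗-𝟘ˡ : ∀ x → 𝟘 ⊗ x ≡ 𝟘
  ⊗-𝟘ˡ = R.zeroˡ
  ⊗-𝟘ʳ : ∀ x → x ⊗ 𝟘 ≡ 𝟘
  ⊗-𝟘ʳ = R.zeroʳ
  ⊗-𝟙ˡ : ∀ x → 𝟙 ⊗ x ≡ x
  ⊗-𝟙ˡ = R.*-identityˡ
  ⊗-𝟙ʳ : ∀ x → x ⊗ 𝟙 ≡ x
  ⊗-𝟙ʳ = R.*-identityʳ
  ⊕-comm : ∀ x y → x ⊕ y ≡ y ⊕ x
  ⊕-comm = R.+-comm
  ⊕-𝟘ʳ : ∀ x → x ⊕ 𝟘 ≡ x
  ⊕-𝟘ʳ = R.+-identityʳ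
  ⊗-comm : ∀ x y → x ⊗ y ≡ y ⊗ x
  ⊗-comm = R.*-comm
  ⊗-assoc : ∀ x y z → (x ⊗ y) ⊗ z ≡ x ⊗ (y ⊗ z)
  ⊗-assoc = R.*-assoc
  ⊖-involutive : ∀ x → ⊖ (⊖ x) ≡ x
  ⊖-involutive = RP.-‿involutive
  ⊖-𝟘 : ⊖ 𝟘 ≡ 𝟘
  ⊖-𝟘 = RP.-0#≈0#

  ⊖-injective : ∀ {x y} → ⊖ x ≡ ⊖ y → x ≡ y
  ⊖-injective = RP.-‿injective

  ⊝-self : ∀ x → x ⊝ x ≡ 𝟘
  ⊝-self = R.-‿inverseʳ

  ⊝-≡𝟘 : ∀ {x y} → x ⊝ y ≡ 𝟘 → x ≡ y
  ⊝-≡𝟘 {x} {y} eq = trans (solve 2 (λ x y → x := (x :- y) :+ y) refl x y)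
    (trans (cong (_⊕ y) eq) (R.+-identityˡ y))

  ⊝-≢𝟘 : ∀ {x y} → x ≢ y → x ⊝ y ≢ 𝟘
  ⊝-≢𝟘 ne = ne ∘ ⊝-≡𝟘

  inverseˡ : ∀ x → x ≢ 𝟘 → x ⁻¹ ⊗ x ≡ 𝟙
  inverseˡ x ne = trans (⊗-comm _ _) (inverseʳ x ne)

  ⊗-cancelˡ : ∀ a {x y} → a ≢ 𝟘 → a ⊗ x ≡ a ⊗ y → x ≡ y
  ⊗-cancelˡ a {x} {y} ne eq = trans (lem x) (trans (cong (a ⁻¹ ⊗_) eq) (sym (lem y)))
    where
    lem : ∀ t → t ≡ a ⁻¹ ⊗ (a ⊗ t)
    lem t = trans (sym (⊗-𝟙ˡ t)) (trans (cong (_⊗ t) (sym (inverseˡ a ne))) (⊗-assoc _ _ _))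

  ⊗-cancelʳ : ∀ a {x y} → a ≢ 𝟘 → x ⊗ a ≡ y ⊗ a → x ≡ y
  ⊗-cancelʳ a ne eq = ⊗-cancelˡ a ne (trans (⊗-comm _ _) (trans eq (⊗-comm _ _)))

  ⊗-≡𝟘 : ∀ {x y} → x ⊗ y ≡ 𝟘 → x ≡ 𝟘 ⊎ y ≡ 𝟘
  ⊗-≡𝟘 {x} {y} eq with x ≟ᶠ 𝟘
  ... | yes x0 = inj₁ x0
  ... | no x≢0 = inj₂ (⊗-cancelˡ x x≢0 (trans eq (sym (⊗-𝟘ʳ x))))

  ⊗-≢𝟘 : ∀ {x y} → x ≢ 𝟘 → y ≢ 𝟘 → x ⊗ y ≢ 𝟘
  ⊗-≢𝟘 nx ny eq with ⊗-≡𝟘 eq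
  ... | inj₁ e = nx e
  ... | inj₂ e = ny e

  ⁻¹-≢𝟘 : ∀ {x} → x ≢ 𝟘 → x ⁻¹ ≢ 𝟘
  ⁻¹-≢𝟘 {x} ne eq = 𝟙≢𝟘 (trans (sym (inverseʳ x ne)) (trans (cong (x ⊗_) eq) (⊗-𝟘ʳ x)))

  ⊖-≢𝟘 : ∀ {x} → x ≢ 𝟘 → ⊖ x ≢ 𝟘
  ⊖-≢𝟘 ne eq = ne (⊖-injective (trans eq (sym ⊖-𝟘)))

  ^-≢𝟘 : ∀ {x} n → x ≢ 𝟘 → x ^ᶠ n ≢ 𝟘
  ^-≢𝟘 zero ne = 𝟙≢𝟘
  ^-≢𝟘 (suc n) ne = ⊗-≢𝟘 ne (^-≢𝟘 n ne)

  ^-⁻¹ : ∀ {x} n → x ≢ 𝟘 → (x ⁻¹) ^ᶠ n ⊗ x ^ᶠ n ≡ 𝟙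
  ^-⁻¹ {x} n ne = trans (sym (^-distrib-⊗ _ _ n)) (trans (cong (_^ᶠ n) (inverseˡ x ne)) (^-𝟙 n))

  ^-quotient : ∀ {x y} e → y ≢ 𝟘 → x ^ᶠ e ≡ y ^ᶠ e → (x ⊗ y ⁻¹) ^ᶠ e ≡ 𝟙
  ^-quotient {x} {y} e ne eq = trans (^-distrib-⊗ _ _ e)
    (trans (cong (_⊗ (y ⁻¹) ^ᶠ e) eq) (trans (⊗-comm _ _) (^-⁻¹ e ne)))

  -- Roots of monic polynomials

  data Monic : ℕ → (Fin q → Fin q) → Set where
    one : ∀ {f} → (∀ x → f x ≡ 𝟙) → Monic zero f
    step : ∀ {n f} g c → Monic n g → (∀ x → f x ≡ x ⊗ g x ⊕ c) → Monic (suc n) f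

  -- Synthetic division on the Horner form: if `g` has quotient `g'` and remainder `g r`, then
  -- `x ⊗ g x ⊕ c` has quotient `x ⊗ g' x ⊕ g r`.
  divide : ∀ {n f} → Monic (suc n) f → ∀ r → ∃ λ g → Monic n g × (∀ x → f x ≡ (x ⊝ r) ⊗ g x ⊕ f r)
  divide {zero} {f} (step g c (one g1) eq) r = (λ _ → 𝟙) , one (λ _ → refl) , λ x →
    trans (f-val x) (trans (solve 3 (λ x r c → x :* con (pos 1) :+ c := (x :- r) :* con (pos 1) :+ (r :* con (pos 1) :+ c)) refl x r c)
      (cong ((x ⊝ r) ⊗ 𝟙 ⊕_) (sym (f-val r))))
    where
    f-val : ∀ x → f x ≡ x ⊗ 𝟙 ⊕ c
    f-val x = trans (eq x) (cong (λ t → x ⊗ t ⊕ c) (g1 x))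
  divide {suc n} {f} (step g c m eq) r with divide m r
  ... | g' , m' , eq' = (λ x → x ⊗ g' x ⊕ g r) , step g' (g r) m' (λ _ → refl) , λ x → begin
    f x ≡⟨ eq x ⟩
    x ⊗ g x ⊕ c ≡⟨ cong (λ t → x ⊗ t ⊕ c) (eq' x) ⟩
    x ⊗ ((x ⊝ r) ⊗ g' x ⊕ g r) ⊕ c ≡⟨ solve 5 (λ x r g'x gr c → x :* ((x :- r) :* g'x :+ gr) :+ c
                                                       := (x :- r) :* (x :* g'x :+ gr) :+ (r :* gr :+ c)) refl x r (g' x) (g r) c ⟩
    (x ⊝ r) ⊗ (x ⊗ g' x ⊕ g r) ⊕ (r ⊗ g r ⊕ c) ≡⟨ cong ((x ⊝ r) ⊗ (x ⊗ g' x ⊕ g r) ⊕_) (sym (eq r)) ⟩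
    (x ⊝ r) ⊗ (x ⊗ g' x ⊕ g r) ⊕ f r ∎
    where open ≡-Reasoning

  -- Dividing by the first root leaves the others as roots of a monic quotient of smaller degree,
  -- since a field has no zero divisors.
  too-many-roots : ∀ {n f} → Monic n f → (g : Fin (suc n) → Fin q) → (∀ {r s} → g r ≡ g s → r ≡ s) →
    (∀ r → f (g r) ≡ 𝟘) → ⊥
  too-many-roots (one eq) g inj root = 𝟙≢𝟘 (trans (sym (eq _)) (root zero))
  too-many-roots {suc n} m g inj root with divide m (g zero)
  ... | h , mh , eq = too-many-roots mh (g ∘ suc) (λ e → suc-inj (inj e)) λ r →
    case-zero r (⊗-≡𝟘 (trans (sym (⊕-𝟘ʳ _)) (trans (cong (_ ⊕_) (sym (root zero))) (trans (sym (eq _)) (root (suc r))))))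
    where
    suc-inj : ∀ {r s : Fin (suc n)} → Fin.suc r ≡ suc s → r ≡ s
    suc-inj refl = refl
    case-zero : ∀ r → g (suc r) ⊝ g zero ≡ 𝟘 ⊎ h (g (suc r)) ≡ 𝟘 → h (g (suc r)) ≡ 𝟘
    case-zero r (inj₁ e) with inj (⊝-≡𝟘 e)
    ... | ()
    case-zero r (inj₂ e) = e

  ^-monic : ∀ n → Monic n (_^ᶠ n)
  ^-monic zero = one (λ _ → refl)
  ^-monic (suc n) = step (_^ᶠ n) 𝟘 (^-monic n) (λ x → sym (⊕-𝟘ʳ _))

  monic-⊝ : ∀ {n f} c → Monic (suc n) f → Monic (suc n) (λ x → f x ⊝ c)
  monic-⊝ c (step g a m eq) = step g (a ⊝ c) m (λ x → trans (cong (_⊝ c) (eq x)) (R.+-assoc _ _ _))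

  -- The value `c` is arbitrary because the bound serves square roots as well as roots of unity.
  root-of-unity-bound : ∀ {n} → (g : Fin (suc (suc n)) → Fin q) → (∀ {r s} → g r ≡ g s → r ≡ s) →
    ∀ c → (∀ r → g r ^ᶠ suc n ≡ c) → ⊥
  root-of-unity-bound {n} g inj c eq =
    too-many-roots (monic-⊝ c (^-monic (suc n))) g inj (λ r → trans (cong (_⊝ c) (eq r)) (⊝-self c))

  ⊖-^-even : ∀ {n} f → n ≡ 2 * f → ∀ x → (⊖ x) ^ᶠ n ≡ x ^ᶠ n
  ⊖-^-even f refl x = trans (^-* (⊖ x) 2 f) (trans (cong (_^ᶠ f) (square x)) (sym (^-* x 2 f)))
    where
    square : ∀ x → (⊖ x) ^ᶠ 2 ≡ x ^ᶠ 2
    square = solve 1 (λ x → (:- x) :* ((:- x) :* con (pos 1)) := x :* (x :* con (pos 1))) refl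

  ⊖-swap : ∀ x y → x ⊝ y ≡ ⊖ (y ⊝ x)
  ⊖-swap = solve 2 (λ x y → x :- y := :- (y :- x)) refl

  ≢⊖ : 𝟙 ⊕ 𝟙 ≢ 𝟘 → ∀ {x} → x ≢ 𝟘 → x ≢ ⊖ x
  ≢⊖ two nx eq = ⊗-≢𝟘 nx two (trans (double _) (trans (cong (_ ⊕_) eq) (⊝-self _)))
    where
    double : ∀ x → x ⊗ (𝟙 ⊕ 𝟙) ≡ x ⊕ x
    double = solve 1 (λ x → x :* (con (pos 1) :+ con (pos 1)) := x :+ x) refl

-- Fermat's theorem and power residue classes

module Fermat {q : ℕ} (F : FiniteField q) where
  open Field F
  private
    module R = CommutativeRing R
    module Π = Algebra.Properties.CommutativeMonoid.Sum R.*-commutativeMonoid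

    ∏ : ∀ {n} → (Fin n → Fin q) → Fin q
    ∏ f = Π.sum f

    -- Turns a product over the field into one over its nonzero elements. Condition and factor are
    -- separate arguments so that the factor `x` can be split off from `x ⊗ y`.
    unless𝟘 : Fin q → Fin q → Fin q
    unless𝟘 y t with y ≟ᶠ 𝟘
    ... | yes _ = 𝟙
    ... | no _ = t

    unless𝟘-⊗ : ∀ x → x ≢ 𝟘 → ∀ y → unless𝟘 (x ⊗ y) (x ⊗ y) ≡ unless𝟘 y x ⊗ unless𝟘 y y
    unless𝟘-⊗ x nx y with y ≟ᶠ 𝟘 | (x ⊗ y) ≟ᶠ 𝟘
    ... | yes e | yes _ = sym (⊗-𝟙ˡ 𝟙)
    ... | yes refl | no ne = contradiction (⊗-𝟘ʳ x) ne
    ... | no ny | yes e = contradiction e (⊗-≢𝟘 nx ny)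
    ... | no _ | no _ = refl

    unless𝟘-≢𝟘 : ∀ y → unless𝟘 y y ≢ 𝟘
    unless𝟘-≢𝟘 y with y ≟ᶠ 𝟘
    ... | yes _ = 𝟙≢𝟘
    ... | no ny = ny

    ∏-≢𝟘 : ∀ {n} (f : Fin n → Fin q) → (∀ i → f i ≢ 𝟘) → ∏ f ≢ 𝟘
    ∏-≢𝟘 {zero} f nz = 𝟙≢𝟘
    ∏-≢𝟘 {suc n} f nz = ⊗-≢𝟘 (nz zero) (∏-≢𝟘 (f ∘ suc) (nz ∘ suc))

    ∏-unless : ∀ {n} (g : Fin n → Fin q) x → ∏ (λ i → unless𝟘 (g i) x) ≡ x ^ᶠ count (λ i → ¬? (g i ≟ᶠ 𝟘))
    ∏-unless {zero} g x = refl
    ∏-unless {suc n} g x with g zero ≟ᶠ 𝟘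
    ... | yes _ = trans (⊗-𝟙ˡ _) (∏-unless (g ∘ suc) x)
    ... | no _ = cong (x ⊗_) (∏-unless (g ∘ suc) x)

    mult : ∀ x → x ≢ 𝟘 → Permutation′ q
    mult x nx = permutation (x ⊗_) (x ⁻¹ ⊗_)
      (λ y → trans (sym (⊗-assoc _ _ _)) (trans (cong (_⊗ y) (inverseʳ x nx)) (⊗-𝟙ˡ y)))
      (λ y → trans (sym (⊗-assoc _ _ _)) (trans (cong (_⊗ y) (inverseˡ x nx)) (⊗-𝟙ˡ y)))

  count-≢𝟘 : ∀ {n} → q ≡ suc n → count {q} (λ y → ¬? (y ≟ᶠ 𝟘)) ≡ n
  count-≢𝟘 {n} eq = ℕ-suc-injective (trans (cong (_+ count (λ y → ¬? (y ≟ᶠ 𝟘)))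
      (sym (count-singleton (λ y → y ≟ᶠ 𝟘) 𝟘 refl (λ y e → e)))) (trans (count-¬ (λ y → y ≟ᶠ 𝟘)) eq))

  -- Multiplication by `x` permutes the nonzero elements, so their product is both unchanged and
  -- multiplied by `x ^ᶠ n`; being nonzero, it cancels.
  fermat : ∀ {n} → q ≡ suc n → ∀ x → x ≢ 𝟘 → x ^ᶠ n ≡ 𝟙
  fermat {n} eq x nx = sym (⊗-cancelʳ (∏ (λ y → unless𝟘 y y)) (∏-≢𝟘 _ unless𝟘-≢𝟘) (begin
    𝟙 ⊗ ∏ (λ y → unless𝟘 y y) ≡⟨ ⊗-𝟙ˡ _ ⟩
    ∏ (λ y → unless𝟘 y y) ≡⟨ Π.sum-permute (λ y → unless𝟘 y y) (mult x nx) ⟩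
    ∏ (λ y → unless𝟘 (x ⊗ y) (x ⊗ y)) ≡⟨ Π.sum-cong-≗ (unless𝟘-⊗ x nx) ⟩
    ∏ (λ y → unless𝟘 y x ⊗ unless𝟘 y y) ≡⟨ Π.∑-distrib-+ (λ y → unless𝟘 y x) (λ y → unless𝟘 y y) ⟩
    ∏ (λ y → unless𝟘 y x) ⊗ ∏ (λ y → unless𝟘 y y) ≡⟨ cong (_⊗ _) (∏-unless (λ y → y) x) ⟩
    x ^ᶠ count {q} (λ y → ¬? (y ≟ᶠ 𝟘)) ⊗ ∏ (λ y → unless𝟘 y y) ≡⟨ cong (λ t → x ^ᶠ t ⊗ _) (count-≢𝟘 eq) ⟩
    x ^ᶠ n ⊗ ∏ (λ y → unless𝟘 y y) ∎))
    where open ≡-Reasoning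

  𝟘^suc : ∀ n → 𝟘 ^ᶠ suc n ≡ 𝟘
  𝟘^suc n = ⊗-𝟘ˡ _

  -- The d-th roots of unity label the classes of nonzero elements modulo d-th powers.
  record Roots (d : ℕ) : Set where
    field
      root : Fin d → Fin q
      root-injective : ∀ {r s} → root r ≡ root s → r ≡ s
      root-onto : ∀ y → y ^ᶠ d ≡ 𝟙 → ∃ λ r → root r ≡ y
      root-^ : ∀ r → root r ^ᶠ d ≡ 𝟙

    root-≢𝟘 : ∀ r → root r ≢ 𝟘
    root-≢𝟘 r eq = no-root d r (trans (cong (_^ᶠ d) (sym eq)) (root-^ r))
      where
      no-root : ∀ n → Fin n → 𝟘 ^ᶠ n ≢ 𝟙
      no-root (suc n) _ h = 𝟙≢𝟘 (trans (sym h) (𝟘^suc n))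

  -- An element of exact order `suc d` has that many distinct powers; one more root of unity would
  -- exceed the number of roots of a polynomial of this degree.
  power-roots : ∀ {d} ω → ω ^ᶠ suc d ≡ 𝟙 → (∀ j → 0 < j → j < suc d → ω ^ᶠ j ≢ 𝟙) → Roots (suc d)
  power-roots {d} ω ω^d≡1 order = record
    { root = z ; root-injective = λ {r} {s} → z-inj r s ; root-onto = onto ; root-^ = z-^ }
    where
    z : Fin (suc d) → Fin q
    z r = ω ^ᶠ toℕ r
    ω≢𝟘 : ω ≢ 𝟘
    ω≢𝟘 eq = 𝟙≢𝟘 (trans (sym ω^d≡1) (trans (cong (_^ᶠ suc d) eq) (𝟘^suc d)))
    z-< : ∀ r s → toℕ r < toℕ s → z r ≢ z s
    z-< r s lt eq = order (toℕ s ∸ toℕ r) (m<n⇒0<n∸m lt) (≤-<-trans (m∸n≤m _ (toℕ r)) (toℕ<n s))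
      (⊗-cancelˡ (z r) (^-≢𝟘 (toℕ r) ω≢𝟘) (begin
        z r ⊗ ω ^ᶠ (toℕ s ∸ toℕ r) ≡⟨ sym (^-distribˡ-+ ω (toℕ r) _) ⟩
        ω ^ᶠ (toℕ r + (toℕ s ∸ toℕ r)) ≡⟨ cong (ω ^ᶠ_) (m+[n∸m]≡n (<⇒≤ lt)) ⟩
        z s ≡⟨ sym eq ⟩
        z r ≡⟨ sym (⊗-𝟙ʳ _) ⟩
        z r ⊗ 𝟙 ∎))
      where open ≡-Reasoning
    z-inj : ∀ r s → z r ≡ z s → r ≡ s
    z-inj r s eq with <-cmp (toℕ r) (toℕ s)
    ... | tri< lt _ _ = ⊥-elim (z-< r s lt eq)
    ... | tri≈ _ e _ = toℕ-injective e
    ... | tri> _ _ gt = ⊥-elim (z-< s r gt (sym eq))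
    z-^ : ∀ r → z r ^ᶠ suc d ≡ 𝟙
    z-^ r = trans (sym (^-* ω (toℕ r) (suc d))) (trans (cong (ω ^ᶠ_) (*-comm (toℕ r) (suc d)))
      (trans (^-* ω (suc d) (toℕ r)) (trans (cong (_^ᶠ toℕ r) ω^d≡1) (^-𝟙 (toℕ r)))))
    onto : ∀ y → y ^ᶠ suc d ≡ 𝟙 → ∃ λ r → z r ≡ y
    onto y e with any? (λ r → z r ≟ᶠ y)
    ... | yes found = found
    ... | no none = ⊥-elim (root-of-unity-bound g (λ {r} {s} → g-inj r s) 𝟙 g-root)
      where
      g : Fin (suc (suc d)) → Fin q
      g zero = y
      g (suc r) = z r
      g-inj : ∀ r s → g r ≡ g s → r ≡ s
      g-inj zero zero eq = refl
      g-inj zero (suc s) eq = ⊥-elim (none (s , sym eq))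
      g-inj (suc r) zero eq = ⊥-elim (none (r , eq))
      g-inj (suc r) (suc s) eq = cong suc (z-inj r s eq)
      g-root : ∀ r → g r ^ᶠ suc d ≡ 𝟙
      g-root zero = e
      g-root (suc r) = z-^ r

-- Wilson's second moment argument

-- How large the field must be to choose n elements with prescribed classes of differences from sets of density 1/D:
-- each choice lowers the density of the remaining sets by a factor of at most 2d.
threshold : ℕ → ℕ → ℕ → ℕ
threshold d zero D = 0
threshold d (suc n) D = D * (n * (4 * d * d * D + 4 * d)) + threshold d n (2 * d * D)

module Wilson {q : ℕ} (F : FiniteField q) (d e-1 : ℕ) (q≡ : q ≡ suc (d * suc e-1)) (Z : Fermat.Roots F d) where
  open Field F
  open Fermat F
  open Roots Z

  e : ℕ
  e = suc e-1

  cls-label : ∀ x → x ≢ 𝟘 → ∃ λ r → root r ≡ x ^ᶠ e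
  cls-label x nx = root-onto _ (trans (sym (^-* x e d))
    (trans (cong (x ^ᶠ_) (*-comm e d)) (fermat q≡ x nx)))

  class-≢𝟘 : ∀ {x} r → x ^ᶠ e ≡ root r → x ≢ 𝟘
  class-≢𝟘 r eq x≡𝟘 = root-≢𝟘 r (trans (sym eq) (trans (cong (_^ᶠ e) x≡𝟘) (𝟘^suc e-1)))

  In : Fin q → Fin q → Fin d → Set
  In b x r = (x ⊝ b) ^ᶠ e ≡ root r

  in? : ∀ b x r → Dec (In b x r)
  in? b x r = (x ⊝ b) ^ᶠ e ≟ᶠ root r

  In⇒≢ : ∀ {b x r} → In b x r → x ≢ b
  In⇒≢ {b} {r = r} i refl = class-≢𝟘 r i (⊝-self b)

  private
    c : Fin q → Fin q → Fin d → ℕ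
    c b x r = ⟦ in? b x r ⟧

    In-unique : ∀ b x {r s} → In b x r → In b x s → r ≡ s
    In-unique b x i j = root-injective (trans (sym i) j)

    ∑c≤1 : ∀ b x → ∑ (c b x) ≤ 1
    ∑c≤1 b x = count-≤ (in? b x) 1 λ g inj sat → 0≢1 (inj (In-unique b x (sat zero) (sat (suc zero))))
      where
      0≢1 : (zero {1}) ≢ suc zero
      0≢1 ()

    ∑c≡ : ∀ b x → ∑ (c b x) ≡ ⟦ ¬? (b ≟ᶠ x) ⟧
    ∑c≡ b x with b ≟ᶠ x
    ... | yes refl = ∑-zero (λ r → ⟦⟧-no (in? b b r) (λ i → In⇒≢ {r = r} i refl))
    ... | no b≢x with cls-label (x ⊝ b) (⊝-≢𝟘 (b≢x ∘ sym))
    ... | r , eq = count-singleton (in? b x) r (sym eq) (λ s i → In-unique b x i (sym eq))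

    ∑∑c : ∀ x → ∑ (λ b → ∑ (c b x)) ≡ d * e
    ∑∑c x = trans (∑-cong (λ b → ∑c≡ b x)) (ℕ-suc-injective (trans
        (cong (_+ count (λ b → ¬? (b ≟ᶠ x))) (sym (count-singleton (λ b → b ≟ᶠ x) x refl (λ _ eq → eq))))
        (trans (count-¬ (λ b → b ≟ᶠ x)) q≡)))

    Same : Fin q → Fin q → Fin q → Set
    Same x x' b = (x ⊝ b) ^ᶠ e ≡ (x' ⊝ b) ^ᶠ e × x' ≢ b

    same? : ∀ x x' b → Dec (Same x x' b)
    same? x x' b = ((x ⊝ b) ^ᶠ e ≟ᶠ (x' ⊝ b) ^ᶠ e) ×-dec ¬? (x' ≟ᶠ b)

    ∑cc≤ : ∀ x x' b → ∑ (λ r → c b x r * c b x' r) ≤ ⟦ same? x x' b ⟧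
    ∑cc≤ x x' b with same? x x' b
    ... | yes _ = ≤-trans (∑-mono λ r → ≤-trans (*-monoʳ-≤ (c b x r) (⟦⟧-≤1 (in? b x' r))) (≤-reflexive (*-identityʳ _))) (∑c≤1 b x)
    ... | no ns = ≤-reflexive (∑-zero λ r → none r)
      where
      none : ∀ r → c b x r * c b x' r ≡ 0
      none r with in? b x r | in? b x' r
      ... | no _ | _ = refl
      ... | yes _ | no _ = refl
      ... | yes i | yes j = ⊥-elim (ns (trans i (sym j) , In⇒≢ {r = r} j))

    -- If `x ⊝ b` and `x' ⊝ b` have the same class, the e-th power of their quotient is 1. As a
    -- fractional linear function of `b` the quotient is injective, so there are at most `e` such
    -- `b`.
    same-count : ∀ x x' → x ≢ x' → count (same? x x') ≤ e
    same-count x x' ne = count-≤ (same? x x') e λ g inj sat →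
      root-of-unity-bound (λ r → (x ⊝ g r) ⊗ (x' ⊝ g r) ⁻¹)
        (λ {r} {s} eq → inj (ratio-injective (g r) (g s) (proj₂ (sat r)) (proj₂ (sat s)) eq)) 𝟙
        (λ r → ^-quotient e (⊝-≢𝟘 (proj₂ (sat r))) (proj₁ (sat r)))
      where
      ratio-injective : ∀ b b' → x' ≢ b → x' ≢ b' →
        (x ⊝ b) ⊗ (x' ⊝ b) ⁻¹ ≡ (x ⊝ b') ⊗ (x' ⊝ b') ⁻¹ → b ≡ b'
      ratio-injective b b' nb nb' eq = ⊝-≡𝟘 (⊗-cancelˡ (x ⊝ x') (⊝-≢𝟘 ne) (begin
        (x ⊝ x') ⊗ (b ⊝ b') ≡⟨ solve 4 (λ x x' b b' → (x :- x') :* (b :- b')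
                                                               := (x :- b) :* (x' :- b') :- (x :- b') :* (x' :- b)) refl x x' b b' ⟩
        (x ⊝ b) ⊗ (x' ⊝ b') ⊝ (x ⊝ b') ⊗ (x' ⊝ b) ≡⟨ cong (_⊝ (x ⊝ b') ⊗ (x' ⊝ b)) cross ⟩
        (x ⊝ b') ⊗ (x' ⊝ b) ⊝ (x ⊝ b') ⊗ (x' ⊝ b) ≡⟨ ⊝-self _ ⟩
        𝟘 ≡⟨ sym (⊗-𝟘ʳ _) ⟩
        (x ⊝ x') ⊗ 𝟘 ∎))
        where
        open ≡-Reasoning
        u = x ⊝ b
        v = x' ⊝ b
        u' = x ⊝ b'
        v' = x' ⊝ b'
        expand : ∀ s t → t ≢ 𝟘 → s ≡ (s ⊗ t ⁻¹) ⊗ t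
        expand s t nt = sym (trans (⊗-assoc _ _ _) (trans (cong (s ⊗_) (inverseˡ t nt)) (⊗-𝟙ʳ s)))
        cross : u ⊗ v' ≡ u' ⊗ v
        cross = begin
          u ⊗ v' ≡⟨ cong (_⊗ v') (expand u v (⊝-≢𝟘 nb)) ⟩
          (u ⊗ v ⁻¹) ⊗ v ⊗ v' ≡⟨ cong (λ t → t ⊗ v ⊗ v') eq ⟩
          (u' ⊗ v' ⁻¹) ⊗ v ⊗ v' ≡⟨ solve 3 (λ a v v' → a :* v :* v' := a :* v' :* v) refl (u' ⊗ v' ⁻¹) v v' ⟩
          (u' ⊗ v' ⁻¹) ⊗ v' ⊗ v ≡⟨ cong (_⊗ v) (sym (expand u' v' (⊝-≢𝟘 nb'))) ⟩
          u' ⊗ v ∎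

    ∑∑cc≤ : ∀ x x' → ∑ (λ b → ∑ (λ r → c b x r * c b x' r)) ≤ ⟦ x ≟ᶠ x' ⟧ * q + e
    ∑∑cc≤ x x' with x ≟ᶠ x'
    ... | yes refl = ≤-trans (∑-mono (λ b → ≤-trans (∑cc≤ x x b) (⟦⟧-≤1 (same? x x b))))
            (≤-trans (≤-reflexive (trans (∑-const q 1) (trans (*-identityʳ q) (sym (+-identityʳ q))))) (m≤m+n (q + 0) e))
    ... | no ne = ≤-trans (∑-mono (λ b → ∑cc≤ x x' b)) (same-count x x' ne)

  module _ {X : Fin q → Set} (X? : ∀ x → Dec (X x)) where
    size : ℕ
    size = count X?

    hits : Fin q → Fin d → ℕ
    hits b r = count (λ x → X? x ×-dec in? b x r)

    -- Fewer than half of the roughly `size / d` hits expected on average.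
    Bad : Fin d → Fin q → Set
    Bad r b = 2 * d * hits b r < size

    bad? : ∀ r b → Dec (Bad r b)
    bad? r b = 2 * d * hits b r <? size

    private
      χ : Fin q → ℕ
      χ x = ⟦ X? x ⟧

      hits≡ : ∀ b r → hits b r ≡ ∑ (λ x → χ x * c b x r)
      hits≡ b r = ∑-cong (λ x → ⟦⟧-× (X? x) (in? b x r))

      first-moment : ∑ (λ b → ∑ (hits b)) ≡ size * (d * e)
      first-moment = begin
        ∑ (λ b → ∑ (hits b)) ≡⟨ ∑-cong (λ b → ∑-cong (hits≡ b)) ⟩
        ∑ (λ b → ∑ (λ r → ∑ (λ x → χ x * c b x r))) ≡⟨ ∑-cong (λ b → ∑-swap (λ r x → χ x * c b x r)) ⟩
        ∑ (λ b → ∑ (λ x → ∑ (λ r → χ x * c b x r))) ≡⟨ ∑-swap (λ b x → ∑ (λ r → χ x * c b x r)) ⟩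
        ∑ (λ x → ∑ (λ b → ∑ (λ r → χ x * c b x r))) ≡⟨ ∑-cong (λ x → ∑-cong (λ b → ∑-*ˡ (χ x) (c b x))) ⟩
        ∑ (λ x → ∑ (λ b → χ x * ∑ (c b x))) ≡⟨ ∑-cong (λ x → ∑-*ˡ (χ x) (λ b → ∑ (c b x))) ⟩
        ∑ (λ x → χ x * ∑ (λ b → ∑ (c b x))) ≡⟨ ∑-cong (λ x → cong (χ x *_) (∑∑c x)) ⟩
        ∑ (λ x → χ x * (d * e)) ≡⟨ ∑-*ʳ χ (d * e) ⟩
        size * (d * e) ∎
        where open ≡-Reasoning

      square : ∀ {n} (f : Fin n → ℕ) → ∑ f * ∑ f ≡ ∑ (λ x → ∑ (λ x' → f x * f x'))
      square f = trans (sym (∑-*ʳ f (∑ f))) (∑-cong (λ x → sym (∑-*ˡ (f x) f)))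

      -- Squares of hit counts count pairs `x`, `x'` that have the same class as seen from `b`; over
      -- all `b`, a pair with `x` equal to `x'` contributes at most `q`, any other at most `e`.
      second-moment : ∑ (λ b → ∑ (λ r → hits b r * hits b r)) ≤ size * q + size * size * e
      second-moment = begin
        ∑ (λ b → ∑ (λ r → hits b r * hits b r))
          ≡⟨ ∑-cong (λ b → ∑-cong (λ r → trans (cong₂ _*_ (hits≡ b r) (hits≡ b r)) (square (λ x → χ x * c b x r)))) ⟩
        ∑ (λ b → ∑ (λ r → ∑ (λ x → ∑ (λ x' → χ x * c b x r * (χ x' * c b x' r)))))
          ≡⟨ ∑-cong (λ b → trans (∑-swap (λ r x → ∑ (λ x' → t b r x x'))) (∑-cong (λ x → ∑-swap (λ r x' → t b r x x')))) ⟩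
        ∑ (λ b → ∑ (λ x → ∑ (λ x' → ∑ (λ r → χ x * c b x r * (χ x' * c b x' r)))))
          ≡⟨ trans (∑-swap (λ b x → ∑ (λ x' → ∑ (λ r → t b r x x')))) (∑-cong (λ x → ∑-swap (λ b x' → ∑ (λ r → t b r x x')))) ⟩
        ∑ (λ x → ∑ (λ x' → ∑ (λ b → ∑ (λ r → χ x * c b x r * (χ x' * c b x' r)))))
          ≡⟨ ∑-cong (λ x → ∑-cong (λ x' → trans (∑-cong (λ b → trans (∑-cong (λ r → exchange (χ x) (c b x r) (χ x') (c b x' r)))
                (∑-*ˡ (χ x * χ x') (λ r → c b x r * c b x' r)))) (∑-*ˡ (χ x * χ x') (λ b → ∑ (λ r → c b x r * c b x' r))))) ⟩
        ∑ (λ x → ∑ (λ x' → χ x * χ x' * ∑ (λ b → ∑ (λ r → c b x r * c b x' r))))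
          ≤⟨ ∑-mono (λ x → ∑-mono (λ x' → *-monoʳ-≤ (χ x * χ x') (∑∑cc≤ x x'))) ⟩
        ∑ (λ x → ∑ (λ x' → χ x * χ x' * (⟦ x ≟ᶠ x' ⟧ * q + e)))
          ≤⟨ ∑-mono (λ x → ∑-mono (λ x' → drop x x')) ⟩
        ∑ (λ x → ∑ (λ x' → χ x * ⟦ x ≟ᶠ x' ⟧ * q + χ x * χ x' * e))
          ≡⟨ ∑-cong (λ x → trans (∑-+ (λ x' → χ x * ⟦ x ≟ᶠ x' ⟧ * q) (λ x' → χ x * χ x' * e)) (cong₂ _+_ (diag x) (offd x))) ⟩
        ∑ (λ x → χ x * q + χ x * size * e)
          ≡⟨ trans (∑-+ (λ x → χ x * q) (λ x → χ x * size * e)) (cong₂ _+_ (∑-*ʳ χ q)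
               (trans (∑-*ʳ (λ x → χ x * size) e) (cong (_* e) (∑-*ʳ χ size)))) ⟩
        size * q + size * size * e ∎
        where
        open ≤-Reasoning
        t : Fin q → Fin d → Fin q → Fin q → ℕ
        t b r x x' = χ x * c b x r * (χ x' * c b x' r)
        exchange : ∀ a b c d → a * b * (c * d) ≡ a * c * (b * d)
        exchange = solve-∀
        drop : ∀ x x' → χ x * χ x' * (⟦ x ≟ᶠ x' ⟧ * q + e) ≤ χ x * ⟦ x ≟ᶠ x' ⟧ * q + χ x * χ x' * e
        drop x x' = begin
          χ x * χ x' * (⟦ x ≟ᶠ x' ⟧ * q + e) ≡⟨ expand (χ x) (χ x') ⟦ x ≟ᶠ x' ⟧ q e ⟩
          χ x' * (χ x * ⟦ x ≟ᶠ x' ⟧ * q) + χ x * χ x' * e ≤⟨ +-monoˡ-≤ _ (*-monoˡ-≤ (χ x * ⟦ x ≟ᶠ x' ⟧ * q) (⟦⟧-≤1 (X? x'))) ⟩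
          1 * (χ x * ⟦ x ≟ᶠ x' ⟧ * q) + χ x * χ x' * e ≡⟨ cong (_+ χ x * χ x' * e) (*-identityˡ _) ⟩
          χ x * ⟦ x ≟ᶠ x' ⟧ * q + χ x * χ x' * e ∎
          where
          expand : ∀ a b i q e → a * b * (i * q + e) ≡ b * (a * i * q) + a * b * e
          expand = solve-∀
        diag : ∀ x → ∑ (λ x' → χ x * ⟦ x ≟ᶠ x' ⟧ * q) ≡ χ x * q
        diag x = trans (∑-*ʳ (λ x' → χ x * ⟦ x ≟ᶠ x' ⟧) q) (cong (_* q) (trans (∑-*ˡ (χ x) (λ x' → ⟦ x ≟ᶠ x' ⟧))
          (trans (cong (χ x *_) (count-singleton (x ≟ᶠ_) x refl (λ _ → sym))) (*-identityʳ (χ x)))))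
        offd : ∀ x → ∑ (λ x' → χ x * χ x' * e) ≡ χ x * size * e
        offd x = trans (∑-*ʳ (λ x' → χ x * χ x') e) (cong (_* e) (∑-*ˡ (χ x) χ))

      mean-deviation : ∀ a s → 4 * (a * s) ≤ a * a + 4 * (s * s)
      mean-deviation a s with ≤-total a (2 * s)
      ... | inj₁ le = subst₂ _≤_ (l a s) (r a s)
              (subst (λ t → 2 * (a * t) ≤ a * a + t * t) (m+[n∸m]≡n le) (small a (2 * s ∸ a)))
        where
        small : ∀ a t → 2 * (a * (a + t)) ≤ a * a + (a + t) * (a + t)
        small a t = ≤-trans (m≤m+n _ (t * t)) (≤-reflexive (id a t))
          where
          id : ∀ a t → 2 * (a * (a + t)) + t * t ≡ a * a + (a + t) * (a + t)
          id = solve-∀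
        l : ∀ a s → 2 * (a * (2 * s)) ≡ 4 * (a * s)
        l = solve-∀
        r : ∀ a s → a * a + 2 * s * (2 * s) ≡ a * a + 4 * (s * s)
        r = solve-∀
      ... | inj₂ ge = subst (λ t → 4 * (t * s) ≤ t * t + 4 * (s * s)) (m+[n∸m]≡n ge) (big s (a ∸ 2 * s))
        where
        big : ∀ s t → 4 * ((2 * s + t) * s) ≤ (2 * s + t) * (2 * s + t) + 4 * (s * s)
        big s t = ≤-trans (m≤m+n _ (t * t)) (≤-reflexive (id s t))
          where
          id : ∀ s t → 4 * ((2 * s + t) * s) + t * t ≡ (2 * s + t) * (2 * s + t) + 4 * (s * s)
          id = solve-∀

      large-deviation : ∀ a s → a ≤ s → 4 * (a * s) + s * s ≤ a * a + 4 * (s * s)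
      large-deviation a s le = subst (λ s → 4 * (a * s) + s * s ≤ a * a + 4 * (s * s)) (m+[n∸m]≡n le) (go a (s ∸ a))
        where
        go : ∀ a t → 4 * (a * (a + t)) + (a + t) * (a + t) ≤ a * a + 4 * ((a + t) * (a + t))
        go a t = ≤-trans (m≤m+n _ (2 * (a * t) + 3 * (t * t))) (≤-reflexive (id a t))
          where
          id : ∀ a t → 4 * (a * (a + t)) + (a + t) * (a + t) + (2 * (a * t) + 3 * (t * t)) ≡ a * a + 4 * ((a + t) * (a + t))
          id = solve-∀

      total-bad : ℕ
      total-bad = ∑ (λ b → ∑ (λ r → ⟦ bad? r b ⟧))

      -- The square of `2 * size - 2 * d * hits` is nonnegative, and at least `size * size` at a bad
      -- place; the cross term stands on the left to stay within the natural numbers.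
      pointwise : ∀ b r → 8 * d * size * hits b r + ⟦ bad? r b ⟧ * (size * size)
                          ≤ 4 * d * d * (hits b r * hits b r) + 4 * (size * size)
      pointwise b r with bad? r b
      ... | yes bad = ≤-trans (≤-reflexive (lhs d size (hits b r)))
              (≤-trans (large-deviation (2 * d * hits b r) size (<⇒≤ bad)) (≤-reflexive (rhs d size (hits b r))))
        where
        lhs : ∀ d s n → 8 * d * s * n + 1 * (s * s) ≡ 4 * (2 * d * n * s) + s * s
        lhs = solve-∀
        rhs : ∀ d s n → 2 * d * n * (2 * d * n) + 4 * (s * s) ≡ 4 * d * d * (n * n) + 4 * (s * s)
        rhs = solve-∀
      ... | no _ = ≤-trans (≤-reflexive (lhs d size (hits b r)))
              (≤-trans (mean-deviation (2 * d * hits b r) size) (≤-reflexive (rhs d size (hits b r))))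
        where
        lhs : ∀ d s n → 8 * d * s * n + 0 * (s * s) ≡ 4 * (2 * d * n * s)
        lhs = solve-∀
        rhs : ∀ d s n → 2 * d * n * (2 * d * n) + 4 * (s * s) ≡ 4 * d * d * (n * n) + 4 * (s * s)
        rhs = solve-∀

      summed : 8 * d * size * (size * (d * e)) + total-bad * (size * size)
               ≤ 4 * d * d * (size * q + size * size * e) + q * (d * (4 * (size * size)))
      summed = begin
        8 * d * size * (size * (d * e)) + total-bad * (size * size)
          ≡⟨ sym (trans (∑-cong (λ b → trans (∑-+ (λ r → 8 * d * size * hits b r) (λ r → ⟦ bad? r b ⟧ * (size * size)))
               (cong₂ _+_ (∑-*ˡ (8 * d * size) (hits b)) (∑-*ʳ (λ r → ⟦ bad? r b ⟧) (size * size)))))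
             (trans (∑-+ (λ b → 8 * d * size * ∑ (hits b)) (λ b → ∑ (λ r → ⟦ bad? r b ⟧) * (size * size)))
               (cong₂ _+_ (trans (∑-*ˡ (8 * d * size) (λ b → ∑ (hits b))) (cong (8 * d * size *_) first-moment))
                 (∑-*ʳ (λ b → ∑ (λ r → ⟦ bad? r b ⟧)) (size * size))))) ⟩
        ∑ (λ b → ∑ (λ r → 8 * d * size * hits b r + ⟦ bad? r b ⟧ * (size * size)))
          ≤⟨ ∑-mono (λ b → ∑-mono (pointwise b)) ⟩
        ∑ (λ b → ∑ (λ r → 4 * d * d * (hits b r * hits b r) + 4 * (size * size)))
          ≡⟨ trans (∑-cong (λ b → trans (∑-+ (λ r → 4 * d * d * (hits b r * hits b r)) (λ _ → 4 * (size * size)))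
               (cong₂ _+_ (∑-*ˡ (4 * d * d) (λ r → hits b r * hits b r)) (∑-const d (4 * (size * size))))))
             (trans (∑-+ (λ b → 4 * d * d * ∑ (λ r → hits b r * hits b r)) (λ _ → d * (4 * (size * size))))
               (cong₂ _+_ (∑-*ˡ (4 * d * d) (λ b → ∑ (λ r → hits b r * hits b r))) (∑-const q (d * (4 * (size * size)))))) ⟩
        4 * d * d * ∑ (λ b → ∑ (λ r → hits b r * hits b r)) + q * (d * (4 * (size * size)))
          ≤⟨ +-monoˡ-≤ _ (*-monoʳ-≤ (4 * d * d) second-moment) ⟩
        4 * d * d * (size * q + size * size * e) + q * (d * (4 * (size * size))) ∎
        where open ≤-Reasoning

    -- Chebyshev's inequality. As `q = d * e + 1`, the main terms `8 * d * d * e * (size * size)`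
    -- cancel, and `q ≤ size * D` turns what remains into a multiple of `size * size`. A single
    -- class `r` is bounded by the sum over all classes.
    bad-bound : ∀ D r → q ≤ size * D → count (bad? r) ≤ 4 * d * d * D + 4 * d
    bad-bound D r q≤ = ≤-trans (∑-mono (λ b → ∑-term (λ r → ⟦ bad? r b ⟧) r)) (cancel size≢0 (begin
      8 * d * d * e * (size * size) + total-bad * (size * size)
        ≡⟨ cong (_+ total-bad * (size * size)) (l d size e) ⟩
      8 * d * size * (size * (d * e)) + total-bad * (size * size)
        ≤⟨ summed ⟩
      4 * d * d * (size * q + size * size * e) + q * (d * (4 * (size * size)))
        ≡⟨ cong (λ t → 4 * d * d * (size * q + size * size * e) + t * (d * (4 * (size * size)))) q≡ ⟩
      4 * d * d * (size * q + size * size * e) + suc (d * e) * (d * (4 * (size * size)))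
        ≤⟨ +-monoˡ-≤ _ (*-monoʳ-≤ (4 * d * d) (+-monoˡ-≤ _ (*-monoʳ-≤ size q≤))) ⟩
      4 * d * d * (size * (size * D) + size * size * e) + suc (d * e) * (d * (4 * (size * size)))
        ≡⟨ r' d size e D ⟩
      8 * d * d * e * (size * size) + (4 * d * d * D + 4 * d) * (size * size) ∎))
      where
      open ≤-Reasoning
      l : ∀ d s e → 8 * d * d * e * (s * s) ≡ 8 * d * s * (s * (d * e))
      l = solve-∀
      r' : ∀ d s e D → 4 * d * d * (s * (s * D) + s * s * e) + (1 + d * e) * (d * (4 * (s * s)))
             ≡ 8 * d * d * e * (s * s) + (4 * d * d * D + 4 * d) * (s * s)
      r' = solve-∀
      size≢0 : size ≢ 0
      size≢0 eq = contradiction (subst (_≤ 0) q≡ (subst (q ≤_) (cong (_* D) eq) q≤)) λ ()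
      cancel : ∀ {s x y z} → s ≢ 0 → z + x * (s * s) ≤ z + y * (s * s) → x ≤ y
      cancel {zero} s≢0 _ = contradiction refl s≢0
      cancel {suc s} {x} {y} {z} _ le = *-cancelʳ-≤ x y (suc s * suc s) (+-cancelˡ-≤ z _ _ le)

  -- Greedy choice: the first element avoids the places bad for any of the remaining sets, each of
  -- which is then cut down to its required class relative to this element.
  choose : ∀ n {X : Fin n → Fin q → Set} (X? : ∀ i x → Dec (X i x)) D →
    (∀ i → q ≤ count (X? i) * D) → threshold d n D < q → (lab : ∀ i j → i Fin.< j → Fin d) →
    ∃ λ (b : Fin n → Fin q) → (∀ i → X i (b i)) × (∀ i j lt → (b j ⊝ b i) ^ᶠ e ≡ root (lab i j lt))
  choose zero X? D big large lab = (λ ()) , (λ ()) , λ ()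
  choose (suc n) {X} X? D big large lab = result
    where
    lab₀ : Fin n → Fin d
    lab₀ i = lab zero (suc i) (s≤s z≤n)
    badAt : Fin n → Fin q → ℕ
    badAt i b = ⟦ bad? (X? (suc i)) (lab₀ i) b ⟧
    K : ℕ
    K = n * (4 * d * d * D + 4 * d)
    K< : K < count (X? zero)
    K< = *-cancelˡ-< D K (count (X? zero)) (<-≤-trans (≤-<-trans (m≤m+n (D * K) (threshold d n (2 * d * D))) large)
      (≤-trans (big zero) (≤-reflexive (*-comm (count (X? zero)) D))))
    few : ∑ (λ b → ∑ (λ i → badAt i b)) < count (X? zero)
    few = ≤-<-trans
      (≤-trans (≤-reflexive (∑-swap (λ b i → badAt i b)))
        (≤-trans (∑-mono (λ i → bad-bound (X? (suc i)) D (lab₀ i) (big (suc i))))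
          (≤-reflexive (∑-const n (4 * d * d * D + 4 * d)))))
      K<
    pick : ∃ λ b → ∑ (λ i → badAt i b) < ⟦ X? zero b ⟧
    pick = ∑-<⇒∃ (λ b → ∑ (λ i → badAt i b)) (λ b → ⟦ X? zero b ⟧) few
    b₀ : Fin q
    b₀ = proj₁ pick
    Xb₀ : X zero b₀
    Xb₀ = ⟦⟧-pos (X? zero b₀) (≤-<-trans z≤n (proj₂ pick))
    good : ∀ i → ¬ Bad (X? (suc i)) (lab₀ i) b₀
    good i bad = <⇒≱ (proj₂ pick) (≤-trans (⟦⟧-≤1 (X? zero b₀))
      (≤-trans (≤-reflexive (sym (⟦⟧-yes (bad? (X? (suc i)) (lab₀ i) b₀) bad))) (∑-term (λ i → badAt i b₀) i)))
    X'? : ∀ i x → Dec (X (suc i) x × In b₀ x (lab₀ i))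
    X'? i x = X? (suc i) x ×-dec in? b₀ x (lab₀ i)
    big' : ∀ i → q ≤ count (X'? i) * (2 * d * D)
    big' i = ≤-trans (big (suc i)) (≤-trans (*-monoˡ-≤ D (≮⇒≥ (good i)))
      (≤-reflexive (rearr (2 * d) (count (X'? i)) D)))
      where
      rearr : ∀ a h D → a * h * D ≡ h * (a * D)
      rearr = solve-∀
    rest : ∃ λ (b : Fin n → Fin q) → (∀ i → X (suc i) (b i) × In b₀ (b i) (lab₀ i)) ×
             (∀ i j lt → (b j ⊝ b i) ^ᶠ e ≡ root (lab (suc i) (suc j) (s≤s lt)))
    rest = choose n X'? (2 * d * D) big' (≤-<-trans (m≤n+m (threshold d n (2 * d * D)) (D * K)) large) (λ i j lt → lab (suc i) (suc j) (s≤s lt))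
    b : Fin (suc n) → Fin q
    b zero = b₀
    b (suc i) = proj₁ rest i
    result : ∃ λ (b : Fin (suc n) → Fin q) → (∀ i → X i (b i)) × (∀ i j lt → (b j ⊝ b i) ^ᶠ e ≡ root (lab i j lt))
    result = b , inX , differences
      where
      inX : ∀ i → X i (b i)
      inX zero = Xb₀
      inX (suc i) = proj₁ (proj₁ (proj₂ rest) i)
      differences : ∀ i j lt → (b j ⊝ b i) ^ᶠ e ≡ root (lab i j lt)
      differences zero (suc j) (s≤s z≤n) = proj₂ (proj₁ (proj₂ rest) j)
      differences (suc i) (suc j) (s≤s lt) = proj₂ (proj₂ rest) i j lt

-- Primes with an element of prescribed order

coprime-product-∣ : ∀ {x y n} → Coprime x y → x ∣ n → y ∣ n → x * y ∣ n
coprime-product-∣ {x} {y} c (divides-refl k) y∣n =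
  subst (x * y ∣_) (*-comm x k) (*-monoʳ-∣ x (coprime-divisor (Coprime.sym c) (subst (y ∣_) (*-comm k x) y∣n)))

gcd-factor : ∀ {y n b} → Coprime n b → y ∣ n * b → gcd y n * gcd y b ≡ y
gcd-factor {y} {n} {b} cop y∣ = ∣-antisym
  (coprime-product-∣ (λ (d∣l , d∣r) → cop (∣-trans d∣l (gcd[m,n]∣n y n) , ∣-trans d∣r (gcd[m,n]∣n y b)))
    (gcd[m,n]∣m y n) (gcd[m,n]∣m y b))
  (subst (y ∣_) (sym (c*gcd[m,n]≡gcd[cm,cn] (gcd y n) y b))
    (gcd-greatest (n∣m*n (gcd y n))
      (subst (y ∣_) (trans (sym (c*gcd[m,n]≡gcd[cm,cn] b y n)) (*-comm b (gcd y n)))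
        (gcd-greatest (n∣m*n b) (subst (y ∣_) (*-comm n b) y∣)))))

prime-≢⇒coprime : ∀ {p q} → Prime p → Prime q → p ≢ q → Coprime p q
prime-≢⇒coprime pp pq ne (d∣p , d∣q) with prime⇒irreducible pp d∣p | prime⇒irreducible pq d∣q
... | inj₁ d≡1 | _ = d≡1
... | inj₂ _ | inj₁ d≡1 = d≡1
... | inj₂ refl | inj₂ eq = contradiction eq ne

prime-divisor : ∀ n → 2 ≤ n → ∃ λ p → Prime p × p ∣ n
prime-divisor n 2≤n with factorise n ⦃ >-nonZero (≤-trans (s≤s z≤n) 2≤n) ⦄
... | record { factors = [] ; isFactorisation = eq } = contradiction (subst (2 ≤_) eq 2≤n) λ { (s≤s ()) }
... | record { factors = p ∷ ps ; isFactorisation = eq ; factorsPrime = pp ∷ _ } = p , pp , subst (p ∣_) (sym eq) (m∣m*n (product ps))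

data DistinctPrimes : List ℕ → Set where
  [] : DistinctPrimes []
  _∷_ : ∀ {q qs} → Prime q × All (λ q' → Prime q' × Coprime q q') qs → DistinctPrimes qs → DistinctPrimes (q ∷ qs)

coprime-product : ∀ {q} qs → All (λ q' → Prime q' × Coprime q q') qs → Coprime q (product qs)
coprime-product [] [] (_ , d∣1) = ∣1⇒≡1 d∣1
coprime-product (q' ∷ qs) ((_ , c) ∷ cs) {d} (d∣q , d∣p) =
  coprime-product qs cs (d∣q , coprime-divisor (λ (x∣d , x∣q') → c (∣-trans x∣d d∣q , x∣q')) d∣p)

-- The bound `n` is the variable of the recursion; for `n = M > 0` the product of the list is the
-- radical of `M`.
record PrimeSupport (M n : ℕ) : Set where
  field
    primes : List ℕ
    distinct : DistinctPrimes primes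
    bounded : All (_≤ n) primes
    allPrime : All (λ q → Prime q × q ∣ M) primes
    complete : ∀ q → Prime q → q ∣ M → q ≤ n → q ∈ primes
    product∣ : product primes ∣ M

primeSupport : ∀ M n → PrimeSupport M n
primeSupport M zero = record
  { primes = [] ; distinct = [] ; bounded = [] ; allPrime = []
  ; complete = λ q pq _ q≤0 → contradiction (≤-trans (>-nonZero⁻¹ q ⦃ prime⇒nonZero pq ⦄) q≤0) λ ()
  ; product∣ = divides M (sym (*-identityʳ M)) }
primeSupport M (suc n) with primeSupport M n | prime? (suc n) ×-dec (suc n ∣? M)
... | S | no none = record
  { PrimeSupport S ; bounded = All.map m≤n⇒m≤1+n (PrimeSupport.bounded S)
  ; complete = λ q pq q∣M q≤ → case-≤ q pq q∣M (m≤n⇒m<n∨m≡n q≤) }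
  where
  case-≤ : ∀ q → Prime q → q ∣ M → q < suc n ⊎ q ≡ suc n → q ∈ PrimeSupport.primes S
  case-≤ q pq q∣M (inj₁ (s≤s le)) = PrimeSupport.complete S q pq q∣M le
  case-≤ q pq q∣M (inj₂ refl) = contradiction (pq , q∣M) none
... | S | yes (pq , q∣M) = record
  { primes = suc n ∷ PrimeSupport.primes S
  ; distinct = (pq , cops) ∷ PrimeSupport.distinct S
  ; bounded = ≤-refl ∷ All.map m≤n⇒m≤1+n (PrimeSupport.bounded S)
  ; allPrime = (pq , q∣M) ∷ PrimeSupport.allPrime S
  ; complete = λ q pq q∣M q≤ → case-≤ q pq q∣M (m≤n⇒m<n∨m≡n q≤)
  ; product∣ = coprime-product-∣ (coprime-product _ cops) q∣M (PrimeSupport.product∣ S) }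
  where
  cops : All (λ q' → Prime q' × Coprime (suc n) q') (PrimeSupport.primes S)
  cops = All.zipWith (λ ((pq' , _) , q'≤n) → pq' , λ {d} → prime-≢⇒coprime pq pq' (λ { refl → <-irrefl refl q'≤n }) {d})
    (PrimeSupport.allPrime S , PrimeSupport.bounded S)
  case-≤ : ∀ q → Prime q → q ∣ M → q < suc n ⊎ q ≡ suc n → q ∈ suc n ∷ PrimeSupport.primes S
  case-≤ q pq q∣M (inj₁ (s≤s le)) = there (PrimeSupport.complete S q pq q∣M le)
  case-≤ q pq q∣M (inj₂ refl) = here refl

-- Divisors of a^e - 1 and values of cyclotomic polynomials

module Cyclotomic (a-3 : ℕ) where
  a : ℕ
  a = 3 + a-3

  A : ℕ → ℕ
  A e = a ^ e ∸ 1

  1+A : ∀ e → suc (A e) ≡ a ^ e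
  1+A e = m+[n∸m]≡n (m^n>0 a e)

  A-+ : ∀ s t → A (s + t) ≡ a ^ s * A t + A s
  A-+ s t = ℕ-suc-injective (begin
    suc (A (s + t)) ≡⟨ 1+A (s + t) ⟩
    a ^ (s + t) ≡⟨ ^-distribˡ-+-* a s t ⟩
    a ^ s * a ^ t ≡⟨ cong (a ^ s *_) (sym (1+A t)) ⟩
    a ^ s * suc (A t) ≡⟨ *-suc (a ^ s) (A t) ⟩
    a ^ s + a ^ s * A t ≡⟨ +-comm (a ^ s) _ ⟩
    a ^ s * A t + a ^ s ≡⟨ cong (a ^ s * A t +_) (sym (1+A s)) ⟩
    a ^ s * A t + suc (A s) ≡⟨ +-suc _ (A s) ⟩
    suc (a ^ s * A t + A s) ∎)
    where open ≡-Reasoning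

  A-∣ : ∀ m t → A t ∣ A (m * t)
  A-∣ zero t = A t ∣0
  A-∣ (suc m) t = subst (A t ∣_) (sym (A-+ t (m * t))) (∣m∣n⇒∣m+n (∣n⇒∣m*n (a ^ t) (A-∣ m t)) ∣-refl)

  coprime-a^ : ∀ s {d} → d ∣ A s → Coprime d (a ^ s)
  coprime-a^ s {d} d∣A {c} (c∣d , c∣a^s) =
    ∣1⇒≡1 (∣m+n∣m⇒∣n {m = A s} (subst (c ∣_) (trans (sym (1+A s)) (+-comm 1 (A s))) c∣a^s) (∣-trans c∣d d∣A))

  A-difference : ∀ s t {d} → d ∣ A (s + t) → d ∣ A s → d ∣ A t
  A-difference s t {d} d∣st d∣s = coprime-divisor (coprime-a^ s d∣s)
    (∣m+n∣m⇒∣n {m = A s} (subst (d ∣_) (trans (A-+ s t) (+-comm _ (A s))) d∣st) d∣s)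

  -- Bézout in the exponents: multiples of `q * t` and `q' * t` differ by `t`, and `A-difference`
  -- passes to the difference.
  A-coprime : ∀ {q q'} t {d} → Coprime q q' → d ∣ A (q * t) → d ∣ A (q' * t) → d ∣ A t
  A-coprime {q} {q'} t {d} c d∣q d∣q' with coprime-Bézout c
  ... | Bézout.+- x y eq = A-difference (y * q' * t) t
          (subst (λ n → d ∣ A n) (rearr x q y q' t eq) (∣-trans d∣q (A-∣ x (q * t)))) (subst (λ n → d ∣ A n) (sym (*-assoc y q' t)) (∣-trans d∣q' (A-∣ y (q' * t))))
    where
    rearr : ∀ x q y q' t → 1 + y * q' ≡ x * q → x * (q * t) ≡ y * q' * t + t
    rearr x q y q' t eq = trans (sym (*-assoc x q t)) (trans (cong (_* t) (sym eq)) (+-comm t _))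
  ... | Bézout.-+ x y eq = A-difference (x * q * t) t
          (subst (λ n → d ∣ A n) (rearr y q' x q t eq) (∣-trans d∣q' (A-∣ y (q' * t)))) (subst (λ n → d ∣ A n) (sym (*-assoc x q t)) (∣-trans d∣q (A-∣ x (q * t))))
    where
    rearr : ∀ x q y q' t → 1 + y * q' ≡ x * q → x * (q * t) ≡ y * q' * t + t
    rearr x q y q' t eq = trans (sym (*-assoc x q t)) (trans (cong (_* t) (sym eq)) (+-comm t _))

  -- `N` is the geometric sum 1 + a^t + ... + a^((q-1)t), which is congruent to `q` modulo `A t`.
  geometric : ∀ q t → ∃ λ N → A (q * t) ≡ N * A t × ∃ λ W → N ≡ q + W * A t
  geometric zero t = 0 , refl , 0 , refl
  geometric (suc q) t with geometric q t
  ... | N , eq , W , eq' = a ^ (q * t) + N , step₁ , N + W , step₂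
    where
    open ≡-Reasoning
    step₁ : A (t + q * t) ≡ (a ^ (q * t) + N) * A t
    step₁ = begin
      A (t + q * t) ≡⟨ cong A (+-comm t (q * t)) ⟩
      A (q * t + t) ≡⟨ A-+ (q * t) t ⟩
      a ^ (q * t) * A t + A (q * t) ≡⟨ cong (a ^ (q * t) * A t +_) eq ⟩
      a ^ (q * t) * A t + N * A t ≡⟨ sym (*-distribʳ-+ (A t) (a ^ (q * t)) N) ⟩
      (a ^ (q * t) + N) * A t ∎
    step₂ : a ^ (q * t) + N ≡ suc q + (N + W) * A t
    step₂ = begin
      a ^ (q * t) + N ≡⟨ cong₂ _+_ (sym (1+A (q * t))) eq' ⟩
      suc (A (q * t)) + (q + W * A t) ≡⟨ cong (λ z → suc z + (q + W * A t)) eq ⟩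
      suc (N * A t) + (q + W * A t) ≡⟨ arith N (A t) q W ⟩
      suc q + (N + W) * A t ∎
      where
      arith : ∀ n x q w → suc (n * x) + (q + w * x) ≡ suc q + (n + w) * x
      arith = solve-∀

  -- A common divisor of `N` and `A t` divides `q` by the congruence for the geometric sum, hence
  -- `a`; but divisors of `A t` are coprime to `a`.
  unitary : ∀ q t → 0 < t → q ∣ a → ∃ λ N → A (q * t) ≡ N * A t × Coprime N (A t)
  unitary q t t>0 q∣a with geometric q t
  ... | N , eq , W , eq' = N , eq , λ {d} (d∣N , d∣A) →
    coprime-a^ t d∣A (∣-refl , ∣-trans (∣-trans (∣m+n∣m⇒∣n {m = W * A t} (subst (d ∣_) (trans eq' (+-comm q _)) d∣N) (∣n⇒∣m*n W d∣A)) q∣a) (a∣a^ t t>0))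
    where
    a∣a^ : ∀ t → 0 < t → a ∣ a ^ t
    a∣a^ (suc t) _ = m∣m*n (a ^ t)

  -- This holds for x = 1 and all s, but for the values of cyclotomic polynomials below only up to s = g: hence they
  -- are not 1.
  Unit : ℕ → ℕ → Set
  Unit s x = a ^ s ∣ x * x ∸ 1

  unit-1 : ∀ s → Unit s 1
  unit-1 s = (a ^ s) ∣0

  square-identity : ∀ x y → 0 < x → 0 < y → x * y * (x * y) ∸ 1 ≡ x * x * (y * y ∸ 1) + (x * x ∸ 1)
  square-identity (suc x) (suc y) _ _ = ℕ-suc-injective (arith (suc x * suc x) (y + y * suc y) (x + x * suc x) refl (suc x) (suc y) refl refl)
    where
    arith : ∀ X Y X' → X ≡ suc X' → ∀ u v → u * u ≡ X → v * v ≡ suc Y → u * v * (u * v) ≡ suc (X * Y + X')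
    arith X Y X' eX u v eu ev = trans (mid u v) (trans (cong₂ _*_ eu ev) (trans (*-suc X Y)
      (trans (+-comm X (X * Y)) (trans (cong (X * Y +_) eX) (+-suc (X * Y) X')))))
      where
      mid : ∀ u v → u * v * (u * v) ≡ u * u * (v * v)
      mid = solve-∀

  -- Working with squares makes signs disappear: `A e` is -1 modulo `a ^ e`, and its sign would
  -- otherwise have to be followed through products and quotients.
  unit-cancel : ∀ s x y → 0 < x → 0 < y → Unit s (x * y) → Unit s y → Unit s x
  unit-cancel s x y px py uxy uy =
    ∣m+n∣m⇒∣n {m = x * x * (y * y ∸ 1)} (subst (a ^ s ∣_) (square-identity x y px py) uxy) (∣n⇒∣m*n (x * x) uy)

  unit-weaken : ∀ {s t} x → s ≤ t → Unit t x → Unit s x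
  unit-weaken {s} {t} x s≤t u = ∣-trans (subst (a ^ s ∣_) (trans (sym (^-distribˡ-+-* a s (t ∸ s))) (cong (a ^_) (m+[n∸m]≡n s≤t))) (m∣m*n (a ^ (t ∸ s)))) u

  A-square : ∀ e → 0 < e → A e * A e ∸ 1 ≡ a ^ e * (a ^ e ∸ 2)
  A-square e e>0 = go (a ^ e) (≤-trans (s≤s (s≤s z≤n)) (a≤a^ e e>0))
    where
    a≤a^ : ∀ e → 0 < e → a ≤ a ^ e
    a≤a^ (suc e) _ = m≤m*n a (a ^ e) ⦃ m^n≢0 a e ⦄
    go : ∀ b → 2 ≤ b → (b ∸ 1) * (b ∸ 1) ∸ 1 ≡ b * (b ∸ 2)
    go (suc zero) (s≤s ())
    go (suc (suc b)) _ = arith b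
      where
      arith : ∀ b → b + b * suc b ≡ suc (suc b) * b
      arith = solve-∀

  A-unit : ∀ e → 0 < e → Unit e (A e)
  A-unit e e>0 = subst (a ^ e ∣_) (sym (A-square e e>0)) (m∣m*n (a ^ e ∸ 2))

  -- By `A-square`, one more factor `a` would divide `a ^ e ∸ 2` and hence 2; the base is at least 3
  -- to exclude this.
  A-nonunit : ∀ e → 0 < e → ¬ Unit (suc e) (A e)
  A-nonunit e e>0 u = contradiction (∣⇒≤ a∣2) λ { (s≤s (s≤s ())) }
    where
    a∣ : a ∣ a ^ e ∸ 2
    a∣ = *-cancelˡ-∣ (a ^ e) ⦃ m^n≢0 a e ⦄ (subst₂ _∣_ (*-comm a (a ^ e)) (A-square e e>0) u)
    a∣a^ : ∀ e → 0 < e → a ∣ a ^ e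
    a∣a^ (suc e) _ = m∣m*n (a ^ e)
    2≤a^ : ∀ e → 0 < e → 2 ≤ a ^ e
    2≤a^ (suc e) _ = ≤-trans (s≤s (s≤s z≤n)) (m≤m*n a (a ^ e) ⦃ m^n≢0 a e ⦄)
    a∣2 : a ∣ 2
    a∣2 = ∣m+n∣m⇒∣n {m = a ^ e ∸ 2} (subst (a ∣_) (sym (m∸n+n≡m (2≤a^ e e>0))) (a∣a^ e e>0)) a∣

  -- For e = g * product qs this is the value at a^g of the cyclotomic polynomial of index product qs.
  record Φ (e g : ℕ) (qs : List ℕ) : Set where
    field
      val : ℕ
      val>0 : 0 < val
      divisor : val ∣ A e
      coprime : ∀ {q} → q ∈ qs → ∀ e' → q * e' ≡ e → Coprime val (A e')
      greatest : ∀ d → d ∣ A e → (∀ {q} → q ∈ qs → ∀ e' → q * e' ≡ e → Coprime d (A e')) → d ∣ val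
      unit : Unit g val
      nonunit : ¬ Unit (suc g) val

  A>0 : ∀ e → 0 < e → 0 < A e
  A>0 (suc e) _ = m<n⇒0<n∸m {1} (≤-trans (s≤s (s≤s z≤n)) (m≤m*n a (a ^ e) ⦃ m^n≢0 a e ⦄))

  ∣-pos : ∀ {m n} → m ∣ n → 0 < n → 0 < m
  ∣-pos {zero} 0∣n n>0 = contradiction (subst (0 <_) (0∣⇒≡0 0∣n) n>0) λ ()
  ∣-pos {suc m} _ _ = s≤s z≤n

  -- The recursion is the identity Φ_qP(x) Φ_P(x) = Φ_P(x^q) for a prime `q` not dividing P, at x =
  -- `a ^ g`; the three values are `X`, `Z.val` and `Y`. As `Y` satisfies `Unit` at level `q * g`,
  -- which exceeds `g`, the exact level `g` passes from `Z.val` to `X`.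
  cyclotomic : ∀ qs → DistinctPrimes qs → All (_∣ a) qs → ∀ g → 0 < g → Φ (product qs * g) g qs
  cyclotomic [] [] [] g g>0 = record
    { val = A (1 * g) ; val>0 = A>0 _ 1g>0 ; divisor = ∣-refl ; coprime = λ () ; greatest = λ d d∣ _ → d∣
    ; unit = subst (λ h → Unit g (A h)) (sym (*-identityˡ g)) (A-unit g g>0)
    ; nonunit = A-nonunit g g>0 ∘ subst (λ h → Unit (suc g) (A h)) (*-identityˡ g) }
    where
    1g>0 : 0 < 1 * g
    1g>0 = subst (0 <_) (sym (*-identityˡ g)) g>0
  cyclotomic (q ∷ qs) ((pq , cops) ∷ dist) (q∣a ∷ qs∣a) g g>0 = record
    { val = X ; val>0 = X>0 ; divisor = ∣-trans X∣Y Y∣A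
    ; coprime = λ { (here refl) e' eq → subst (λ t → Coprime X (A t)) (sym (*-cancelˡ-≡ e' e₁ q ⦃ prime⇒nonZero pq ⦄ (trans eq e≡)))
                      (λ (d∣X , d∣A) → N-coprime (∣-trans d∣X (gcd[m,n]∣n Y N) , d∣A))
                  ; (there q∈) e' eq (d∣X , d∣A) → Y.coprime q∈ e' (trans eq (sym Ye≡)) (∣-trans d∣X X∣Y , d∣A) }
    ; greatest = λ d d∣A cop → gcd-greatest
        (Y.greatest d (subst (λ t → d ∣ A t) (sym Ye≡) d∣A) (λ q∈ e' eq → cop (there q∈) e' (trans eq Ye≡)))
        (coprime-divisor (cop (here refl) e₁ (sym e≡)) (subst (d ∣_) (trans AN (*-comm N (A e₁))) (subst (λ t → d ∣ A t) e≡ d∣A)))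
    ; unit = unit-cancel g X Z.val X>0 Z.val>0 (subst (Unit g) (sym XZ) (unit-weaken Y (m≤n*m g q ⦃ prime⇒nonZero pq ⦄) Y.unit)) Z.unit
    ; nonunit = λ u → Z.nonunit (unit-cancel (suc g) Z.val X Z.val>0 X>0
        (subst (Unit (suc g)) (trans (sym XZ) (*-comm X Z.val)) (unit-weaken Y g<qg Y.unit)) u) }
    where
    module Y = Φ (cyclotomic qs dist qs∣a (q * g) (≤-trans g>0 (m≤n*m g q ⦃ prime⇒nonZero pq ⦄)))
    module Z = Φ (cyclotomic qs dist qs∣a g g>0)
    e₁ = product qs * g
    Y = Y.val
    e≡ : q * product qs * g ≡ q * e₁
    e≡ = *-assoc q (product qs) g
    Ye≡ : product qs * (q * g) ≡ q * product qs * g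
    Ye≡ = arith (product qs) q g
      where
      arith : ∀ p q g → p * (q * g) ≡ q * p * g
      arith = solve-∀
    q≥2 : 2 ≤ q
    q≥2 = nonTrivial⇒n>1 q ⦃ prime⇒nonTrivial pq ⦄
    g<qg : suc g ≤ q * g
    g<qg = ≤-trans (subst (suc g ≤_) (cong (g +_) (sym (+-identityʳ g))) (+-monoˡ-≤ g g>0)) (*-monoˡ-≤ g q≥2)
    product>0 : ∀ ps → All (λ q' → Prime q' × Coprime q q') ps → 0 < product ps
    product>0 [] [] = s≤s z≤n
    product>0 (p ∷ ps) ((pp , _) ∷ rest) = *-mono-< (>-nonZero⁻¹ p ⦃ prime⇒nonZero pp ⦄) (product>0 ps rest)
    e₁>0 : 0 < e₁
    e₁>0 = *-mono-< (product>0 qs cops) g>0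
    split = unitary q e₁ e₁>0 q∣a
    N = proj₁ split
    AN : A (q * e₁) ≡ N * A e₁
    AN = proj₁ (proj₂ split)
    N-coprime : Coprime N (A e₁)
    N-coprime = proj₂ (proj₂ split)
    -- A gcd instead of the quotient of `Y` by `Z.val`: it removes from `Y` exactly what is shared
    -- with `A e₁`, so that coprimality and maximality of `X` come directly.
    X = gcd Y N
    X∣Y : X ∣ Y
    X∣Y = gcd[m,n]∣m Y N
    Y∣A : Y ∣ A (q * product qs * g)
    Y∣A = subst (λ t → Y ∣ A t) Ye≡ Y.divisor
    X>0 : 0 < X
    X>0 = ∣-pos X∣Y Y.val>0
    Z∣Y : Z.val ∣ Y
    Z∣Y = Y.greatest Z.val (∣-trans Z.divisor (subst (λ t → A e₁ ∣ A t) (trans (sym e≡) (sym Ye≡)) (A-∣ q e₁)))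
      λ {q'} q'∈ e' eq {d} (d∣Z , d∣A) → helper q' q'∈ e' eq d d∣Z d∣A
      where
      helper : ∀ q' → q' ∈ qs → ∀ e' → q' * e' ≡ product qs * (q * g) → ∀ d → d ∣ Z.val → d ∣ A e' → d ≡ 1
      helper q' q'∈ e' eq d d∣Z d∣A = Z.coprime q'∈ e'' q'e'' (d∣Z , A-coprime {q} {q'} e'' (proj₂ ok) (subst (λ t → d ∣ A t) e'≡ d∣A)
          (subst (λ t → d ∣ A t) (sym q'e'') (∣-trans d∣Z Z.divisor)))
        where
        ok : Prime q' × Coprime q q'
        ok = All.lookup cops q'∈
        q∣e' : q ∣ e'
        q∣e' = coprime-divisor (proj₂ ok) (subst (q ∣_) (sym (trans eq (trans Ye≡ e≡))) (m∣m*n e₁))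
        e'' = quotient q∣e'
        e'≡ : e' ≡ q * e''
        e'≡ = m∣n⇒n≡m*quotient q∣e'
        q'e'' : q' * e'' ≡ e₁
        q'e'' = *-cancelˡ-≡ (q' * e'') e₁ q ⦃ prime⇒nonZero pq ⦄ (trans (arith q q' e'') (trans (cong (q' *_) (sym e'≡)) (trans eq (trans Ye≡ e≡))))
          where
          arith : ∀ q q' e → q * (q' * e) ≡ q' * (q * e)
          arith = solve-∀
    gcd≡Z : gcd Y (A e₁) ≡ Z.val
    gcd≡Z = ∣-antisym
      (Z.greatest (gcd Y (A e₁)) (gcd[m,n]∣n Y (A e₁)) λ {q'} q'∈ e'' eq (d∣g , d∣A) →
        Y.coprime q'∈ (q * e'') (trans (arith q q' e'') (trans (cong (q *_) eq) (trans (sym e≡) (sym Ye≡))))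
          (∣-trans d∣g (gcd[m,n]∣m Y (A e₁)) , ∣-trans d∣A (A-∣ q e'')))
      (gcd-greatest Z∣Y Z.divisor)
      where
      arith : ∀ q q' e → q' * (q * e) ≡ q * (q' * e)
      arith = solve-∀
    XZ : X * Z.val ≡ Y
    XZ = trans (cong (X *_) (sym gcd≡Z)) (gcd-factor N-coprime (subst (Y ∣_) (trans (cong A e≡) AN) Y∣A))

-- In other words, a has order M modulo p.
record PrimitivePrime (M N : ℕ) : Set where
  field
    p : ℕ
    isPrime : Prime p
    large : N < p
    a : ℕ
    order-∣ : p ∣ a ^ M ∸ 1
    order-∤ : ∀ q e → Prime q → q * e ≡ M → ¬ p ∣ a ^ e ∸ 1
    a∤ : ¬ p ∣ a

-- The value used is that of the cyclotomic polynomial of index `M` at `a`, written with the radical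
-- of `M` as index and `a ^ g` as argument. It is not 1, and it is coprime to `A e` whenever `M` is
-- a prime times `e`.
primitivePrime : ∀ M N → 0 < M → PrimitivePrime M N
primitivePrime M N M>0 = record
  { p = p ; isPrime = pp ; large = ≰⇒> large ; a = a
  ; order-∣ = p∣AM
  ; order-∤ = λ q e pq eq p∣ → ¬prime[1] (subst Prime (X.coprime
      (S.complete q pq (divides e (trans (sym eq) (*-comm q e))) (∣⇒≤ ⦃ >-nonZero M>0 ⦄ (divides e (trans (sym eq) (*-comm q e))))) e (trans eq M≡) (p∣X , p∣)) pp)
  ; a∤ = p∤a }
  where
  -- The base is at least 3 for `A-nonunit`, divisible by the primes of `M` for `unitary`, and
  -- divisible by all positive numbers up to `N`: a prime divisor of `A M` does not divide the base,
  -- so it exceeds `N`.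
  a₀ = 3 * (M * N !)
  module S = PrimeSupport (primeSupport M M)
  N!>0 : 0 < N !
  N!>0 = >-nonZero⁻¹ (N !) ⦃ N !≢0 ⦄
  3≤a₀ : 3 ≤ a₀
  3≤a₀ = *-monoʳ-≤ 3 {1} {M * N !} (*-mono-< M>0 N!>0)
  open Cyclotomic (a₀ ∸ 3)
  a≡ : a ≡ a₀
  a≡ = m+[n∸m]≡n 3≤a₀
  M∣a : M ∣ a
  M∣a = subst (M ∣_) (sym a≡) (∣n⇒∣m*n 3 (m∣m*n (N !)))
  g = quotient S.product∣
  M≡ : M ≡ product S.primes * g
  M≡ = m∣n⇒n≡m*quotient S.product∣
  g>0 : 0 < g
  g>0 = n≢0⇒n>0 λ eq → <-irrefl (sym (trans M≡ (trans (cong (product S.primes *_) eq) (*-zeroʳ (product S.primes))))) M>0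
  module X = Φ (cyclotomic S.primes S.distinct (All.map (λ (_ , q∣M) → ∣-trans q∣M M∣a) S.allPrime) g g>0)
  X≢1 : X.val ≢ 1
  X≢1 eq = X.nonunit (subst (Unit (suc g)) (sym eq) (unit-1 (suc g)))
  factor = prime-divisor X.val (≤∧≢⇒< X.val>0 (X≢1 ∘ sym))
  p = proj₁ factor
  pp = proj₁ (proj₂ factor)
  p∣X : p ∣ X.val
  p∣X = proj₂ (proj₂ factor)
  p∣AM : p ∣ A M
  p∣AM = subst (λ t → p ∣ A t) (sym M≡) (∣-trans p∣X X.divisor)
  p∤a : ¬ p ∣ a
  p∤a p∣a = ¬prime[1] (subst Prime (coprime-a^ M p∣AM (∣-refl , ∣-trans p∣a (a∣a^ M M>0))) pp)
    where
    a∣a^ : ∀ e → 0 < e → a ∣ a ^ e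
    a∣a^ (suc e) _ = m∣m*n (a ^ e)
  large : ¬ p ≤ N
  large p≤N = p∤a (subst (p ∣_) (sym a≡) (∣n⇒∣m*n 3 (∣n⇒∣m*n M (∣-trans (p∣p! p (prime⇒nonZero pp)) (m≤n⇒m!∣n! p≤N)))))
    where
    p∣p! : ∀ n → NonZero n → n ∣ n !
    p∣p! (suc n) _ = m∣m*n (n !)

-- Prime fields

module PrimeField (p : ℕ) (isPrime : Prime p) where
  private
    instance
      nz : NonZero p
      nz = prime⇒nonZero isPrime

  ⟪_⟫ : ℕ → Fin p
  ⟪ n ⟫ = n mod p

  toℕ-⟪⟫ : ∀ n → toℕ ⟪ n ⟫ ≡ n % p
  toℕ-⟪⟫ n = toℕ-fromℕ< (m%n<n n p)

  ⟪⟫-cong : ∀ {m n} → m % p ≡ n % p → ⟪ m ⟫ ≡ ⟪ n ⟫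
  ⟪⟫-cong {m} {n} eq = toℕ-injective (trans (toℕ-⟪⟫ m) (trans eq (sym (toℕ-⟪⟫ n))))

  ⟪toℕ⟫ : ∀ x → ⟪ toℕ x ⟫ ≡ x
  ⟪toℕ⟫ x = toℕ-injective (trans (toℕ-⟪⟫ (toℕ x)) (m<n⇒m%n≡m (toℕ<n x)))

  ⟪⟫-multiple : ∀ m k → ⟪ m + k * p ⟫ ≡ ⟪ m ⟫
  ⟪⟫-multiple m k = ⟪⟫-cong {m + k * p} {m} ([m+kn]%n≡m%n m k p)

  infixl 6 _⊞_
  infixl 7 _⊠_
  _⊞_ _⊠_ : Fin p → Fin p → Fin p
  x ⊞ y = ⟪ toℕ x + toℕ y ⟫
  x ⊠ y = ⟪ toℕ x * toℕ y ⟫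
  ⊟_ : Fin p → Fin p
  ⊟ x = ⟪ p ∸ toℕ x ⟫

  ⟪⟫-+ : ∀ m n → ⟪ m ⟫ ⊞ ⟪ n ⟫ ≡ ⟪ m + n ⟫
  ⟪⟫-+ m n = ⟪⟫-cong {toℕ ⟪ m ⟫ + toℕ ⟪ n ⟫} {m + n}
    (trans (cong₂ (λ s t → (s + t) % p) (toℕ-⟪⟫ m) (toℕ-⟪⟫ n)) (sym (%-distribˡ-+ m n p)))

  ⟪⟫-* : ∀ m n → ⟪ m ⟫ ⊠ ⟪ n ⟫ ≡ ⟪ m * n ⟫
  ⟪⟫-* m n = ⟪⟫-cong {toℕ ⟪ m ⟫ * toℕ ⟪ n ⟫} {m * n}
    (trans (cong₂ (λ s t → (s * t) % p) (toℕ-⟪⟫ m) (toℕ-⟪⟫ n)) (sym (%-distribˡ-* m n p)))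

  ⟪⟫-+ˡ : ∀ m y → ⟪ m ⟫ ⊞ y ≡ ⟪ m + toℕ y ⟫
  ⟪⟫-+ˡ m y = trans (cong (⟪ m ⟫ ⊞_) (sym (⟪toℕ⟫ y))) (⟪⟫-+ m (toℕ y))
  ⟪⟫-+ʳ : ∀ x n → x ⊞ ⟪ n ⟫ ≡ ⟪ toℕ x + n ⟫
  ⟪⟫-+ʳ x n = trans (cong (_⊞ ⟪ n ⟫) (sym (⟪toℕ⟫ x))) (⟪⟫-+ (toℕ x) n)
  ⟪⟫-*ˡ : ∀ m y → ⟪ m ⟫ ⊠ y ≡ ⟪ m * toℕ y ⟫
  ⟪⟫-*ˡ m y = trans (cong (⟪ m ⟫ ⊠_) (sym (⟪toℕ⟫ y))) (⟪⟫-* m (toℕ y))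
  ⟪⟫-*ʳ : ∀ x n → x ⊠ ⟪ n ⟫ ≡ ⟪ toℕ x * n ⟫
  ⟪⟫-*ʳ x n = trans (cong (_⊠ ⟪ n ⟫) (sym (⟪toℕ⟫ x))) (⟪⟫-* (toℕ x) n)

  private
    ⊞-assoc : ∀ x y z → (x ⊞ y) ⊞ z ≡ x ⊞ (y ⊞ z)
    ⊞-assoc x y z = trans (⟪⟫-+ˡ _ z) (trans (cong ⟪_⟫ (+-assoc (toℕ x) (toℕ y) (toℕ z))) (sym (⟪⟫-+ʳ x _)))
    ⊞-comm : ∀ x y → x ⊞ y ≡ y ⊞ x
    ⊞-comm x y = cong ⟪_⟫ (+-comm (toℕ x) (toℕ y))
    ⊞-identityˡ : ∀ x → ⟪ 0 ⟫ ⊞ x ≡ x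
    ⊞-identityˡ x = trans (⟪⟫-+ˡ 0 x) (⟪toℕ⟫ x)
    ⊟-inverseˡ : ∀ x → (⊟ x) ⊞ x ≡ ⟪ 0 ⟫
    ⊟-inverseˡ x = trans (⟪⟫-+ˡ _ x) (trans (cong ⟪_⟫ (trans (m∸n+n≡m (<⇒≤ (toℕ<n x))) (sym (+-identityʳ p)))) (⟪⟫-multiple 0 1))
    ⊠-assoc : ∀ x y z → (x ⊠ y) ⊠ z ≡ x ⊠ (y ⊠ z)
    ⊠-assoc x y z = trans (⟪⟫-*ˡ _ z) (trans (cong ⟪_⟫ (*-assoc (toℕ x) (toℕ y) (toℕ z))) (sym (⟪⟫-*ʳ x _)))
    ⊠-comm : ∀ x y → x ⊠ y ≡ y ⊠ x
    ⊠-comm x y = cong ⟪_⟫ (*-comm (toℕ x) (toℕ y))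
    ⊠-identityˡ : ∀ x → ⟪ 1 ⟫ ⊠ x ≡ x
    ⊠-identityˡ x = trans (⟪⟫-*ˡ 1 x) (trans (cong ⟪_⟫ (*-identityˡ (toℕ x))) (⟪toℕ⟫ x))
    ⊠-distribˡ-⊞ : ∀ x y z → x ⊠ (y ⊞ z) ≡ (x ⊠ y) ⊞ (x ⊠ z)
    ⊠-distribˡ-⊞ x y z = trans (⟪⟫-*ʳ x _) (trans (cong ⟪_⟫ (*-distribˡ-+ (toℕ x) (toℕ y) (toℕ z))) (sym (⟪⟫-+ _ _)))

    1≢0 : ⟪ 1 ⟫ ≢ ⟪ 0 ⟫
    1≢0 eq = contradiction (trans (sym (small (nonTrivial⇒n>1 p ⦃ prime⇒nonTrivial isPrime ⦄))) (trans (cong toℕ eq) (small (>-nonZero⁻¹ p)))) λ ()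
      where
      small : ∀ {n} → n < p → toℕ ⟪ n ⟫ ≡ n
      small {n} n<p = trans (toℕ-⟪⟫ n) (m<n⇒m%n≡m n<p)

    invertible : ∀ x → x ≢ ⟪ 0 ⟫ → ∃ λ y → x ⊠ y ≡ ⟪ 1 ⟫
    invertible x x≢0 with coprime-Bézout (Coprime.prime⇒coprime isPrime ⦃ ≢-nonZero (λ e → x≢0 (trans (sym (⟪toℕ⟫ x)) (cong ⟪_⟫ e))) ⦄ (toℕ<n x))
    ... | Bézout.-+ k y eq = ⟪ y ⟫ , trans (⟪⟫-*ʳ x y) (trans (cong ⟪_⟫ (trans (*-comm (toℕ x) y) (sym eq))) (⟪⟫-multiple 1 k))
    -- Here `y * toℕ x` is -1 modulo `p`, so the inverse is the negative of `y`; `y * toℕ x * y` is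
    -- this residue without subtraction.
    ... | Bézout.+- k y eq = ⟪ y * toℕ x * y ⟫ , (begin
      x ⊠ ⟪ y * toℕ x * y ⟫ ≡⟨ ⟪⟫-*ʳ x _ ⟩
      ⟪ toℕ x * (y * toℕ x * y) ⟫ ≡⟨ cong ⟪_⟫ (square (toℕ x) y) ⟩
      ⟪ z * z ⟫ ≡⟨ sym (⟪⟫-multiple (z * z) k) ⟩
      ⟪ z * z + k * p ⟫ ≡⟨ cong (λ t → ⟪ z * z + t ⟫) (sym eq) ⟩
      ⟪ z * z + (1 + z) ⟫ ≡⟨ cong ⟪_⟫ (shift z) ⟩
      ⟪ 1 + z * (1 + z) ⟫ ≡⟨ cong (λ t → ⟪ 1 + t ⟫) (trans (cong (z *_) eq) (sym (*-assoc z k p))) ⟩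
      ⟪ 1 + z * k * p ⟫ ≡⟨ ⟪⟫-multiple 1 (z * k) ⟩
      ⟪ 1 ⟫ ∎)
      where
      open ≡-Reasoning
      z = y * toℕ x
      square : ∀ x y → x * (y * x * y) ≡ y * x * (y * x)
      square = solve-∀
      shift : ∀ z → z * z + (1 + z) ≡ 1 + z * (1 + z)
      shift = solve-∀

    inv : Fin p → Fin p
    inv x with x ≟ᶠ ⟪ 0 ⟫
    ... | yes _ = x
    ... | no x≢0 = proj₁ (invertible x x≢0)

    inv-inverse : ∀ x → x ≢ ⟪ 0 ⟫ → x ⊠ inv x ≡ ⟪ 1 ⟫
    inv-inverse x nz with x ≟ᶠ ⟪ 0 ⟫
    ... | yes e = contradiction e nz
    ... | no x≢0 = proj₂ (invertible x x≢0)

  primeField : FiniteField p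
  primeField = record
    { _⊕_ = _⊞_ ; _⊗_ = _⊠_ ; ⊖_ = ⊟_ ; 𝟘 = ⟪ 0 ⟫ ; 𝟙 = ⟪ 1 ⟫
    ; isCommutativeRing = record
      { isRing = record
        { +-isAbelianGroup = record
          { isGroup = record
            { isMonoid = record
              { isSemigroup = record
                { isMagma = record { isEquivalence = isEquivalence ; ∙-cong = cong₂ _⊞_ }
                ; assoc = ⊞-assoc }
              ; identity = ⊞-identityˡ , λ x → trans (⊞-comm x _) (⊞-identityˡ x) }
            ; inverse = ⊟-inverseˡ , λ x → trans (⊞-comm x _) (⊟-inverseˡ x)
            ; ⁻¹-cong = cong ⊟_ }
          ; comm = ⊞-comm }
        ; *-cong = cong₂ _⊠_
        ; *-assoc = ⊠-assoc
        ; *-identity = ⊠-identityˡ , λ x → trans (⊠-comm x _) (⊠-identityˡ x)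
        ; distrib = ⊠-distribˡ-⊞ , λ x y z → trans (⊠-comm _ x) (trans (⊠-distribˡ-⊞ x y z) (cong₂ _⊞_ (⊠-comm x y) (⊠-comm x z))) }
      ; *-comm = ⊠-comm }
    ; _⁻¹ = inv
    ; inverseʳ = inv-inverse
    ; 𝟙≢𝟘 = 1≢0 }

  open Field primeField using (_^ᶠ_)

  ⟪⟫-^ : ∀ a n → ⟪ a ⟫ ^ᶠ n ≡ ⟪ a ^ n ⟫
  ⟪⟫-^ a zero = refl
  ⟪⟫-^ a (suc n) = trans (cong (⟪ a ⟫ ⊠_) (⟪⟫-^ a n)) (⟪⟫-* a (a ^ n))

  ⟪⟫-∣ : ∀ b → 0 < b → p ∣ b ∸ 1 → ⟪ b ⟫ ≡ ⟪ 1 ⟫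
  ⟪⟫-∣ (suc b) _ (divides k eq) = trans (cong (λ t → ⟪ suc t ⟫) eq) (⟪⟫-multiple 1 k)

  ∣-⟪⟫ : ∀ b → ⟪ b ⟫ ≡ ⟪ 1 ⟫ → p ∣ b ∸ 1
  ∣-⟪⟫ b eq = divides (b / p) (trans (cong (_∸ 1) (m≡m%n+[m/n]*n b p)) (cong (λ t → t + b / p * p ∸ 1)
    (trans (sym (toℕ-⟪⟫ b)) (trans (cong toℕ eq) (trans (toℕ-⟪⟫ 1) (m<n⇒m%n≡m (nonTrivial⇒n>1 p ⦃ prime⇒nonTrivial isPrime ⦄)))))))

-- Elements of exact order M and the roots of unity they provide

module Order {q : ℕ} (F : FiniteField q) (M : ℕ) (M>0 : 0 < M) (ω : Fin q) where
  open Field F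
  open Fermat F

  module Primitive (ω^M : ω ^ᶠ M ≡ 𝟙) (prim : ∀ r e → Prime r → r * e ≡ M → ω ^ᶠ e ≢ 𝟙) where

    ω^-multiple : ∀ x {j} → ω ^ᶠ j ≡ 𝟙 → ω ^ᶠ (x * j) ≡ 𝟙
    ω^-multiple x {j} eq = trans (cong (ω ^ᶠ_) (*-comm x j)) (trans (^-* ω j x) (trans (cong (_^ᶠ x) eq) (^-𝟙 x)))

    ω^-difference : ∀ g y → ω ^ᶠ (g + y) ≡ 𝟙 → ω ^ᶠ y ≡ 𝟙 → ω ^ᶠ g ≡ 𝟙
    ω^-difference g y e₁ e₂ = trans (sym (⊗-𝟙ʳ _)) (trans (cong (ω ^ᶠ g ⊗_) (sym e₂)) (trans (sym (^-distribˡ-+ ω g y)) e₁))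

    ω^gcd : ∀ j → ω ^ᶠ j ≡ 𝟙 → ω ^ᶠ gcd j M ≡ 𝟙
    ω^gcd j eq with Bézout.identity (gcd-GCD j M)
    ... | Bézout.+- x y e = ω^-difference (gcd j M) (y * M) (subst (λ t → ω ^ᶠ t ≡ 𝟙) (sym e) (ω^-multiple x eq)) (ω^-multiple y ω^M)
    ... | Bézout.-+ x y e = ω^-difference (gcd j M) (x * j) (subst (λ t → ω ^ᶠ t ≡ 𝟙) (sym e) (ω^-multiple y ω^M)) (ω^-multiple x eq)

    -- If a smaller power were 1, so would be the one with exponent `gcd j M`, a proper divisor of
    -- `M`, and then the one with exponent `M / r` for a prime `r` dividing the cofactor.
    order : ∀ j → 0 < j → j < M → ω ^ᶠ j ≢ 𝟙
    order j j>0 j<M eq = prim r (c' * gcd j M) (proj₁ (proj₂ factor)) M≡ (ω^-multiple c' (ω^gcd j eq))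
      where
      g∣M = gcd[m,n]∣n j M
      c = quotient g∣M
      2≤c : 2 ≤ c
      2≤c = quotient>1 g∣M (≤-<-trans (∣⇒≤ ⦃ >-nonZero j>0 ⦄ (gcd[m,n]∣m j M)) j<M)
      factor = prime-divisor c 2≤c
      r = proj₁ factor
      c' = quotient (proj₂ (proj₂ factor))
      M≡ : r * (c' * gcd j M) ≡ M
      M≡ = trans (sym (*-assoc r c' _)) (trans (cong (_* gcd j M) (sym (m∣n⇒n≡m*quotient (proj₂ (proj₂ factor))))) (sym (m∣n⇒n≡quotient*m g∣M)))

    ω≢𝟘 : ω ≢ 𝟘
    ω≢𝟘 eq = 𝟙≢𝟘 (trans (sym ω^M) (zero-power M M>0))
      where
      zero-power : ∀ n → 0 < n → ω ^ᶠ n ≡ 𝟘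
      zero-power (suc n) _ = trans (cong (_^ᶠ suc n) eq) (𝟘^suc n)

    M∣q-1 : ∀ {n} → q ≡ suc n → M ∣ n
    M∣q-1 {n} q≡ = m%n≡0⇒n∣m n M rem≡0
      where
      instance
        M≢0 : NonZero M
        M≢0 = >-nonZero M>0
      ω^rem : ω ^ᶠ (n % M) ≡ 𝟙
      ω^rem = ω^-difference (n % M) (n / M * M)
        (subst (λ t → ω ^ᶠ t ≡ 𝟙) (m≡m%n+[m/n]*n n M) (fermat q≡ ω ω≢𝟘)) (ω^-multiple (n / M) ω^M)
      rem≡0 : n % M ≡ 0
      rem≡0 with n % M in eq
      ... | zero = refl
      ... | suc r = contradiction (subst (λ t → ω ^ᶠ t ≡ 𝟙) eq ω^rem) (order (suc r) (s≤s z≤n) (subst (_< M) eq (m%n<n n M)))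

    roots : ∀ d c → suc d * c ≡ M → Roots (suc d)
    roots d c eq = power-roots (ω ^ᶠ c) (trans (sym (^-* ω c (suc d))) (trans (cong (ω ^ᶠ_) (trans (*-comm c (suc d)) eq)) ω^M))
      λ j j>0 j<d h → order (c * j) (*-mono-< c>0 j>0)
        (<-≤-trans (*-monoʳ-< c ⦃ >-nonZero c>0 ⦄ j<d) (≤-reflexive (trans (*-comm c (suc d)) eq)))
        (trans (^-* ω c j) h)
      where
      c>0 : 0 < c
      c>0 = n≢0⇒n>0 λ { refl → <-irrefl (trans (sym (*-zeroʳ (suc d))) eq) M>0 }

-- Roots of unity are provided for every positive divisor of `M`, because one field serves several
-- numbers of classes at once.
record RootField (M N : ℕ) : Set where
  field
    q : ℕ
    F : FiniteField q
    large : N < q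
    e : ℕ
    q≡ : q ≡ suc (M * e)
    roots : ∀ d c → suc d * c ≡ M → Fermat.Roots F (suc d)

primeRootField : ∀ {M N} → 0 < M → PrimitivePrime M N → RootField M N
primeRootField {M} {N} M>0 P = record
  { q = p ; F = primeField ; large = large ; e = quotient M∣p-1
  ; q≡ = trans p≡ (cong suc (m∣n⇒n≡m*quotient M∣p-1)) ; roots = roots }
  where
  open PrimitivePrime P
  open PrimeField p isPrime
  open Field primeField using (_^ᶠ_; 𝟙)
  a>0 : 0 < a
  a>0 = n≢0⇒n>0 λ a≡0 → a∤ (subst (p ∣_) (sym a≡0) (p ∣0))
  a^>0 : ∀ e → 0 < a ^ e
  a^>0 e = m^n>0 a ⦃ >-nonZero a>0 ⦄ e
  ω^M : ⟪ a ⟫ ^ᶠ M ≡ 𝟙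
  ω^M = trans (⟪⟫-^ a M) (⟪⟫-∣ (a ^ M) (a^>0 M) order-∣)
  open Order.Primitive primeField M M>0 ⟪ a ⟫ ω^M
    (λ r e pr eq h → order-∤ r e pr eq (∣-⟪⟫ (a ^ e) (trans (sym (⟪⟫-^ a e)) h)))
  p≡ : p ≡ suc (pred p)
  p≡ = sym (suc-pred p ⦃ prime⇒nonZero isPrime ⦄)
  M∣p-1 : M ∣ pred p
  M∣p-1 = M∣q-1 p≡

rootField : ∀ M N → 0 < M → RootField M N
rootField M N M>0 = primeRootField M>0 (primitivePrime M N M>0)

-- Designs given by indexed blocks

-- Blocks are tuples and not subsets because base blocks attach a scalar to each position.
record TupleDesign (v k : ℕ) : Set where
  field
    size : ℕ
    pt : Fin size → Fin k → Fin v
    pt-injective : ∀ i {s t} → pt i s ≡ pt i t → s ≡ t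
    through : ∀ x y → x ≢ y → ∃ λ i → ∃ λ s → ∃ λ t → pt i s ≡ x × pt i t ≡ y
    unique : ∀ i j s t s' t' → s ≢ t → pt i s ≡ pt j s' → pt i t ≡ pt j t' → i ≡ j

setOf : ∀ {k v} → (Fin k → Fin v) → Subset v
setOf f = tabulate λ y → does (any? (λ s → f s ≟ᶠ y))

∈-setOf⁺ : ∀ {k v} (f : Fin k → Fin v) s → f s Subset.∈ setOf f
∈-setOf⁺ f s = lookup⇒[]= (f s) _ (trans (lookup∘tabulate _ (f s)) true!)
  where
  true! : does (any? (λ t → f t ≟ᶠ f s)) ≡ true
  true! with any? (λ t → f t ≟ᶠ f s)
  ... | yes _ = refl
  ... | no none = contradiction (s , refl) none

∈-tabulate-does⁻ : ∀ {v} {P : Fin v → Set} (P? : ∀ y → Dec (P y)) y → y Subset.∈ tabulate (λ y → does (P? y)) → P y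
∈-tabulate-does⁻ P? y y∈ with P? y | trans (sym (lookup∘tabulate (λ y → does (P? y)) y)) ([]=⇒lookup y∈)
... | yes p | _ = p
... | no _ | ()

∈-setOf⁻ : ∀ {k v} (f : Fin k → Fin v) y → y Subset.∈ setOf f → ∃ λ s → f s ≡ y
∈-setOf⁻ f = ∈-tabulate-does⁻ (λ y → any? (λ s → f s ≟ᶠ y))

setOf-⊆ : ∀ {k k' v} (f : Fin k → Fin v) (g : Fin k' → Fin v) → (∀ s → ∃ λ t → g t ≡ f s) → setOf f Subset.⊆ setOf g
setOf-⊆ f g sub {y} y∈ with ∈-setOf⁻ f y y∈
... | s , refl with sub s
... | t , eq = subst (Subset._∈ setOf g) eq (∈-setOf⁺ g t)

setOf-≡ : ∀ {k k' v} (f : Fin k → Fin v) (g : Fin k' → Fin v) →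
  (∀ s → ∃ λ t → g t ≡ f s) → (∀ t → ∃ λ s → f s ≡ g t) → setOf f ≡ setOf g
setOf-≡ f g sub sup = ⊆-antisym (setOf-⊆ f g sub) (setOf-⊆ g f sup)

∣tabulate∣ : ∀ {v} {P : Fin v → Set} (P? : ∀ y → Dec (P y)) → ∣ tabulate (λ y → does (P? y)) ∣ ≡ count P?
∣tabulate∣ {zero} P? = refl
∣tabulate∣ {suc v} P? with P? zero
... | yes _ = cong suc (∣tabulate∣ (P? ∘ suc))
... | no _ = ∣tabulate∣ (P? ∘ suc)

count-image : ∀ {k v} (f : Fin k → Fin v) → (∀ {s t} → f s ≡ f t → s ≡ t) → count (λ y → any? (λ s → f s ≟ᶠ y)) ≡ k
count-image {k} {v} f inj = begin
  count (λ y → any? (λ s → f s ≟ᶠ y)) ≡⟨ ∑-cong fibre ⟩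
  ∑ (λ y → ∑ (λ s → ⟦ f s ≟ᶠ y ⟧)) ≡⟨ ∑-swap (λ y s → ⟦ f s ≟ᶠ y ⟧) ⟩
  ∑ (λ s → ∑ (λ y → ⟦ f s ≟ᶠ y ⟧)) ≡⟨ ∑-cong (λ s → count-singleton (f s ≟ᶠ_) (f s) refl (λ _ → sym)) ⟩
  ∑ {k} (λ _ → 1) ≡⟨ trans (∑-const k 1) (*-identityʳ k) ⟩
  k ∎
  where
  open ≡-Reasoning
  fibre : ∀ y → ⟦ any? (λ s → f s ≟ᶠ y) ⟧ ≡ ∑ (λ s → ⟦ f s ≟ᶠ y ⟧)
  fibre y with any? (λ s → f s ≟ᶠ y)
  ... | yes (s , eq) = sym (count-singleton (λ s → f s ≟ᶠ y) s eq (λ t e → inj (trans e (sym eq))))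
  ... | no none = sym (∑-zero (λ s → ⟦⟧-no (f s ≟ᶠ y) (λ e → none (s , e))))

∣setOf∣ : ∀ {k v} (f : Fin k → Fin v) → (∀ {s t} → f s ≡ f t → s ≡ t) → ∣ setOf f ∣ ≡ k
∣setOf∣ f inj = trans (∣tabulate∣ (λ y → any? (λ s → f s ≟ᶠ y))) (count-image f inj)

toDesign : ∀ {v k} → TupleDesign v k → Design v k
toDesign T = record
  { b = T.size
  ; block = λ i → setOf (T.pt i)
  ; size = λ i → ∣setOf∣ (T.pt i) (T.pt-injective i)
  ; pairs = λ x y x≢y → pair x y x≢y (T.through x y x≢y) }
  where
  module T = TupleDesign T
  pair : ∀ x y → x ≢ y → (∃ λ i → ∃ λ s → ∃ λ t → T.pt i s ≡ x × T.pt i t ≡ y) →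
    Σ (Fin T.size) λ i → (x Subset.∈ setOf (T.pt i) × y Subset.∈ setOf (T.pt i)) ×
      (∀ j → x Subset.∈ setOf (T.pt j) → y Subset.∈ setOf (T.pt j) → j ≡ i)
  pair x y x≢y (i , s , t , refl , refl) = i , (∈-setOf⁺ _ s , ∈-setOf⁺ _ t) , λ j x∈ y∈ →
    sym (meet j (∈-setOf⁻ (T.pt j) x x∈) (∈-setOf⁻ (T.pt j) y y∈))
    where
    meet : ∀ j → (∃ λ s' → T.pt j s' ≡ x) → (∃ λ t' → T.pt j t' ≡ y) → i ≡ j
    meet j (s' , eq) (t' , eq') = T.unique i j s t s' t' (x≢y ∘ cong (T.pt i)) (sym eq) (sym eq')

lookup-injective : ∀ {A : Set} {xs : List A} → Unique xs → ∀ i j → lookup xs i ≡ lookup xs j → i ≡ j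
lookup-injective (_ ∷ _) zero zero eq = refl
lookup-injective {xs = x ∷ xs} (x∉ ∷ _) zero (suc j) eq = contradiction eq (All.lookup x∉ (∈-lookup j))
lookup-injective {xs = x ∷ xs} (x∉ ∷ _) (suc i) zero eq = contradiction (sym eq) (All.lookup x∉ (∈-lookup i))
lookup-injective (_ ∷ u) (suc i) (suc j) eq = cong suc (lookup-injective u i j eq)

-- The same set of points may be listed as a block several times.
record TupleFamily (v k : ℕ) : Set₁ where
  field
    Index : Set
    indices : List Index
    tuple : Index → Fin k → Fin v
    tuple-injective : ∀ ι → ι ∈ indices → ∀ {s t} → tuple ι s ≡ tuple ι t → s ≡ t
    cover : ∀ x y → x ≢ y → ∃ λ ι → ι ∈ indices × ∃ λ s → ∃ λ t → tuple ι s ≡ x × tuple ι t ≡ y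
    agree : ∀ ι ι' → ι ∈ indices → ι' ∈ indices → ∀ s t s' t' → s ≢ t →
      tuple ι s ≡ tuple ι' s' → tuple ι t ≡ tuple ι' t' → ∀ l → ∃ λ l' → tuple ι' l' ≡ tuple ι l

module Family {v k : ℕ} (T : TupleFamily v k) where
  open TupleFamily T

  private
    _≟ˢ_ : (S S' : Subset v) → Dec (S ≡ S')
    _≟ˢ_ = ≡-dec Bool._≟_

    sets : List (Subset v)
    sets = deduplicate _≟ˢ_ (map (setOf ∘ tuple) indices)

    origin : ∀ i → ∃ λ ι → ι ∈ indices × lookup sets i ≡ setOf (tuple ι)
    origin i = ∈-map⁻ (setOf ∘ tuple) (∈-deduplicate⁻ _≟ˢ_ _ (∈-lookup {xs = sets} i))

    position : ∀ ι → ι ∈ indices → ∃ λ i → lookup sets i ≡ setOf (tuple ι)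
    position ι ι∈ = Any.index mem , sym (lookup-index mem)
      where
      mem : setOf (tuple ι) ∈ sets
      mem = ∈-deduplicate⁺ _≟ˢ_ (∈-map⁺ (setOf ∘ tuple) ι∈)

    pt : Fin (length sets) → Fin k → Fin v
    pt i = tuple (proj₁ (origin i))

    setOf-pt : ∀ i → setOf (pt i) ≡ lookup sets i
    setOf-pt i = sym (proj₂ (proj₂ (origin i)))

    agree-≡ : ∀ ι ι' → ι ∈ indices → ι' ∈ indices → ∀ s t s' t' → s ≢ t →
      tuple ι s ≡ tuple ι' s' → tuple ι t ≡ tuple ι' t' → setOf (tuple ι) ≡ setOf (tuple ι')
    agree-≡ ι ι' ι∈ ι'∈ s t s' t' s≢t es et = setOf-≡ _ _ (agree ι ι' ι∈ ι'∈ s t s' t' s≢t es et)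
      (agree ι' ι ι'∈ ι∈ s' t' s t (λ { refl → s≢t (tuple-injective ι ι∈ (trans es (sym et))) }) (sym es) (sym et))

  -- Once repeated subsets are removed, an index is determined by its set of points, and `agree` in
  -- both directions shows that tuples sharing two points have the same set.
  tupleDesign : TupleDesign v k
  tupleDesign = record
    { size = length sets
    ; pt = pt
    ; pt-injective = λ i → tuple-injective (proj₁ (origin i)) (proj₁ (proj₂ (origin i)))
    ; through = λ x y x≢y → thru x y (cover x y x≢y)
    ; unique = λ i j s t s' t' s≢t es et → lookup-injective (deduplicate-! _≟ˢ_ (map (setOf ∘ tuple) indices)) i j
        (trans (sym (setOf-pt i)) (trans (agree-≡ _ _ (proj₁ (proj₂ (origin i))) (proj₁ (proj₂ (origin j))) s t s' t' s≢t es et) (setOf-pt j))) }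
    where
    thru : ∀ x y → (∃ λ ι → ι ∈ indices × ∃ λ s → ∃ λ t → tuple ι s ≡ x × tuple ι t ≡ y) →
      ∃ λ i → ∃ λ s → ∃ λ t → pt i s ≡ x × pt i t ≡ y
    thru x y (ι , ι∈ , s , t , refl , refl) with position ι ι∈
    ... | i , eq with ∈-setOf⁻ (pt i) x (subst (x Subset.∈_) (trans (sym eq) (sym (setOf-pt i))) (∈-setOf⁺ (tuple ι) s))
                    | ∈-setOf⁻ (pt i) y (subst (y Subset.∈_) (trans (sym eq) (sym (setOf-pt i))) (∈-setOf⁺ (tuple ι) t))
    ... | s' , es | t' , et = i , s' , t' , es , et

  design : Design v k
  design = toDesign tupleDesign

  image-setOf : ∀ (σ : Permutation′ v) (f g : Fin k → Fin v) → (∀ l → g l ≡ σ ⟨$⟩ʳ f l) → image σ (setOf f) ≡ setOf g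
  image-setOf σ f g eq = ⊆-antisym forth back
    where
    forth : image σ (setOf f) Subset.⊆ setOf g
    forth {y} y∈ with ∈-setOf⁻ f (σ ⟨$⟩ˡ y) (lookup⇒[]= _ _ (trans (sym (lookup∘tabulate _ y)) ([]=⇒lookup y∈)))
    ... | s , e = subst (Subset._∈ setOf g) (trans (eq s) (trans (cong (σ ⟨$⟩ʳ_) e) (perm-inverseʳ σ))) (∈-setOf⁺ g s)
    back : setOf g Subset.⊆ image σ (setOf f)
    back {y} y∈ with ∈-setOf⁻ g y y∈
    ... | s , e = lookup⇒[]= _ _ (trans (lookup∘tabulate _ y) ([]=⇒lookup (subst (Subset._∈ setOf f)
                    (trans (sym (perm-inverseˡ σ)) (cong (σ ⟨$⟩ˡ_) (trans (sym (eq s)) e))) (∈-setOf⁺ f s))))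

  -- The hypothesis on the inverse permutation supplies the block that is mapped onto a given one.
  automorphism : ∀ (σ : Permutation′ v) →
    (∀ ι → ι ∈ indices → ∃ λ ι' → ι' ∈ indices × ∀ l → tuple ι' l ≡ σ ⟨$⟩ʳ tuple ι l) →
    (∀ ι → ι ∈ indices → ∃ λ ι' → ι' ∈ indices × ∀ l → tuple ι' l ≡ σ ⟨$⟩ˡ tuple ι l) →
    IsAutomorphism design σ
  automorphism σ fwd bwd = forward , backward
    where
    forward : ∀ i → ∃ λ j → image σ (setOf (pt i)) ≡ setOf (pt j)
    forward i with fwd (proj₁ (origin i)) (proj₁ (proj₂ (origin i)))
    ... | ι' , ι'∈ , eq with position ι' ι'∈
    ... | j , ej = j , trans (image-setOf σ (pt i) (tuple ι') eq) (trans (sym ej) (sym (setOf-pt j)))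
    backward : ∀ j → ∃ λ i → image σ (setOf (pt i)) ≡ setOf (pt j)
    backward j with bwd (proj₁ (origin j)) (proj₁ (proj₂ (origin j)))
    ... | ι' , ι'∈ , eq with position ι' ι'∈
    ... | i , ei = i , trans (cong (image σ) (trans (setOf-pt i) ei))
                     (image-setOf σ (tuple ι') (pt j) (λ l → sym (trans (cong (σ ⟨$⟩ʳ_) (eq l)) (perm-inverseʳ σ))))

-- Translation designs on layers of a vector space

funToFin-cong : ∀ {m n} {f g : Fin m → Fin n} → (∀ i → f i ≡ g i) → funToFin f ≡ funToFin g
funToFin-cong {zero} eq = refl
funToFin-cong {suc m} eq = cong₂ combine (eq zero) (funToFin-cong (eq ∘ suc))

funToFin-injective : ∀ {m n} {f g : Fin m → Fin n} → funToFin f ≡ funToFin g → ∀ i → f i ≡ g i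
funToFin-injective {f = f} {g} eq i =
  trans (sym (finToFun-funToFin f i)) (trans (cong (λ a → finToFun a i) eq) (finToFun-funToFin g i))

-- Base blocks are sets of k points (lay l , coe l) with a layer in Fin c and a scalar; a direction d in Λ and
-- a translation a turn the scalar t into the vector a + t d. Pairs of points with equal vectors lie in the holes.
record BaseFamily {q : ℕ} (F : FiniteField q) (N c k : ℕ) : Set₁ where
  open Field F
  Nonzero : (Fin N → Fin q) → Set
  Nonzero d = ¬ (∀ x → d x ≡ 𝟘)
  field
    Base : Set
    bases : List Base
    bases-complete : ∀ β → β ∈ bases
    lay : Base → Fin k → Fin c
    coe : Base → Fin k → Fin q
    coe-injective : ∀ β {s t} → coe β s ≡ coe β t → s ≡ t
    Λ : (Fin N → Fin q) → Set
    Λ? : ∀ d → Dec (Λ d)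
    Λ-cong : ∀ {d d'} → (∀ x → d x ≡ d' x) → Λ d → Λ d'
    Λ-nonzero : ∀ {d} → Λ d → Nonzero d
    hit : ∀ i j δ → Nonzero δ → ∃ λ β → ∃ λ s → ∃ λ t → ∃ λ d →
      Λ d × lay β s ≡ i × lay β t ≡ j × (∀ x → (coe β t ⊝ coe β s) ⊗ d x ≡ δ x)
    meet : ∀ β β' s t s' t' d d' → Λ d → Λ d' → s ≢ t → lay β s ≡ lay β' s' → lay β t ≡ lay β' t' →
      (∀ x → (coe β t ⊝ coe β s) ⊗ d x ≡ (coe β' t' ⊝ coe β' s') ⊗ d' x) →
      ∀ l → ∃ λ l' → lay β' l' ≡ lay β l × (∀ x → (coe β' l' ⊝ coe β' s') ⊗ d' x ≡ (coe β l ⊝ coe β s) ⊗ d x)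

module Development {q : ℕ} (F : FiniteField q) (N c k : ℕ) (hole : TupleDesign c k) (B : BaseFamily F N c k) where
  open Field F
  open BaseFamily B
  module Hole = TupleDesign hole

  point : Fin c → (Fin N → Fin q) → Fin (c * q ^ N)
  point i u = combine i (funToFin u)

  point-cong : ∀ {i j u w} → i ≡ j → (∀ x → u x ≡ w x) → point i u ≡ point j w
  point-cong eq eq' = cong₂ combine eq (funToFin-cong eq')

  point-injective : ∀ {i j u w} → point i u ≡ point j w → i ≡ j × (∀ x → u x ≡ w x)
  point-injective {i} {j} {u} {w} eq with combine-injective i (funToFin u) j (funToFin w) eq
  ... | e , e' = e , funToFin-injective e'

  layer : Fin (c * q ^ N) → Fin c
  layer x = proj₁ (remQuot {c} (q ^ N) x)

  vector : Fin (c * q ^ N) → Fin N → Fin q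
  vector x = finToFun (proj₂ (remQuot {c} (q ^ N) x))

  point-layer : ∀ x → point (layer x) (vector x) ≡ x
  point-layer x = trans (cong (combine (layer x)) (funToFin-finToFin {N} {q} (proj₂ (remQuot {c} (q ^ N) x)))) (combine-remQuot {c} (q ^ N) x)

  layer-point : ∀ i u → layer (point i u) ≡ i
  layer-point i u = cong proj₁ (remQuot-combine {c} {q ^ N} i (funToFin u))

  vector-point : ∀ i u x → vector (point i u) x ≡ u x
  vector-point i u x = trans (cong (λ p → finToFun (proj₂ p) x) (remQuot-combine {c} {q ^ N} i (funToFin u))) (finToFun-funToFin u x)

  Code : Set
  Code = Fin (q ^ N)

  ⟨_⟩ : Code → Fin N → Fin q
  ⟨ a ⟩ = finToFun a

  Index : Set
  Index = (Fin Hole.size × Code) ⊎ (Base × Code × Code)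

  Admissible : Base × Code × Code → Set
  Admissible (β , a , d) = Λ ⟨ d ⟩

  admissible? : ∀ ι → Dec (Admissible ι)
  admissible? (β , a , d) = Λ? ⟨ d ⟩

  holes : List Index
  holes = map inj₁ (cartesianProduct (allFin Hole.size) (allFin (q ^ N)))

  translates : List (Base × Code × Code)
  translates = filter admissible? (cartesianProduct bases (cartesianProduct (allFin (q ^ N)) (allFin (q ^ N))))

  indices : List Index
  indices = holes ++ map inj₂ translates

  hole∈ : ∀ D a → inj₁ (D , a) ∈ indices
  hole∈ D a = ∈-++⁺ˡ (∈-map⁺ inj₁ (∈-cartesianProduct⁺ (∈-allFin D) (∈-allFin a)))

  base∈ : ∀ β a d → Λ ⟨ d ⟩ → inj₂ (β , a , d) ∈ indices
  base∈ β a d λd = ∈-++⁺ʳ holes (∈-map⁺ inj₂ (∈-filter⁺ admissible?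
    (∈-cartesianProduct⁺ (bases-complete β) (∈-cartesianProduct⁺ (∈-allFin a) (∈-allFin d))) λd))

  base-Λ : ∀ β a d → inj₂ (β , a , d) ∈ indices → Λ ⟨ d ⟩
  base-Λ β a d ι∈ with ∈-++⁻ holes ι∈
  ... | inj₁ h with ∈-map⁻ inj₁ h
  ... | _ , _ , ()
  base-Λ β a d ι∈ | inj₂ h with ∈-map⁻ inj₂ h
  ... | _ , t∈ , refl = proj₂ (∈-filter⁻ admissible? {xs = cartesianProduct bases (cartesianProduct (allFin (q ^ N)) (allFin (q ^ N)))} t∈)

  along : Code → Fin q → Code → Fin N → Fin q
  along a t d x = ⟨ a ⟩ x ⊕ t ⊗ ⟨ d ⟩ x

  tuple : Index → Fin k → Fin (c * q ^ N)
  tuple (inj₁ (D , a)) l = point (Hole.pt D l) ⟨ a ⟩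
  tuple (inj₂ (β , a , d)) l = point (lay β l) (along a (coe β l) d)

  private
    difference : ∀ s t a d → (t ⊝ s) ⊗ d ≡ (a ⊕ t ⊗ d) ⊝ (a ⊕ s ⊗ d)
    difference = solve 4 (λ s t a d → (t :- s) :* d := (a :+ t :* d) :- (a :+ s :* d)) refl

    shift : ∀ s t a d → a ⊕ t ⊗ d ≡ (a ⊕ s ⊗ d) ⊕ (t ⊝ s) ⊗ d
    shift = solve 4 (λ s t a d → a :+ t :* d := (a :+ s :* d) :+ (t :- s) :* d) refl

    along-injective : ∀ {s t} a d → Nonzero ⟨ d ⟩ → (∀ x → along a s d x ≡ along a t d x) → s ≡ t
    along-injective {s} {t} a d nz eq with s ≟ᶠ t
    ... | yes e = e
    ... | no s≢t = ⊥-elim (nz λ x → ⊗-cancelˡ (t ⊝ s) (⊝-≢𝟘 (s≢t ∘ sym))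
            (trans (difference s t (⟨ a ⟩ x) (⟨ d ⟩ x)) (trans (cong (along a t d x ⊝_) (eq x)) (trans (⊝-self _) (sym (⊗-𝟘ʳ _))))))

  tuple-injective : ∀ ι → ι ∈ indices → ∀ {s t} → tuple ι s ≡ tuple ι t → s ≡ t
  tuple-injective (inj₁ (D , a)) _ eq = Hole.pt-injective D (proj₁ (point-injective eq))
  tuple-injective (inj₂ (β , a , d)) ι∈ eq =
    coe-injective β (along-injective a d (Λ-nonzero (base-Λ β a d ι∈)) (proj₂ (point-injective eq)))

  private
    cover' : ∀ i u j w → point i u ≢ point j w →
      ∃ λ ι → ι ∈ indices × ∃ λ s → ∃ λ t → tuple ι s ≡ point i u × tuple ι t ≡ point j w
    cover' i u j w ne with funToFin u ≟ᶠ funToFin w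
    ... | yes eq with Hole.through i j (λ e → ne (point-cong e (funToFin-injective eq)))
    ... | D , s , t , es , et = inj₁ (D , funToFin u) , hole∈ D _ , s , t
              , point-cong es (finToFun-funToFin u)
              , point-cong et (λ x → trans (finToFun-funToFin u x) (funToFin-injective eq x))
    cover' i u j w ne | no neq with hit i j (λ x → w x ⊝ u x) (λ z → neq (funToFin-cong (λ x → sym (⊝-≡𝟘 (z x)))))
    ... | β , s , t , d , λd , es , et , eq = inj₂ (β , funToFin base , funToFin d)
            , base∈ β _ _ (Λ-cong (λ x → sym (finToFun-funToFin d x)) λd) , s , t
            , point-cong es at-s , point-cong et at-t
      where
      base : Fin N → Fin q
      base x = u x ⊝ coe β s ⊗ d x
      at-s : ∀ x → along (funToFin base) (coe β s) (funToFin d) x ≡ u x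
      at-s x = trans (cong₂ (λ a d → a ⊕ coe β s ⊗ d) (finToFun-funToFin base x) (finToFun-funToFin d x))
        (solve 2 (λ u sd → (u :- sd) :+ sd := u) refl (u x) (coe β s ⊗ d x))
      at-t : ∀ x → along (funToFin base) (coe β t) (funToFin d) x ≡ w x
      at-t x = trans (shift (coe β s) (coe β t) _ _) (trans (cong₂ _⊕_ (at-s x)
        (trans (cong ((coe β t ⊝ coe β s) ⊗_) (finToFun-funToFin d x)) (eq x)))
        (solve 2 (λ u w → u :+ (w :- u) := w) refl (u x) (w x)))

    cover : ∀ x y → x ≢ y → ∃ λ ι → ι ∈ indices × ∃ λ s → ∃ λ t → tuple ι s ≡ x × tuple ι t ≡ y
    cover x y ne with cover' (layer x) (vector x) (layer y) (vector y)
                        (λ e → ne (trans (sym (point-layer x)) (trans e (point-layer y))))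
    ... | ι , ι∈ , s , t , es , et = ι , ι∈ , s , t , trans es (point-layer x) , trans et (point-layer y)

    -- Points of a hole have equal vectors, while distinct positions of a base block have distinct
    -- scalars and, the direction being nonzero, distinct vectors.
    hole-base : ∀ D a β a' d → Λ ⟨ d ⟩ → ∀ s t s' t' → s ≢ t →
      tuple (inj₁ (D , a)) s ≡ tuple (inj₂ (β , a' , d)) s' → tuple (inj₁ (D , a)) t ≡ tuple (inj₂ (β , a' , d)) t' → ⊥
    hole-base D a β a' d λd s t s' t' s≢t es et = s≢t (Hole.pt-injective D
      (trans (proj₁ (point-injective es)) (trans (cong (lay β) (coe-injective β
        (along-injective a' d (Λ-nonzero λd) (λ x → trans (sym (proj₂ (point-injective es) x)) (proj₂ (point-injective et) x)))))
        (sym (proj₁ (point-injective et))))))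

    agree : ∀ ι ι' → ι ∈ indices → ι' ∈ indices → ∀ s t s' t' → s ≢ t →
      tuple ι s ≡ tuple ι' s' → tuple ι t ≡ tuple ι' t' → ∀ l → ∃ λ l' → tuple ι' l' ≡ tuple ι l
    agree (inj₁ (D , a)) (inj₁ (D' , a')) _ _ s t s' t' s≢t es et l
      with Hole.unique D D' s t s' t' s≢t (proj₁ (point-injective es)) (proj₁ (point-injective et))
    ... | refl = l , point-cong refl (λ x → sym (proj₂ (point-injective es) x))
    agree (inj₁ (D , a)) (inj₂ (β , a' , d)) _ ι'∈ s t s' t' s≢t es et l =
      ⊥-elim (hole-base D a β a' d (base-Λ β a' d ι'∈) s t s' t' s≢t es et)
    agree (inj₂ (β , a' , d)) (inj₁ (D , a)) ι∈ ι'∈ s t s' t' s≢t es et l =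
      ⊥-elim (hole-base D a β a' d (base-Λ β a' d ι∈) s' t' s t
        (λ { refl → s≢t (tuple-injective (inj₂ (β , a' , d)) ι∈ (trans es (sym et))) }) (sym es) (sym et))
    agree (inj₂ (β , a , d)) (inj₂ (β' , a' , d')) ι∈ ι'∈ s t s' t' s≢t es et l
      with meet β β' s t s' t' ⟨ d ⟩ ⟨ d' ⟩ (base-Λ β a d ι∈) (base-Λ β' a' d' ι'∈) s≢t
             (proj₁ (point-injective es)) (proj₁ (point-injective et))
             (λ x → trans (difference (coe β s) (coe β t) (⟨ a ⟩ x) (⟨ d ⟩ x))
               (trans (cong₂ _⊝_ (proj₂ (point-injective et) x) (proj₂ (point-injective es) x))
                 (sym (difference (coe β' s') (coe β' t') (⟨ a' ⟩ x) (⟨ d' ⟩ x))))) l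
    ... | l' , el , ed = l' , point-cong el (λ x → begin
      along a' (coe β' l') d' x ≡⟨ shift (coe β' s') (coe β' l') _ _ ⟩
      along a' (coe β' s') d' x ⊕ (coe β' l' ⊝ coe β' s') ⊗ ⟨ d' ⟩ x ≡⟨ cong₂ _⊕_ (sym (proj₂ (point-injective es) x)) (ed x) ⟩
      along a (coe β s) d x ⊕ (coe β l ⊝ coe β s) ⊗ ⟨ d ⟩ x ≡⟨ sym (shift (coe β s) (coe β l) _ _) ⟩
      along a (coe β l) d x ∎)
      where open ≡-Reasoning

  family : TupleFamily (c * q ^ N) k
  family = record
    { Index = Index ; indices = indices ; tuple = tuple ; tuple-injective = tuple-injective ; cover = cover ; agree = agree }

-- Designs from difference families in a finite field

-- The binomial coefficient of `k` over 2, in the recursive form that `pair` follows.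
pairs : ℕ → ℕ
pairs zero = 0
pairs (suc k) = k + pairs k

pair : ∀ {k} (i j : Fin k) → i Fin.< j → Fin (pairs k)
pair {suc k} zero (suc j) _ = j ↑ˡ pairs k
pair {suc k} (suc i) (suc j) (s≤s lt) = k ↑ʳ pair i j lt

↑ˡ≢↑ʳ : ∀ {m n} (i : Fin m) (j : Fin n) → i ↑ˡ n ≢ m ↑ʳ j
↑ˡ≢↑ʳ {m} {n} i j eq with trans (sym (splitAt-↑ˡ m i n)) (trans (cong (splitAt m) eq) (splitAt-↑ʳ m n j))
... | ()

pair-injective : ∀ {k} {i j i' j' : Fin k} (lt : i Fin.< j) (lt' : i' Fin.< j') → pair i j lt ≡ pair i' j' lt' → i ≡ i' × j ≡ j'
pair-injective {suc k} {zero} {suc j} {zero} {suc j'} _ _ eq = refl , cong suc (↑ˡ-injective (pairs k) j j' eq)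
pair-injective {suc k} {zero} {suc j} {suc i'} {suc j'} _ (s≤s lt') eq = ⊥-elim (↑ˡ≢↑ʳ _ _ eq)
pair-injective {suc k} {suc i} {suc j} {zero} {suc j'} (s≤s lt) _ eq = ⊥-elim (↑ˡ≢↑ʳ _ _ (sym eq))
pair-injective {suc k} {suc i} {suc j} {suc i'} {suc j'} (s≤s lt) (s≤s lt') eq with pair-injective lt lt' (↑ʳ-injective k _ _ eq)
... | e , e' = cong suc e , cong suc e'

pair-surjective : ∀ {k} (r : Fin (pairs k)) → ∃ λ (i : Fin k) → ∃ λ (j : Fin k) → ∃ λ (lt : i Fin.< j) → pair i j lt ≡ r
pair-surjective {suc k} r with splitAt k r in eq
... | inj₁ j = zero , suc j , s≤s z≤n , trans (cong (Fin.join k (pairs k)) (sym eq)) (join-splitAt k (pairs k) r)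
... | inj₂ r' with pair-surjective r'
... | i , j , lt , eq' = suc i , suc j , s≤s lt ,
          trans (cong (k ↑ʳ_) eq') (trans (cong (Fin.join k (pairs k)) (sym eq)) (join-splitAt k (pairs k) r))

data Orient {n : ℕ} (s t : Fin n) : Set where
  up : s Fin.< t → Orient s t
  down : t Fin.< s → Orient s t

orient : ∀ {n} (s t : Fin n) → s ≢ t → Orient s t
orient s t s≢t with <-cmp (toℕ s) (toℕ t)
... | tri< lt _ _ = up lt
... | tri≈ _ eq _ = contradiction (toℕ-injective eq) s≢t
... | tri> _ _ gt = down gt

-- The hole of a development with a single layer, where distinct points have distinct vectors.
noBlocks : ∀ k → TupleDesign 1 k
noBlocks k = record
  { size = 0 ; pt = λ () ; pt-injective = λ ()
  ; through = λ { zero zero ne → contradiction refl ne }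
  ; unique = λ () }

-- The differences of the base block b, taken up to sign, represent all classes modulo the kernel of the e-th power;
-- since -1 lies in this kernel, directions are restricted to a half-system.
module DifferenceFamily {q : ℕ} (F : FiniteField q) (two : Field._⊕_ F (Field.𝟙 F) (Field.𝟙 F) ≢ Field.𝟘 F)
  (k f e-1 : ℕ) (e≡ : suc e-1 ≡ 2 * f) (q≡ : q ≡ suc (pairs k * suc e-1)) (Z : Fermat.Roots F (pairs k))
  (large : threshold (pairs k) k 1 < q) where
  open Field F
  open Fermat F
  open Roots Z
  open Wilson F (pairs k) e-1 q≡ Z

  private
    chosen : ∃ λ (b : Fin k → Fin q) → (∀ i → ⊤) × (∀ i j lt → (b j ⊝ b i) ^ᶠ e ≡ root (pair i j lt))
    chosen = choose k (λ _ _ → yes tt) 1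
      (λ i → ≤-reflexive (trans (sym (count-all {q} (λ _ → yes tt) (λ _ → tt))) (sym (*-identityʳ _)))) large pair

    b : Fin k → Fin q
    b = proj₁ chosen

    b-class : ∀ i j lt → (b j ⊝ b i) ^ᶠ e ≡ root (pair i j lt)
    b-class = proj₂ (proj₂ chosen)

    ⊖-class : ∀ x → (⊖ x) ^ᶠ e ≡ x ^ᶠ e
    ⊖-class = ⊖-^-even f e≡

    label : ∀ {s t : Fin k} → Orient s t → Fin (pairs k)
    label {s} {t} (up lt) = pair s t lt
    label {s} {t} (down gt) = pair t s gt

    class : ∀ {s t : Fin k} (o : Orient s t) → (b t ⊝ b s) ^ᶠ e ≡ root (label o)
    class (up lt) = b-class _ _ lt
    class {s} {t} (down gt) = trans (cong (_^ᶠ e) (⊖-swap (b t) (b s))) (trans (⊖-class (b s ⊝ b t)) (b-class _ _ gt))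

    b-injective : ∀ {s t} → b s ≡ b t → s ≡ t
    b-injective {s} {t} eq with s ≟ᶠ t
    ... | yes e = e
    ... | no s≢t = contradiction (trans (cong (_⊝ b s) (sym eq)) (⊝-self (b s))) (class-≢𝟘 (label (orient s t s≢t)) (class (orient s t s≢t)))

    -- Picks one of `x` and its negative by comparing codes; for nonzero `x` these differ since the
    -- characteristic is not 2.
    Half : Fin q → Set
    Half x = toℕ x < toℕ (⊖ x)

    Λ : (Fin 1 → Fin q) → Set
    Λ d = d zero ^ᶠ e ≡ 𝟙 × Half (d zero)

    Hit : Fin 1 → Fin 1 → (Fin 1 → Fin q) → Set
    Hit i j δ = ∃ λ s → ∃ λ t → ∃ λ d → Λ d × zero ≡ i × zero ≡ j × (∀ x → (b t ⊝ b s) ⊗ d x ≡ δ x)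

    hit : ∀ i j δ → ¬ (∀ x → δ x ≡ 𝟘) → ∃ λ (β : ⊤) → Hit i j δ
    hit zero zero δ δ≢𝟘 = result (cls-label (δ zero) δ₀)
      where
      δ₀ : δ zero ≢ 𝟘
      δ₀ eq = δ≢𝟘 λ { zero → eq }
      result : (∃ λ r → root r ≡ δ zero ^ᶠ e) → ∃ λ (β : ⊤) → Hit zero zero δ
      result (r , er) with pair-surjective r
      ... | i , j , lt , el = tt , signed (<-cmp (toℕ h) (toℕ (⊖ h)))
        where
        D = b j ⊝ b i
        D≢𝟘 : D ≢ 𝟘
        D≢𝟘 = class-≢𝟘 (pair i j lt) (b-class i j lt)
        h = δ zero ⊗ D ⁻¹
        h^e : h ^ᶠ e ≡ 𝟙
        h^e = ^-quotient e D≢𝟘 (trans (sym er) (trans (cong root (sym el)) (sym (b-class i j lt))))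
        h≢𝟘 : h ≢ 𝟘
        h≢𝟘 = ⊗-≢𝟘 δ₀ (⁻¹-≢𝟘 D≢𝟘)
        Dh : D ⊗ h ≡ δ zero
        Dh = trans (⊗-comm D h) (trans (⊗-assoc _ _ _) (trans (cong (δ zero ⊗_) (inverseˡ D D≢𝟘)) (⊗-𝟙ʳ _)))
        signed : Tri (toℕ h < toℕ (⊖ h)) (toℕ h ≡ toℕ (⊖ h)) (toℕ h > toℕ (⊖ h)) → Hit zero zero δ
        signed (tri< lt' _ _) = i , j , (λ _ → h) , (h^e , lt') , refl , refl , λ { zero → Dh }
        signed (tri≈ _ eq _) = contradiction (toℕ-injective eq) (≢⊖ two h≢𝟘)
        signed (tri> _ _ gt) = j , i , (λ _ → ⊖ h) , (trans (⊖-class h) h^e , subst (λ t → toℕ (⊖ h) < toℕ t) (sym (⊖-involutive h)) gt)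
          , refl , refl , λ { zero → trans (solve 3 (λ x y h → (x :- y) :* (:- h) := (y :- x) :* h) refl (b i) (b j) h) Dh }

    -- Equal classes mean the same unordered pair of positions. In opposite order the directions
    -- would be negatives of each other, which the half-system excludes.
    meet-scalar : ∀ s t s' t' d d' → d ^ᶠ e ≡ 𝟙 → Half d → d' ^ᶠ e ≡ 𝟙 → Half d' → s ≢ t →
      (b t ⊝ b s) ⊗ d ≡ (b t' ⊝ b s') ⊗ d' → s ≡ s' × d ≡ d'
    meet-scalar s t s' t' d d' d^e hd d'^e hd' s≢t eq = match o (orient s' t' s'≢t')
      where
      o = orient s t s≢t
      D≢𝟘 : b t ⊝ b s ≢ 𝟘
      D≢𝟘 = class-≢𝟘 (label o) (class o)
      nonzero : ∀ {x} → x ^ᶠ e ≡ 𝟙 → x ≢ 𝟘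
      nonzero h x≡𝟘 = 𝟙≢𝟘 (trans (sym h) (trans (cong (_^ᶠ e) x≡𝟘) (𝟘^suc e-1)))
      s'≢t' : s' ≢ t'
      s'≢t' e' = ⊗-≢𝟘 D≢𝟘 (nonzero d^e) (trans eq (trans (cong (λ u → (b t' ⊝ b u) ⊗ d') e') (trans (cong (_⊗ d') (⊝-self _)) (⊗-𝟘ˡ d'))))
      drop : ∀ D x → x ^ᶠ e ≡ 𝟙 → (D ⊗ x) ^ᶠ e ≡ D ^ᶠ e
      drop D x h = trans (^-distrib-⊗ D x e) (trans (cong (D ^ᶠ e ⊗_) h) (⊗-𝟙ʳ _))
      labels : ∀ (o : Orient s t) (o' : Orient s' t') → label o ≡ label o'
      labels o o' = root-injective (trans (sym (class o)) (trans (sym (drop _ d d^e))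
        (trans (cong (_^ᶠ e) eq) (trans (drop _ d' d'^e) (class o')))))
      same : s ≡ s' × t ≡ t' → s ≡ s' × d ≡ d'
      same (refl , refl) = refl , ⊗-cancelˡ (b t ⊝ b s) D≢𝟘 eq
      opposite : s ≡ t' × t ≡ s' → s ≡ s' × d ≡ d'
      opposite (refl , refl) = ⊥-elim (<-asym hd (subst₂ (λ x y → toℕ x < toℕ y) d'≡ (trans (cong ⊖_ d'≡) (⊖-involutive d)) hd'))
        where
        d'≡ : d' ≡ ⊖ d
        d'≡ = ⊖-injective (trans (⊗-cancelˡ (b t ⊝ b s) D≢𝟘 (trans
          (solve 3 (λ x y h → (x :- y) :* (:- h) := (y :- x) :* h) refl (b t) (b s) d') (sym eq))) (sym (⊖-involutive d)))
      swap : ∀ {A B : Set} → A × B → B × A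
      swap (x , y) = y , x
      match : Orient s t → Orient s' t' → s ≡ s' × d ≡ d'
      match (up lt) (up lt') = same (pair-injective lt lt' (labels (up lt) (up lt')))
      match (down lt) (down lt') = same (swap (pair-injective lt lt' (labels (down lt) (down lt'))))
      match (up lt) (down lt') = opposite (pair-injective lt lt' (labels (up lt) (down lt')))
      match (down lt) (up lt') = opposite (swap (pair-injective lt lt' (labels (down lt) (up lt'))))

  baseFamily : BaseFamily F 1 1 k
  baseFamily = record
    { Base = ⊤
    ; bases = tt ∷ []
    ; bases-complete = λ _ → here refl
    ; lay = λ _ _ → zero
    ; coe = λ _ → b
    ; coe-injective = λ _ → b-injective
    ; Λ = Λ
    ; Λ? = λ d → (d zero ^ᶠ e ≟ᶠ 𝟙) ×-dec (toℕ (d zero) <? toℕ (⊖ d zero))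
    ; Λ-cong = λ eq → subst (λ x → x ^ᶠ e ≡ 𝟙 × Half x) (eq zero)
    ; Λ-nonzero = λ (h , _) z → 𝟙≢𝟘 (trans (sym h) (trans (cong (_^ᶠ e) (z zero)) (𝟘^suc e-1)))
    ; hit = hit
    ; meet = λ β β' s t s' t' d d' (d^e , hd) (d'^e , hd') s≢t _ _ eq l →
        meet' s t s' t' d d' l (meet-scalar s t s' t' (d zero) (d' zero) d^e hd d'^e hd' s≢t (eq zero)) }
    where
    meet' : ∀ s t s' t' (d d' : Fin 1 → Fin q) l → s ≡ s' × d zero ≡ d' zero →
      ∃ λ l' → zero {0} ≡ zero × (∀ x → (b l' ⊝ b s') ⊗ d' x ≡ (b l ⊝ b s) ⊗ d x)
    meet' s t s' t' d d' l (refl , ed) = l , refl , λ { zero → cong ((b l ⊝ b s) ⊗_) (sym ed) }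

  tupleDesign : TupleDesign (1 * q ^ 1) k
  tupleDesign = Family.tupleDesign (Development.family F 1 1 k (noBlocks k) baseFamily)

-- Replication numbers

module Replication {c h-1 : ℕ} (T : TupleDesign c (suc h-1)) (h-1>0 : 0 < h-1) where
  open TupleDesign T

  On : Fin c → Fin size → Set
  On i S = ∃ λ l → pt S l ≡ i

  on? : ∀ i S → Dec (On i S)
  on? i S = any? (λ l → pt S l ≟ᶠ i)

  degree : Fin c → ℕ
  degree i = count (on? i)

  private
    joint : ∀ i y → ∑ (λ S → ⟦ on? i S ⟧ * ⟦ on? y S ⟧) ≡ ⟦ y ≟ᶠ i ⟧ * degree i + ⟦ ¬? (y ≟ᶠ i) ⟧
    joint i y with y ≟ᶠ i
    ... | yes refl = trans (∑-cong (λ S → idem (on? i S))) (sym (trans (+-identityʳ _) (+-identityʳ _)))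
      where
      idem : ∀ {P : Set} (d : Dec P) → ⟦ d ⟧ * ⟦ d ⟧ ≡ ⟦ d ⟧
      idem (yes _) = refl
      idem (no _) = refl
    ... | no y≢i with through i y (y≢i ∘ sym)
    ... | S , s , t , es , et = trans (∑-cong (λ S → sym (⟦⟧-× (on? i S) (on? y S))))
              (count-singleton (λ S → on? i S ×-dec on? y S) S ((s , es) , (t , et))
                (λ S' ((s' , es') , (t' , et')) → sym (unique S S' s t s' t'
                  (λ { refl → y≢i (trans (sym et) es) }) (trans es (sym es')) (trans et (sym et')))))

  -- Pairs of a point `y` and a block through `i` and `y` are counted in two ways: a block through
  -- `i` accounts for `suc h-1` of them, a point `y` for one, except `i` itself, which accounts for
  -- `degree i`.
  degree≡ : ∀ m → c ≡ suc (h-1 * m) → ∀ i → degree i ≡ m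
  degree≡ m c≡ i = sym (*-cancelˡ-≡ m (degree i) h-1 ⦃ >-nonZero h-1>0 ⦄ (+-cancelˡ-≡ (degree i) _ _ (begin
    degree i + h-1 * m
      ≡⟨ cong (degree i +_) (sym others) ⟩
    degree i + count (λ y → ¬? (y ≟ᶠ i))
      ≡⟨ cong (_+ count (λ y → ¬? (y ≟ᶠ i))) (sym (trans (∑-*ʳ (λ y → ⟦ y ≟ᶠ i ⟧) (degree i))
           (trans (cong (_* degree i) (count-singleton (_≟ᶠ i) i refl (λ _ e → e))) (+-identityʳ (degree i))))) ⟩
    ∑ (λ y → ⟦ y ≟ᶠ i ⟧ * degree i) + count (λ y → ¬? (y ≟ᶠ i))
      ≡⟨ sym (∑-+ (λ y → ⟦ y ≟ᶠ i ⟧ * degree i) (λ y → ⟦ ¬? (y ≟ᶠ i) ⟧)) ⟩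
    ∑ (λ y → ⟦ y ≟ᶠ i ⟧ * degree i + ⟦ ¬? (y ≟ᶠ i) ⟧)
      ≡⟨ ∑-cong (λ y → sym (joint i y)) ⟩
    ∑ (λ y → ∑ (λ S → ⟦ on? i S ⟧ * ⟦ on? y S ⟧))
      ≡⟨ ∑-swap (λ y S → ⟦ on? i S ⟧ * ⟦ on? y S ⟧) ⟩
    ∑ (λ S → ∑ (λ y → ⟦ on? i S ⟧ * ⟦ on? y S ⟧))
      ≡⟨ ∑-cong (λ S → trans (∑-*ˡ ⟦ on? i S ⟧ (λ y → ⟦ on? y S ⟧)) (cong (⟦ on? i S ⟧ *_) (count-image (pt S) (pt-injective S)))) ⟩
    ∑ (λ S → ⟦ on? i S ⟧ * suc h-1)
      ≡⟨ ∑-*ʳ (λ S → ⟦ on? i S ⟧) (suc h-1) ⟩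
    degree i * suc h-1
      ≡⟨ trans (*-suc (degree i) h-1) (cong (degree i +_) (*-comm (degree i) h-1)) ⟩
    degree i + h-1 * degree i ∎)))
    where
    open ≡-Reasoning
    others : count (λ y → ¬? (y ≟ᶠ i)) ≡ h-1 * m
    others = ℕ-suc-injective (trans (cong (_+ count (λ y → ¬? (y ≟ᶠ i))) (sym (count-singleton (_≟ᶠ i) i refl (λ _ e → e))))
      (trans (count-¬ (_≟ᶠ i)) c≡))

  blocksOn : ∀ m → c ≡ suc (h-1 * m) → ∀ i → Enumeration (On i) m
  blocksOn m c≡ i = subst (Enumeration (On i)) (degree≡ m c≡ i) (enumerate (on? i))

-- Conditions on a block with scalars `β l` and their negatives: `β l ⊕ β l` is the difference
-- within a layer, with class prescribed by `z`; up to sign, `β l' ⊝ β l` and `β l' ⊕ β l` are the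
-- differences between two layers.
record Scalars {q : ℕ} (F : FiniteField q) {m : ℕ} (Z : Fermat.Roots F m) (e : ℕ) {h : ℕ} (z : Fin h → Fin m) : Set where
  open Field F
  field
    β : Fin h → Fin q
    β-class : ∀ l → (β l ⊕ β l) ^ᶠ e ≡ Fermat.Roots.root Z (z l)
    β-⊝ : ∀ l l' → l ≢ l' → β l' ⊝ β l ≢ 𝟘
    β-⊕ : ∀ l l' → l ≢ l' → β l' ⊕ β l ≢ 𝟘
    β-≢ : ∀ l l' → l ≢ l' → (β l' ⊝ β l) ^ᶠ e ≢ (β l' ⊕ β l) ^ᶠ e

-- Difference and sum of two scalars have different classes as soon as their product is a nonsquare.
module SymmetricBlock {q : ℕ} (F : FiniteField q) (two : Field._⊕_ F (Field.𝟙 F) (Field.𝟙 F) ≢ Field.𝟘 F)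
  (m m' f e-1 e₂-1 : ℕ) (m≡ : m ≡ 2 * m') (e≡ : suc e-1 ≡ 2 * f) (e₂≡ : suc e₂-1 ≡ suc e-1 * m')
  (q≡ : q ≡ suc (m * suc e-1)) (q≡₂ : q ≡ suc (2 * suc e₂-1))
  (Z : Fermat.Roots F m) (Z₂ : Fermat.Roots F 2) where
  open Field F
  open Fermat F
  open Roots Z
  module W = Wilson F m e-1 q≡ Z
  module W₂ = Wilson F 2 e₂-1 q≡₂ Z₂

  e = suc e-1
  e₂ = suc e₂-1

  ⊖-class : ∀ x → (⊖ x) ^ᶠ e ≡ x ^ᶠ e
  ⊖-class = ⊖-^-even f e≡

  double : Fin q → Fin q
  double x = x ⊕ x

  double≡ : ∀ x → double x ≡ x ⊗ (𝟙 ⊕ 𝟙)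
  double≡ = solve 1 (λ x → x :+ x := x :* (con (pos 1) :+ con (pos 1))) refl

  module _ (large : 4 * m * m * 1 + 4 * m < q) (r : Fin m) where
    Root : Fin q → Set
    Root β = double β ^ᶠ e ≡ root r

    root? : ∀ β → Dec (Root β)
    root? β = double β ^ᶠ e ≟ᶠ root r

    -- The squares are what the second moment argument chooses, with two classes, since the
    -- condition to be met concerns differences of squares.
    SquareOf : Fin q → Set
    SquareOf γ = ∃ λ β → γ ≡ β ⊗ β × Root β

    squareOf? : ∀ γ → Dec (SquareOf γ)
    squareOf? γ = any? (λ β → (γ ≟ᶠ β ⊗ β) ×-dec root? β)

    private
      all? : (x : Fin q) → Dec ⊤
      all? _ = yes tt

      all≡ : count all? ≡ q
      all≡ = count-all all? (λ _ → tt)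

      -- Applied to the whole field, the bound on bad places yields a `b` such that the translate by
      -- `b` of the class `r`, and so the class itself, has at least `q / (2 * m)` elements.
      good : ∃ λ b → ⟦ W.bad? all? r b ⟧ < 1
      good = ∑-<⇒∃ (λ b → ⟦ W.bad? all? r b ⟧) (λ _ → 1)
        (≤-<-trans (W.bad-bound all? 1 r (≤-reflexive (trans (sym all≡) (sym (*-identityʳ _)))))
          (<-≤-trans large (≤-reflexive (sym (trans (∑-const q 1) (*-identityʳ q))))))

      b : Fin q
      b = proj₁ good

      not-bad : q ≤ 2 * m * W.hits all? b r
      not-bad = ≤-trans (≤-reflexive (sym all≡)) (≮⇒≥ λ bad →
        <-irrefl refl (subst (_< 1) (⟦⟧-yes (W.bad? all? r b) bad) (proj₂ good)))

      half : Fin q → Fin q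
      half x = (x ⊝ b) ⊗ (𝟙 ⊕ 𝟙) ⁻¹

      double-half : ∀ x → double (half x) ≡ x ⊝ b
      double-half x = trans (double≡ (half x)) (trans (⊗-assoc _ _ _) (trans (cong ((x ⊝ b) ⊗_) (inverseˡ (𝟙 ⊕ 𝟙) two)) (⊗-𝟙ʳ _)))

      half-injective : ∀ {x y} → half x ≡ half y → x ≡ y
      half-injective {x} {y} eq = trans (shift x) (trans (cong (_⊕ b) (trans (sym (double-half x)) (trans (cong double eq) (double-half y)))) (sym (shift y)))
        where
        shift : ∀ t → t ≡ (t ⊝ b) ⊕ b
        shift t = solve 2 (λ t b → t := (t :- b) :+ b) refl t b

      roots-many : W.hits all? b r ≤ count root?
      roots-many = count-injection (λ x → all? x ×-dec W.in? b x r) root? half half-injective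
        (λ x (_ , i) → trans (cong (_^ᶠ e) (double-half x)) i)

      few-square-roots : ∀ γ → count (λ β → γ ≟ᶠ β ⊗ β) ≤ 2
      few-square-roots γ = count-≤ (λ β → γ ≟ᶠ β ⊗ β) 2 (λ g inj sat → root-of-unity-bound g inj γ
        (λ s → trans (cong (g s ⊗_) (⊗-𝟙ʳ (g s))) (sym (sat s))))

      squares-many : count root? ≤ count squareOf? * 2
      squares-many = begin
        count root?
          ≡⟨ ∑-cong (λ β → sym (trans (∑-*ʳ (λ γ → ⟦ γ ≟ᶠ β ⊗ β ⟧) ⟦ root? β ⟧)
               (trans (cong (_* ⟦ root? β ⟧) (count-singleton (_≟ᶠ β ⊗ β) (β ⊗ β) refl (λ _ eq → eq))) (*-identityˡ _)))) ⟩
        ∑ (λ β → ∑ (λ γ → ⟦ γ ≟ᶠ β ⊗ β ⟧ * ⟦ root? β ⟧))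
          ≡⟨ ∑-swap (λ β γ → ⟦ γ ≟ᶠ β ⊗ β ⟧ * ⟦ root? β ⟧) ⟩
        ∑ (λ γ → ∑ (λ β → ⟦ γ ≟ᶠ β ⊗ β ⟧ * ⟦ root? β ⟧))
          ≤⟨ ∑-mono fibre ⟩
        ∑ (λ γ → ⟦ squareOf? γ ⟧ * 2)
          ≡⟨ ∑-*ʳ (λ γ → ⟦ squareOf? γ ⟧) 2 ⟩
        count squareOf? * 2 ∎
        where
        open ≤-Reasoning
        fibre : ∀ γ → ∑ (λ β → ⟦ γ ≟ᶠ β ⊗ β ⟧ * ⟦ root? β ⟧) ≤ ⟦ squareOf? γ ⟧ * 2
        fibre γ with squareOf? γ
        ... | yes _ = ≤-trans (∑-mono (λ β → ≤-trans (*-monoʳ-≤ ⟦ γ ≟ᶠ β ⊗ β ⟧ (⟦⟧-≤1 (root? β))) (≤-reflexive (*-identityʳ _)))) (few-square-roots γ)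
        ... | no none = ≤-reflexive (∑-zero (λ β → trans (sym (⟦⟧-× (γ ≟ᶠ β ⊗ β) (root? β)))
                (⟦⟧-no ((γ ≟ᶠ β ⊗ β) ×-dec root? β) (λ p → none (β , p)))))

    -- A factor `2 * m` is lost in the bound on the class, another 2 because squaring is at most
    -- two-to-one.
    squares-dense : q ≤ count squareOf? * (4 * m)
    squares-dense = ≤-trans not-bad (≤-trans (*-monoʳ-≤ (2 * m) (≤-trans roots-many squares-many))
      (≤-reflexive (arith m (count squareOf?))))
      where
      arith : ∀ m n → 2 * m * (n * 2) ≡ n * (4 * m)
      arith = solve-∀

  𝟙≢⊖𝟙 : 𝟙 ≢ ⊖ 𝟙
  𝟙≢⊖𝟙 = ≢⊖ two 𝟙≢𝟘

  coarse : ∀ {x y} → x ^ᶠ e ≡ y ^ᶠ e → x ^ᶠ e₂ ≡ y ^ᶠ e₂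
  coarse {x} {y} eq = begin
    x ^ᶠ e₂ ≡⟨ cong (x ^ᶠ_) e₂≡ ⟩
    x ^ᶠ (e * m') ≡⟨ ^-* x e m' ⟩
    (x ^ᶠ e) ^ᶠ m' ≡⟨ cong (_^ᶠ m') eq ⟩
    (y ^ᶠ e) ^ᶠ m' ≡⟨ sym (^-* y e m') ⟩
    y ^ᶠ (e * m') ≡⟨ cong (y ^ᶠ_) (sym e₂≡) ⟩
    y ^ᶠ e₂ ∎
    where open ≡-Reasoning

  square-class : ∀ x → x ≢ 𝟘 → x ^ᶠ e₂ ⊗ x ^ᶠ e₂ ≡ 𝟙
  square-class x nx = begin
    x ^ᶠ e₂ ⊗ x ^ᶠ e₂ ≡⟨ sym (^-distribˡ-+ x e₂ e₂) ⟩
    x ^ᶠ (e₂ + e₂) ≡⟨ cong (λ n → x ^ᶠ (e₂ + n)) (sym (+-identityʳ e₂)) ⟩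
    x ^ᶠ (2 * e₂) ≡⟨ fermat q≡₂ x nx ⟩
    𝟙 ∎
    where open ≡-Reasoning

  -- As `m` is even, the class modulo m-th powers determines the quadratic character (`coarse`), so
  -- equal classes would make the product a square.
  nonsquare-product : ∀ x y → (x ⊗ y) ^ᶠ e₂ ≡ ⊖ 𝟙 → x ≢ 𝟘 × y ≢ 𝟘 × x ^ᶠ e ≢ y ^ᶠ e
  nonsquare-product x y eq = x≢𝟘 , y≢𝟘 , λ same → 𝟙≢⊖𝟙 (begin
    𝟙 ≡⟨ sym (square-class y y≢𝟘) ⟩
    y ^ᶠ e₂ ⊗ y ^ᶠ e₂ ≡⟨ cong (_⊗ y ^ᶠ e₂) (sym (coarse same)) ⟩
    x ^ᶠ e₂ ⊗ y ^ᶠ e₂ ≡⟨ sym (^-distrib-⊗ x y e₂) ⟩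
    (x ⊗ y) ^ᶠ e₂ ≡⟨ eq ⟩
    ⊖ 𝟙 ∎)
    where
    open ≡-Reasoning
    xy≢𝟘 : x ⊗ y ≢ 𝟘
    xy≢𝟘 z = ⊖-≢𝟘 𝟙≢𝟘 (trans (sym eq) (trans (cong (_^ᶠ e₂) z) (𝟘^suc e₂-1)))
    x≢𝟘 : x ≢ 𝟘
    x≢𝟘 z = xy≢𝟘 (trans (cong (_⊗ y) z) (⊗-𝟘ˡ y))
    y≢𝟘 : y ≢ 𝟘
    y≢𝟘 z = xy≢𝟘 (trans (cong (x ⊗_) z) (⊗-𝟘ʳ x))

  separate-swap : ∀ {x y} → x ⊝ y ≢ 𝟘 × x ⊕ y ≢ 𝟘 × (x ⊝ y) ^ᶠ e ≢ (x ⊕ y) ^ᶠ e →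
    y ⊝ x ≢ 𝟘 × y ⊕ x ≢ 𝟘 × (y ⊝ x) ^ᶠ e ≢ (y ⊕ x) ^ᶠ e
  separate-swap {x} {y} (D≢ , S≢ , C≢) =
      (λ z → D≢ (trans (⊖-swap x y) (trans (cong ⊖_ z) ⊖-𝟘)))
    , (λ z → S≢ (trans (⊕-comm x y) z))
    , (λ eq → C≢ (begin
        (x ⊝ y) ^ᶠ e ≡⟨ cong (_^ᶠ e) (⊖-swap x y) ⟩
        (⊖ (y ⊝ x)) ^ᶠ e ≡⟨ ⊖-class (y ⊝ x) ⟩
        (y ⊝ x) ^ᶠ e ≡⟨ eq ⟩
        (y ⊕ x) ^ᶠ e ≡⟨ cong (_^ᶠ e) (⊕-comm y x) ⟩
        (x ⊕ y) ^ᶠ e ∎))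
    where open ≡-Reasoning

  difference-of-squares : ∀ x y → (x ⊝ y) ⊗ (x ⊕ y) ≡ x ⊗ x ⊝ y ⊗ y
  difference-of-squares = solve 2 (λ x y → (x :- y) :* (x :+ y) := x :* x :- y :* y) refl

  -- The label of the class of nonsquares.
  minus-one : ∃ λ r → Roots.root Z₂ r ≡ ⊖ 𝟙
  minus-one = Roots.root-onto Z₂ (⊖ 𝟙) (trans (⊖-^-even 1 refl 𝟙) (^-𝟙 2))

  module _ {h} (z : Fin h → Fin m) (β : Fin h → Fin q) (class : ∀ l → double (β l) ^ᶠ e ≡ root (z l))
    (nonsquare : ∀ l l' → l Fin.< l' → (β l' ⊗ β l' ⊝ β l ⊗ β l) ^ᶠ e₂ ≡ ⊖ 𝟙) where
    private
      Separate : Fin h → Fin h → Set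
      Separate l l' = β l' ⊝ β l ≢ 𝟘 × β l' ⊕ β l ≢ 𝟘 × (β l' ⊝ β l) ^ᶠ e ≢ (β l' ⊕ β l) ^ᶠ e

      separate-< : ∀ l l' → l Fin.< l' → Separate l l'
      separate-< l l' lt = nonsquare-product (β l' ⊝ β l) (β l' ⊕ β l)
        (trans (cong (_^ᶠ e₂) (difference-of-squares (β l') (β l))) (nonsquare l l' lt))

      separate : ∀ l l' → l ≢ l' → Separate l l'
      separate l l' ne with <-cmp (toℕ l) (toℕ l')
      ... | tri< lt _ _ = separate-< l l' lt
      ... | tri≈ _ eq _ = contradiction (toℕ-injective eq) ne
      ... | tri> _ _ gt = separate-swap (separate-< l' l gt)

    separated : Scalars F Z e z
    separated = record
      { β = β ; β-class = class
      ; β-⊝ = λ l l' ne → proj₁ (separate l l' ne)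
      ; β-⊕ = λ l l' ne → proj₁ (proj₂ (separate l l' ne))
      ; β-≢ = λ l l' ne → proj₂ (proj₂ (separate l l' ne)) }

  scalars : ∀ {h} (z : Fin h → Fin m) → 4 * m * m * 1 + 4 * m < q → threshold 2 h (4 * m) < q → Scalars F Z e z
  scalars {h} z large large₂ = build
    (W₂.choose h (λ l → squareOf? large (z l)) (4 * m) (λ l → squares-dense large (z l)) large₂ (λ _ _ _ → proj₁ minus-one))
    where
    build : (∃ λ (γ : Fin h → Fin q) → (∀ l → SquareOf large (z l) (γ l)) ×
      (∀ i j (lt : i Fin.< j) → (γ j ⊝ γ i) ^ᶠ e₂ ≡ Roots.root Z₂ (proj₁ minus-one))) → Scalars F Z e z
    build (γ , square , differ) = separated z (λ l → proj₁ (square l)) (λ l → proj₂ (proj₂ (square l)))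
      λ l l' lt → trans (cong (_^ᶠ e₂) (sym (cong₂ _⊝_ (proj₁ (proj₂ (square l'))) (proj₁ (proj₂ (square l))))))
        (trans (differ l l' lt) (proj₂ minus-one))

-- The base family on c layers

-- Invariance under the group is kept apart, as a property used only for the action. That values are
-- e-th powers means that each vector has a class, so it can be normalised by a difference of this
-- class.
record Invariant {q : ℕ} (F : FiniteField q) (N e : ℕ) : Set where
  open Field F
  field
    κ : (Fin N → Fin q) → Fin q
    κ-cong : ∀ {d d'} → (∀ x → d x ≡ d' x) → κ d ≡ κ d'
    κ-scale : ∀ s d → s ≢ 𝟘 → κ (λ x → s ⊗ d x) ≡ s ^ᶠ e ⊗ κ d
    κ-value : ∀ d → ¬ (∀ x → d x ≡ 𝟘) → ∃ λ t → t ≢ 𝟘 × κ d ≡ t ^ᶠ e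

opp : Fin 2 → Fin 2
opp zero = suc zero
opp (suc zero) = zero

same-or-opp : (ε ε' : Fin 2) → ε' ≡ ε ⊎ ε' ≡ opp ε
same-or-opp zero zero = inj₁ refl
same-or-opp zero (suc zero) = inj₂ refl
same-or-opp (suc zero) zero = inj₂ refl
same-or-opp (suc zero) (suc zero) = inj₁ refl

-- Layers i carry the points of two designs: the blocks S of small give base blocks {(i , ±β)} for i in S, and the
-- blocks A of big give base blocks meeting each layer of A once. For each pair of layers the former account
-- for two classes of differences, and the latter for the remaining ones.
module LayeredFamily {q : ℕ} (F : FiniteField q) (two : Field._⊕_ F (Field.𝟙 F) (Field.𝟙 F) ≢ Field.𝟘 F)
  (N c h m₂ f e-1 : ℕ) (e≡ : suc e-1 ≡ 2 * f) (q≡ : q ≡ suc (suc (suc m₂) * suc e-1))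
  (Z : Fermat.Roots F (suc (suc m₂)))
  (big : TupleDesign c (h * 2)) (small : TupleDesign c h)
  (blocksOn : ∀ i → Enumeration (λ S → ∃ λ l → TupleDesign.pt small S l ≡ i) (suc (suc m₂)))
  (scalars : ∀ S → Scalars F Z (suc e-1) (λ l → Enumeration.index (blocksOn (TupleDesign.pt small S l)) S (l , refl)))
  (transversal : (lab : ∀ (s t : Fin (h * 2)) → s Fin.< t → Fin (suc (suc m₂))) →
    ∃ λ (y : Fin (h * 2) → Fin q) → ∀ s t lt →
      Field._^ᶠ_ F (Field._⊝_ F (y t) (y s)) (suc e-1) ≡ Fermat.Roots.root Z (lab s t lt))
  (I : Invariant F N (suc e-1)) where
  open Field F
  open Fermat F
  open Roots Z
  open Wilson F (suc (suc m₂)) e-1 q≡ Z using (cls-label; class-≢𝟘)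
  open Invariant I
  module Big = TupleDesign big
  module Small = TupleDesign small

  m : ℕ
  m = suc (suc m₂)

  e : ℕ
  e = suc e-1

  β : Fin Small.size → Fin h → Fin q
  β S = Scalars.β (scalars S)

  -- Blocks through a layer are numbered by the classes, and the class of the doubled scalar on that
  -- layer is prescribed to be the number of the block. So the `m` blocks through a layer represent
  -- all classes there once.
  label : ∀ S l → Fin m
  label S l = Enumeration.index (blocksOn (Small.pt S l)) S (l , refl)

  ⊖-class : ∀ x → (⊖ x) ^ᶠ e ≡ x ^ᶠ e
  ⊖-class = ⊖-^-even f e≡

  β≢𝟘 : ∀ S l → β S l ≢ 𝟘
  β≢𝟘 S l eq = class-≢𝟘 (label S l) (Scalars.β-class (scalars S) l) (trans (cong₂ _⊕_ eq eq) (⊕-𝟘ʳ 𝟘))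

  Used : Fin c → Fin c → Fin m → Set
  Used i j r = ∃ λ S → ∃ λ l → ∃ λ l' → Small.pt S l ≡ i × Small.pt S l' ≡ j ×
    ((β S l' ⊝ β S l) ^ᶠ e ≡ root r ⊎ (β S l' ⊕ β S l) ^ᶠ e ≡ root r)

  used? : ∀ i j r → Dec (Used i j r)
  used? i j r = any? λ S → any? λ l → any? λ l' → (Small.pt S l ≟ᶠ i) ×-dec (Small.pt S l' ≟ᶠ j) ×-dec
    (((β S l' ⊝ β S l) ^ᶠ e ≟ᶠ root r) ⊎-dec ((β S l' ⊕ β S l) ^ᶠ e ≟ᶠ root r))

  used-sym : ∀ {i j r} → Used i j r → Used j i r
  used-sym (S , l , l' , ei , ej , inj₁ eq) = S , l' , l , ej , ei ,
    inj₁ (trans (cong (_^ᶠ e) (⊖-swap (β S l) (β S l'))) (trans (⊖-class (β S l' ⊝ β S l)) eq))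
  used-sym (S , l , l' , ei , ej , inj₂ eq) = S , l' , l , ej , ei ,
    inj₂ (trans (cong (_^ᶠ e) (⊕-comm (β S l) (β S l'))) eq)

  -- Only one block of `small` contains both layers, and the difference and the sum of its two
  -- scalars have different classes.
  used-count : ∀ i j → i ≢ j → count (used? i j) ≡ 2
  used-count i j i≢j with Small.through i j i≢j
  ... | S , l , l' , refl , refl with cls-label (β S l' ⊝ β S l) (Scalars.β-⊝ (scalars S) l l' (i≢j ∘ cong (Small.pt S)))
                                   | cls-label (β S l' ⊕ β S l) (Scalars.β-⊕ (scalars S) l l' (i≢j ∘ cong (Small.pt S)))
  ... | u , eu | v , ev = trans (∑-cong pointwise) (trans (∑-+ (λ r → ⟦ r ≟ᶠ u ⟧) (λ r → ⟦ r ≟ᶠ v ⟧))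
          (cong₂ _+_ (count-singleton (_≟ᶠ u) u refl (λ _ e → e)) (count-singleton (_≟ᶠ v) v refl (λ _ e → e))))
    where
    l≢l' : l ≢ l'
    l≢l' = i≢j ∘ cong (Small.pt S)
    u≢v : u ≢ v
    u≢v u≡v = Scalars.β-≢ (scalars S) l l' l≢l' (trans (sym eu) (trans (cong root u≡v) ev))
    only : ∀ r → Used (Small.pt S l) (Small.pt S l') r → r ≡ u ⊎ r ≡ v
    only r (S' , l₁ , l₁' , ei , ej , eq) with Small.unique S S' l l' l₁ l₁' l≢l' (sym ei) (sym ej)
    ... | refl with Small.pt-injective S ei | Small.pt-injective S ej
    only r (S' , l₁ , l₁' , ei , ej , inj₁ eq) | refl | refl | refl = inj₁ (root-injective (trans (sym eq) (sym eu)))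
    only r (S' , l₁ , l₁' , ei , ej , inj₂ eq) | refl | refl | refl = inj₂ (root-injective (trans (sym eq) (sym ev)))
    pointwise : ∀ r → ⟦ used? (Small.pt S l) (Small.pt S l') r ⟧ ≡ ⟦ r ≟ᶠ u ⟧ + ⟦ r ≟ᶠ v ⟧
    pointwise r with r ≟ᶠ u | r ≟ᶠ v
    ... | yes refl | yes r≡v = contradiction r≡v u≢v
    ... | yes refl | no _ = ⟦⟧-yes (used? _ _ r) (S , l , l' , refl , refl , inj₁ (sym eu))
    ... | no _ | yes refl = ⟦⟧-yes (used? _ _ r) (S , l , l' , refl , refl , inj₂ (sym ev))
    ... | no r≢u | no r≢v = ⟦⟧-no (used? _ _ r) λ used → excluded (only r used)
      where
      excluded : ¬ (r ≡ u ⊎ r ≡ v)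
      excluded (inj₁ r≡u) = r≢u r≡u
      excluded (inj₂ r≡v) = r≢v r≡v

  unused : ∀ i j → i ≢ j → Enumeration (λ r → ¬ Used i j r) m₂
  unused i j i≢j = subst (Enumeration (λ r → ¬ Used i j r))
    (+-cancelˡ-≡ 2 _ _ (trans (cong (_+ count (λ r → ¬? (used? i j r))) (sym (used-count i j i≢j))) (count-¬ (used? i j))))
    (enumerate (λ r → ¬? (used? i j r)))

  big-≢ : ∀ A {s t} → s ≢ t → Big.pt A s ≢ Big.pt A t
  big-≢ A s≢t eq = s≢t (Big.pt-injective A eq)

  rest : ∀ A (s t : Fin (h * 2)) → s Fin.< t → Enumeration (λ r → ¬ Used (Big.pt A s) (Big.pt A t) r) m₂
  rest A s t lt = unused (Big.pt A s) (Big.pt A t) (big-≢ A (Fin.<⇒≢ lt))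

  y : Fin Big.size → Fin m₂ → Fin (h * 2) → Fin q
  y A r = proj₁ (transversal (λ s t lt → Enumeration.elem (rest A s t lt) r))

  y-class : ∀ A r s t lt → (y A r t ⊝ y A r s) ^ᶠ e ≡ root (Enumeration.elem (rest A s t lt) r)
  y-class A r = proj₂ (transversal (λ s t lt → Enumeration.elem (rest A s t lt) r))

  restOf : ∀ A {s t} → Orient s t → Fin m₂ → Fin m
  restOf A {s} {t} (up lt) = Enumeration.elem (rest A s t lt)
  restOf A {s} {t} (down gt) = Enumeration.elem (rest A t s gt)

  restOf-injective : ∀ A {s t} (o o' : Orient s t) {r r'} → restOf A o r ≡ restOf A o' r' → r ≡ r'
  restOf-injective A {s} {t} (up lt) (up lt') {r} {r'} eq =
    Enumeration.elem-injective (rest A s t lt) (trans eq (cong (λ p → Enumeration.elem (rest A s t p) r') (<-irrelevant lt' lt)))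
  restOf-injective A (up lt) (down gt) eq = ⊥-elim (<-asym lt gt)
  restOf-injective A (down gt) (up lt) eq = ⊥-elim (<-asym lt gt)
  restOf-injective A {s} {t} (down lt) (down lt') {r} {r'} eq =
    Enumeration.elem-injective (rest A t s lt) (trans eq (cong (λ p → Enumeration.elem (rest A t s p) r') (<-irrelevant lt' lt)))

  restOf-unused : ∀ A {s t} (o : Orient s t) r → ¬ Used (Big.pt A s) (Big.pt A t) (restOf A o r)
  restOf-unused A {s} {t} (up lt) r = Enumeration.elem-sat (rest A s t lt) r
  restOf-unused A {s} {t} (down gt) r = Enumeration.elem-sat (rest A t s gt) r ∘ used-sym

  restOf-onto : ∀ A {s t} (o : Orient s t) z → ¬ Used (Big.pt A s) (Big.pt A t) z → ∃ λ r → restOf A o r ≡ z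
  restOf-onto A {s} {t} (up lt) z nu = Enumeration.index (rest A s t lt) z nu , Enumeration.elem-index (rest A s t lt) z nu
  restOf-onto A {s} {t} (down gt) z nu = Enumeration.index (rest A t s gt) z (nu ∘ used-sym) , Enumeration.elem-index (rest A t s gt) z (nu ∘ used-sym)

  restOf-class : ∀ A r {s t} (o : Orient s t) → (y A r t ⊝ y A r s) ^ᶠ e ≡ root (restOf A o r)
  restOf-class A r (up lt) = y-class A r _ _ lt
  restOf-class A r {s} {t} (down gt) = trans (cong (_^ᶠ e) (⊖-swap (y A r t) (y A r s))) (trans (⊖-class (y A r s ⊝ y A r t)) (y-class A r _ _ gt))

  -- A position of a symmetric block codes a layer index, `L`, and a sign, `E`.
  L : Fin (h * 2) → Fin h
  L p = proj₁ (remQuot {h} 2 p)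

  E : Fin (h * 2) → Fin 2
  E p = proj₂ (remQuot {h} 2 p)

  L-combine : ∀ l (ε : Fin 2) → L (combine l ε) ≡ l
  L-combine l ε = cong proj₁ (remQuot-combine l ε)

  E-combine : ∀ (l : Fin h) ε → E (combine l ε) ≡ ε
  E-combine l ε = cong proj₂ (remQuot-combine l ε)

  position-≡ : ∀ {p p'} → L p ≡ L p' → E p ≡ E p' → p ≡ p'
  position-≡ {p} {p'} el eε = trans (sym (combine-remQuot {h} 2 p)) (trans (cong₂ combine el eε) (combine-remQuot {h} 2 p'))

  sgn : Fin 2 → Fin q → Fin q
  sgn zero x = x
  sgn (suc zero) x = ⊖ x

  sgn-opp : ∀ ε x → sgn (opp ε) x ≡ ⊖ sgn ε x
  sgn-opp zero x = refl
  sgn-opp (suc zero) x = sym (⊖-involutive x)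

  sgn-⊝ : ∀ ε x y → (sgn ε y ⊝ sgn ε x) ^ᶠ e ≡ (y ⊝ x) ^ᶠ e
  sgn-⊝ zero x y = refl
  sgn-⊝ (suc zero) x y = trans (cong (_^ᶠ e) (solve 2 (λ x y → (:- y) :- (:- x) := :- (y :- x)) refl x y)) (⊖-class (y ⊝ x))

  sgn-⊕ : ∀ ε x y → (sgn (opp ε) y ⊝ sgn ε x) ^ᶠ e ≡ (y ⊕ x) ^ᶠ e
  sgn-⊕ zero x y = trans (cong (_^ᶠ e) (solve 2 (λ x y → (:- y) :- x := :- (y :+ x)) refl x y)) (⊖-class (y ⊕ x))
  sgn-⊕ (suc zero) x y = cong (_^ᶠ e) (solve 2 (λ x y → y :- (:- x) := y :+ x) refl x y)

  Base : Set
  Base = Fin Small.size ⊎ (Fin Big.size × Fin m₂)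

  lay : Base → Fin (h * 2) → Fin c
  lay (inj₁ S) p = Small.pt S (L p)
  lay (inj₂ (A , r)) s = Big.pt A s

  coe : Base → Fin (h * 2) → Fin q
  coe (inj₁ S) p = sgn (E p) (β S (L p))
  coe (inj₂ (A , r)) s = y A r s

  sym-class-⊝ : ∀ S s t → E t ≡ E s → (coe (inj₁ S) t ⊝ coe (inj₁ S) s) ^ᶠ e ≡ (β S (L t) ⊝ β S (L s)) ^ᶠ e
  sym-class-⊝ S s t eq = trans (cong (λ ε → (sgn ε (β S (L t)) ⊝ coe (inj₁ S) s) ^ᶠ e) eq) (sgn-⊝ (E s) _ _)

  sym-class-⊕ : ∀ S s t → E t ≡ opp (E s) → (coe (inj₁ S) t ⊝ coe (inj₁ S) s) ^ᶠ e ≡ (β S (L t) ⊕ β S (L s)) ^ᶠ e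
  sym-class-⊕ S s t eq = trans (cong (λ ε → (sgn ε (β S (L t)) ⊝ coe (inj₁ S) s) ^ᶠ e) eq) (sgn-⊕ (E s) _ _)

  power-≢𝟘 : ∀ {x y} → x ≢ 𝟘 → y ^ᶠ e ≡ x ^ᶠ e → y ≢ 𝟘
  power-≢𝟘 {x} {y} nx eq y≡𝟘 = ^-≢𝟘 e nx (trans (sym eq) (trans (cong (_^ᶠ e) y≡𝟘) (𝟘^suc e-1)))

  sgn-≢𝟘 : ∀ ε {x} → x ≢ 𝟘 → sgn ε x ≢ 𝟘
  sgn-≢𝟘 zero nx = nx
  sgn-≢𝟘 (suc zero) nx = ⊖-≢𝟘 nx

  sgn-injective : ∀ {ε ε' x} → x ≢ 𝟘 → sgn ε x ≡ sgn ε' x → ε' ≡ ε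
  sgn-injective {ε} {ε'} {x} nx eq with same-or-opp ε ε'
  ... | inj₁ same = same
  ... | inj₂ refl = contradiction (trans eq (sgn-opp ε x)) (≢⊖ two (sgn-≢𝟘 ε nx))

  sgn-separate : ∀ ε ε' {x y} → y ⊝ x ≢ 𝟘 → y ⊕ x ≢ 𝟘 → sgn ε x ≢ sgn ε' y
  sgn-separate ε ε' {x} {y} nd ns eq with same-or-opp ε ε'
  ... | inj₁ refl = power-≢𝟘 nd (sgn-⊝ ε x y) (trans (cong (_⊝ sgn ε x) (sym eq)) (⊝-self (sgn ε x)))
  ... | inj₂ refl = power-≢𝟘 ns (sgn-⊕ ε x y) (trans (cong (_⊝ sgn ε x) (sym eq)) (⊝-self (sgn ε x)))

  sym-injective : ∀ S s t → Dec (L s ≡ L t) → coe (inj₁ S) s ≡ coe (inj₁ S) t → s ≡ t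
  sym-injective S s t (yes el) eq = position-≡ el (sym (sgn-injective {E s} {E t} (β≢𝟘 S (L s))
    (trans eq (cong (λ l → sgn (E t) (β S l)) (sym el)))))
  sym-injective S s t (no nl) eq = contradiction eq
    (sgn-separate (E s) (E t) (Scalars.β-⊝ (scalars S) (L s) (L t) nl) (Scalars.β-⊕ (scalars S) (L s) (L t) nl))

  transversal-injective : ∀ A r s t → Dec (s ≡ t) → y A r s ≡ y A r t → s ≡ t
  transversal-injective A r s t (yes s≡t) eq = s≡t
  transversal-injective A r s t (no s≢t) eq = contradiction (trans (cong (_⊝ y A r s) (sym eq)) (⊝-self (y A r s)))
    (class-≢𝟘 (restOf A (orient s t s≢t) r) (restOf-class A r (orient s t s≢t)))

  coe-injective : ∀ b {s t} → coe b s ≡ coe b t → s ≡ t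
  coe-injective (inj₁ S) {s} {t} = sym-injective S s t (L s ≟ᶠ L t)
  coe-injective (inj₂ (A , r)) {s} {t} = transversal-injective A r s t (s ≟ᶠ t)

  Hit : Fin c → Fin c → Fin m → Set
  Hit i j z = ∃ λ b → ∃ λ s → ∃ λ t → lay b s ≡ i × lay b t ≡ j × (coe b t ⊝ coe b s) ^ᶠ e ≡ root z

  hit-sym : ∀ S l l' z ε → (sgn ε (β S l') ⊝ β S l) ^ᶠ e ≡ root z → Hit (Small.pt S l) (Small.pt S l') z
  hit-sym S l l' z ε eq = inj₁ S , combine l zero , combine l' ε , cong (Small.pt S) (L-combine l zero) , cong (Small.pt S) (L-combine l' ε) ,
    trans (cong (_^ᶠ e) (cong₂ _⊝_ (cong₂ sgn (E-combine l' ε) (cong (β S) (L-combine l' ε)))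
      (cong₂ sgn (E-combine l zero) (cong (β S) (L-combine l zero))))) eq

  hit-on-layer : ∀ i z S l → Enumeration.elem (blocksOn i) z ≡ S → Small.pt S l ≡ i → Hit i i z
  hit-on-layer i z S l eS refl = hit-sym S l l z (suc zero) (trans (sgn-⊕ zero (β S l) (β S l))
    (trans (Scalars.β-class (scalars S) l) (cong root (Enumeration.elem-injective (blocksOn i)
      (trans (Enumeration.elem-index (blocksOn i) S (l , refl)) (sym eS))))))

  -- On one layer the block numbered `z` serves; between two layers the symmetric block, if `z` is
  -- one of its two classes, and otherwise a transversal block.
  hit-scalar : ∀ i j z → Hit i j z
  hit-scalar i j z with i ≟ᶠ j
  ... | yes refl = hit-on-layer i z _ _ refl (proj₂ (Enumeration.elem-sat (blocksOn i) z))
  ... | no i≢j with used? i j z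
  ... | yes (S , l , l' , refl , refl , inj₁ eq) = hit-sym S l l' z zero eq
  ... | yes (S , l , l' , refl , refl , inj₂ eq) = hit-sym S l l' z (suc zero) (trans (sgn-⊕ zero (β S l) (β S l')) eq)
  ... | no nu = transversal-hit (Big.through i j i≢j)
    where
    transversal-hit : (∃ λ A → ∃ λ s → ∃ λ t → Big.pt A s ≡ i × Big.pt A t ≡ j) → Hit i j z
    transversal-hit (A , s , t , refl , refl) = found (restOf-onto A o z nu)
      where
      o = orient s t (i≢j ∘ cong (Big.pt A))
      found : (∃ λ r → restOf A o r ≡ z) → Hit (Big.pt A s) (Big.pt A t) z
      found (r , er) = inj₂ (A , r) , s , t , refl , refl , trans (restOf-class A r o) (cong root er)

  -- The blocks coincide once the two given differences are scaled to the same vector;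
  -- cross-multiplication keeps the directions out.
  Transport : Base → Fin (h * 2) → Fin (h * 2) → Base → Fin (h * 2) → Fin (h * 2) → Set
  Transport b s t b' s' t' = ∀ l → ∃ λ l' → lay b' l' ≡ lay b l ×
    (coe b' l' ⊝ coe b' s') ⊗ (coe b t ⊝ coe b s) ≡ (coe b l ⊝ coe b s) ⊗ (coe b' t' ⊝ coe b' s')

  transport-refl : ∀ b s t → Transport b s t b s t
  transport-refl b s t l = l , refl , refl

  -- Negation of all scalars maps a symmetric block to itself. Opposite directions thus give the
  -- same block, which is why such blocks are listed more than once.
  flip : Fin (h * 2) → Fin (h * 2)
  flip p = combine (L p) (opp (E p))

  flip-lay : ∀ S p → lay (inj₁ S) (flip p) ≡ lay (inj₁ S) p
  flip-lay S p = cong (Small.pt S) (L-combine (L p) (opp (E p)))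

  flip-coe : ∀ S p → coe (inj₁ S) (flip p) ≡ ⊖ coe (inj₁ S) p
  flip-coe S p = trans (cong₂ sgn (E-combine (L p) (opp (E p))) (cong (β S) (L-combine (L p) (opp (E p))))) (sgn-opp (E p) (β S (L p)))

  transport-flip : ∀ S s t → Transport (inj₁ S) s t (inj₁ S) (flip s) (flip t)
  transport-flip S s t l = flip l , flip-lay S l ,
    trans (cong₂ (λ x y → (x ⊝ y) ⊗ (coe (inj₁ S) t ⊝ coe (inj₁ S) s)) (flip-coe S l) (flip-coe S s))
      (trans (solve 3 (λ l s t → ((:- l) :- (:- s)) :* (t :- s) := (l :- s) :* ((:- t) :- (:- s))) refl
        (coe (inj₁ S) l) (coe (inj₁ S) s) (coe (inj₁ S) t))
        (sym (cong₂ (λ x y → (coe (inj₁ S) l ⊝ coe (inj₁ S) s) ⊗ (x ⊝ y)) (flip-coe S t) (flip-coe S s))))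

  flip-≡ : ∀ {p p'} → L p ≡ L p' → E p' ≡ opp (E p) → flip p ≡ p'
  flip-≡ {p} {p'} el eε = position-≡ (trans (L-combine (L p) _) el) (trans (E-combine (L p) _) (sym eε))

  transport-sym : ∀ S s t s' t' → L s ≡ L s' → L t ≡ L t' →
    (E s' ≡ E s × E t' ≡ E t) ⊎ (E s' ≡ opp (E s) × E t' ≡ opp (E t)) → Transport (inj₁ S) s t (inj₁ S) s' t'
  transport-sym S s t s' t' el el' (inj₁ (es , et)) with position-≡ el (sym es) | position-≡ el' (sym et)
  ... | refl | refl = transport-refl (inj₁ S) s t
  transport-sym S s t s' t' el el' (inj₂ (es , et)) =
    subst₂ (Transport (inj₁ S) s t (inj₁ S)) (flip-≡ el es) (flip-≡ el' et) (transport-flip S s t)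

  SameSigns : (s t s' t' : Fin (h * 2)) → Set
  SameSigns s t s' t' = (E s' ≡ E s × E t' ≡ E t) ⊎ (E s' ≡ opp (E s) × E t' ≡ opp (E t))

  signs-opposite : ∀ {s t s' t'} → E t ≡ opp (E s) → E t' ≡ opp (E s') →
    SameSigns s t s' t'
  signs-opposite {s} {t} {s'} {t'} o o' with same-or-opp (E s) (E s')
  ... | inj₁ eq = inj₁ (eq , trans o' (trans (cong opp eq) (sym o)))
  ... | inj₂ eq = inj₂ (eq , trans o' (trans (cong opp eq) (cong opp (sym o))))

  signs-equal : ∀ {s t s' t'} → E t ≡ E s → E t' ≡ E s' →
    SameSigns s t s' t'
  signs-equal {s} {t} {s'} {t'} o o' with same-or-opp (E s) (E s')
  ... | inj₁ eq = inj₁ (eq , trans o' (trans eq (sym o)))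
  ... | inj₂ eq = inj₂ (eq , trans o' (trans eq (cong opp (sym o))))

  Same-class : Base → Fin (h * 2) → Fin (h * 2) → Base → Fin (h * 2) → Fin (h * 2) → Set
  Same-class b s t b' s' t' = (coe b t ⊝ coe b s) ^ᶠ e ≡ (coe b' t' ⊝ coe b' s') ^ᶠ e

  opposite-signs : ∀ {s t} → s ≢ t → L s ≡ L t → E t ≡ opp (E s)
  opposite-signs {s} {t} s≢t el with same-or-opp (E s) (E t)
  ... | inj₁ eε = contradiction (position-≡ el (sym eε)) s≢t
  ... | inj₂ eε = eε

  on-layer-class : ∀ S s t i → s ≢ t → L s ≡ L t → (es : Small.pt S (L s) ≡ i) →
    (coe (inj₁ S) t ⊝ coe (inj₁ S) s) ^ᶠ e ≡ root (Enumeration.index (blocksOn i) S (L s , es))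
  on-layer-class S s t _ s≢t el refl = trans (sym-class-⊕ S s t (opposite-signs s≢t el))
    (trans (cong (λ l → (β S l ⊕ β S (L s)) ^ᶠ e) (sym el)) (Scalars.β-class (scalars S) (L s)))

  -- Within a layer the class is the number of the block among those through the layer, so `S` and
  -- `S'` coincide; the two points have opposite signs in either pair, so the pairs agree up to
  -- `flip`.
  meet-on-layer : ∀ S S' s t s' t' → s ≢ t → s' ≢ t' → Small.pt S (L s) ≡ Small.pt S' (L s') → L s ≡ L t → L s' ≡ L t' →
    Same-class (inj₁ S) s t (inj₁ S') s' t' → Transport (inj₁ S) s t (inj₁ S') s' t'
  meet-on-layer S S' s t s' t' s≢t s'≢t' es el el' eq = go S≡S'
    where
    i = Small.pt S' (L s')
    B = blocksOn i
    S≡S' : S ≡ S'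
    S≡S' = trans (sym (Enumeration.elem-index B S (L s , es))) (trans (cong (Enumeration.elem B) (root-injective
      (trans (sym (on-layer-class S s t i s≢t el es)) (trans eq (on-layer-class S' s' t' i s'≢t' el' refl)))))
      (Enumeration.elem-index B S' (L s' , refl)))
    go : S ≡ S' → Transport (inj₁ S) s t (inj₁ S') s' t'
    go refl = transport-sym S s t s' t' ll (trans (sym el) (trans ll el'))
      (signs-opposite {s} {t} {s'} {t'} (opposite-signs s≢t el) (opposite-signs s'≢t' el'))
      where
      ll : L s ≡ L s'
      ll = Small.pt-injective S es

  -- The two layers determine the block of `small`, and by `β-≢` the class tells equal signs from
  -- opposite ones.
  meet-between-layers : ∀ S S' s t s' t' → L s ≢ L t → Small.pt S (L s) ≡ Small.pt S' (L s') → Small.pt S (L t) ≡ Small.pt S' (L t') →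
    Same-class (inj₁ S) s t (inj₁ S') s' t' → Transport (inj₁ S) s t (inj₁ S') s' t'
  meet-between-layers S S' s t s' t' nl es et eq = go (Small.unique S S' (L s) (L t) (L s') (L t') nl es et)
    where
    go : S ≡ S' → Transport (inj₁ S) s t (inj₁ S') s' t'
    go refl = transport-sym S s t s' t' ls lt (signs (same-or-opp (E s) (E t)) (same-or-opp (E s') (E t')))
      where
      ls : L s ≡ L s'
      ls = Small.pt-injective S es
      lt : L t ≡ L t'
      lt = Small.pt-injective S et
      separate : (β S (L t) ⊝ β S (L s)) ^ᶠ e ≢ (β S (L t) ⊕ β S (L s)) ^ᶠ e
      separate = Scalars.β-≢ (scalars S) (L s) (L t) nl
      signs : E t ≡ E s ⊎ E t ≡ opp (E s) → E t' ≡ E s' ⊎ E t' ≡ opp (E s') →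
        SameSigns s t s' t'
      signs (inj₁ o) (inj₁ o') = signs-equal {s} {t} {s'} {t'} o o'
      signs (inj₂ o) (inj₂ o') = signs-opposite {s} {t} {s'} {t'} o o'
      signs (inj₁ o) (inj₂ o') = contradiction (trans (sym (sym-class-⊝ S s t o)) (trans eq (trans (sym-class-⊕ S s' t' o')
        (sym (cong₂ (λ l l' → (β S l ⊕ β S l') ^ᶠ e) lt ls))))) separate
      signs (inj₂ o) (inj₁ o') = contradiction (sym (trans (sym (sym-class-⊕ S s t o)) (trans eq (trans (sym-class-⊝ S s' t' o')
        (sym (cong₂ (λ l l' → (β S l ⊝ β S l') ^ᶠ e) lt ls)))))) separate

  sym-used : ∀ S s t {i j r} → Small.pt S (L s) ≡ i → Small.pt S (L t) ≡ j →
    (coe (inj₁ S) t ⊝ coe (inj₁ S) s) ^ᶠ e ≡ root r → Used i j r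
  sym-used S s t ei ej eq with same-or-opp (E s) (E t)
  ... | inj₁ o = S , L s , L t , ei , ej , inj₁ (trans (sym (sym-class-⊝ S s t o)) eq)
  ... | inj₂ o = S , L s , L t , ei , ej , inj₂ (trans (sym (sym-class-⊕ S s t o)) eq)

  sym-transversal : ∀ S s t A r s' t' → s' ≢ t' → Small.pt S (L s) ≡ Big.pt A s' → Small.pt S (L t) ≡ Big.pt A t' →
    ¬ Same-class (inj₁ S) s t (inj₂ (A , r)) s' t'
  sym-transversal S s t A r s' t' s'≢t' es et eq =
    restOf-unused A o r (sym-used S s t es et (trans eq (restOf-class A r o)))
    where
    o = orient s' t' s'≢t'

  meet-scalar : ∀ b b' s t s' t' → s ≢ t → s' ≢ t' → lay b s ≡ lay b' s' → lay b t ≡ lay b' t' →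
    Same-class b s t b' s' t' → Transport b s t b' s' t'
  meet-scalar (inj₁ S) (inj₁ S') s t s' t' s≢t s'≢t' es et eq with L s ≟ᶠ L t
  ... | yes el = meet-on-layer S S' s t s' t' s≢t s'≢t' es el
          (Small.pt-injective S' (trans (sym es) (trans (cong (Small.pt S) el) et))) eq
  ... | no nl = meet-between-layers S S' s t s' t' nl es et eq
  meet-scalar (inj₁ S) (inj₂ (A , r)) s t s' t' s≢t s'≢t' es et eq = contradiction eq (sym-transversal S s t A r s' t' s'≢t' es et)
  meet-scalar (inj₂ (A , r)) (inj₁ S) s t s' t' s≢t s'≢t' es et eq = contradiction (sym eq) (sym-transversal S s' t' A r s t s≢t (sym es) (sym et))
  meet-scalar (inj₂ (A , r)) (inj₂ (A' , r')) s t s' t' s≢t s'≢t' es et eq = go (Big.unique A A' s t s' t' s≢t es et)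
    where
    go : A ≡ A' → Transport (inj₂ (A , r)) s t (inj₂ (A' , r')) s' t'
    go refl = go' (Big.pt-injective A es) (Big.pt-injective A et)
      where
      go' : s ≡ s' → t ≡ t' → Transport (inj₂ (A , r)) s t (inj₂ (A , r')) s' t'
      go' refl refl = go'' (restOf-injective A (orient s t s≢t) (orient s t s≢t) (root-injective
        (trans (sym (restOf-class A r (orient s t s≢t))) (trans eq (restOf-class A r' (orient s t s≢t))))))
        where
        go'' : r ≡ r' → Transport (inj₂ (A , r)) s t (inj₂ (A , r')) s t
        go'' refl = transport-refl (inj₂ (A , r)) s t

  -- From scalars to vectors

  Nonzero : (Fin N → Fin q) → Set
  Nonzero d = ¬ (∀ x → d x ≡ 𝟘)

  Λ : (Fin N → Fin q) → Set
  Λ d = Nonzero d × κ d ≡ 𝟙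

  HitVector : Fin c → Fin c → (Fin N → Fin q) → Set
  HitVector i j δ = ∃ λ b → ∃ λ s → ∃ λ t → ∃ λ d →
    Λ d × lay b s ≡ i × lay b t ≡ j × (∀ x → (coe b t ⊝ coe b s) ⊗ d x ≡ δ x)

  hit : ∀ i j δ → Nonzero δ → HitVector i j δ
  hit i j δ nδ = from (κ-value δ nδ)
    where
    from : (∃ λ t → t ≢ 𝟘 × κ δ ≡ t ^ᶠ e) → HitVector i j δ
    from (τ , τ≢𝟘 , κδ) = from' (cls-label τ τ≢𝟘)
      where
      from' : (∃ λ z → root z ≡ τ ^ᶠ e) → HitVector i j δ
      from' (z , ez) = from'' (hit-scalar i j z)
        where
        from'' : Hit i j z → HitVector i j δ
        -- `δ` and the difference `D` have the same class, so by homogeneity `κ` is 1 at the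
        -- quotient.
        from'' (b , s , t , es , et , eq) = b , s , t , (λ x → D ⁻¹ ⊗ δ x) ,
          ((λ z' → nδ λ x → ⊗-cancelˡ (D ⁻¹) (⁻¹-≢𝟘 D≢𝟘) (trans (z' x) (sym (⊗-𝟘ʳ _)))) ,
            trans (κ-scale (D ⁻¹) δ (⁻¹-≢𝟘 D≢𝟘)) (trans (cong ((D ⁻¹) ^ᶠ e ⊗_) (trans κδ (trans (sym ez) (sym eq)))) (^-⁻¹ e D≢𝟘))) ,
          es , et , λ x → trans (sym (⊗-assoc D (D ⁻¹) (δ x))) (trans (cong (_⊗ δ x) (inverseʳ D D≢𝟘)) (⊗-𝟙ˡ (δ x)))
          where
          D = coe b t ⊝ coe b s
          D≢𝟘 : D ≢ 𝟘
          D≢𝟘 = class-≢𝟘 z eq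

  -- `κ` is 1 on both directions, so applying it to the common vector gives the same class for both
  -- differences and reduces the claim to `meet-scalar`.
  meet : ∀ b b' s t s' t' d d' → Λ d → Λ d' → s ≢ t → lay b s ≡ lay b' s' → lay b t ≡ lay b' t' →
    (∀ x → (coe b t ⊝ coe b s) ⊗ d x ≡ (coe b' t' ⊝ coe b' s') ⊗ d' x) →
    ∀ l → ∃ λ l' → lay b' l' ≡ lay b l × (∀ x → (coe b' l' ⊝ coe b' s') ⊗ d' x ≡ (coe b l ⊝ coe b s) ⊗ d x)
  meet b b' s t s' t' d d' (nd , κd) (nd' , κd') s≢t es et eq l = vectors (meet-scalar b b' s t s' t' s≢t s'≢t' es et same l)
    where
    D = coe b t ⊝ coe b s
    D' = coe b' t' ⊝ coe b' s'
    D≢𝟘 : D ≢ 𝟘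
    D≢𝟘 = ⊝-≢𝟘 (s≢t ∘ sym ∘ coe-injective b)
    D'≢𝟘 : D' ≢ 𝟘
    D'≢𝟘 z = nd λ x → ⊗-cancelˡ D D≢𝟘 (trans (eq x) (trans (cong (_⊗ d' x) z) (trans (⊗-𝟘ˡ _) (sym (⊗-𝟘ʳ D)))))
    s'≢t' : s' ≢ t'
    s'≢t' eq' = D'≢𝟘 (trans (cong (λ u → coe b' t' ⊝ coe b' u) eq') (⊝-self _))
    class : ∀ D d → D ≢ 𝟘 → κ d ≡ 𝟙 → κ (λ x → D ⊗ d x) ≡ D ^ᶠ e
    class D d nD κd = trans (κ-scale D d nD) (trans (cong (D ^ᶠ e ⊗_) κd) (⊗-𝟙ʳ _))
    same : Same-class b s t b' s' t'
    same = trans (sym (class D d D≢𝟘 κd)) (trans (κ-cong eq) (class D' d' D'≢𝟘 κd'))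
    vectors : (∃ λ l' → lay b' l' ≡ lay b l × (coe b' l' ⊝ coe b' s') ⊗ D ≡ (coe b l ⊝ coe b s) ⊗ D') →
      ∃ λ l' → lay b' l' ≡ lay b l × (∀ x → (coe b' l' ⊝ coe b' s') ⊗ d' x ≡ (coe b l ⊝ coe b s) ⊗ d x)
    vectors (l' , el , ec) = l' , el , λ x → ⊗-cancelˡ D D≢𝟘 (begin
      D ⊗ (X' ⊗ d' x) ≡⟨ arrange D X' (d' x) ⟩
      X' ⊗ D ⊗ d' x ≡⟨ cong (_⊗ d' x) ec ⟩
      X ⊗ D' ⊗ d' x ≡⟨ ⊗-assoc X D' (d' x) ⟩
      X ⊗ (D' ⊗ d' x) ≡⟨ cong (X ⊗_) (sym (eq x)) ⟩
      X ⊗ (D ⊗ d x) ≡⟨ solve 3 (λ X D d → X :* (D :* d) := D :* (X :* d)) refl X D (d x) ⟩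
      D ⊗ (X ⊗ d x) ∎)
      where
      open ≡-Reasoning
      X = coe b l ⊝ coe b s
      X' = coe b' l' ⊝ coe b' s'
      arrange : ∀ D X d → D ⊗ (X ⊗ d) ≡ X ⊗ D ⊗ d
      arrange = solve 3 (λ D X d → D :* (X :* d) := X :* D :* d) refl

  bases : List Base
  bases = map inj₁ (allFin Small.size) ++ map inj₂ (cartesianProduct (allFin Big.size) (allFin m₂))

  bases-complete : ∀ b → b ∈ bases
  bases-complete (inj₁ S) = ∈-++⁺ˡ (∈-map⁺ inj₁ (∈-allFin S))
  bases-complete (inj₂ (A , r)) = ∈-++⁺ʳ (map inj₁ (allFin Small.size)) (∈-map⁺ inj₂ (∈-cartesianProduct⁺ (∈-allFin A) (∈-allFin r)))

  allZero? : (d : Fin N → Fin q) → Dec (∀ x → d x ≡ 𝟘)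
  allZero? d = Fin.all? (λ x → d x ≟ᶠ 𝟘)

  baseFamily : BaseFamily F N c (h * 2)
  baseFamily = record
    { Base = Base ; bases = bases ; bases-complete = bases-complete
    ; lay = lay ; coe = coe ; coe-injective = coe-injective
    ; Λ = Λ
    ; Λ? = λ d → ¬? (allZero? d) ×-dec (κ d ≟ᶠ 𝟙)
    ; Λ-cong = λ eq (nd , κd) → (λ z → nd λ x → trans (eq x) (z x)) , trans (κ-cong (λ x → sym (eq x))) κd
    ; Λ-nonzero = proj₁
    ; hit = hit
    ; meet = meet }

-- A group permuting the coordinates of a vector space

argmin : ∀ {n} {P : Fin n → Set} (P? : ∀ x → Dec (P x)) (f : Fin n → ℕ) → ∃ P →
  ∃ λ x → P x × (∀ y → P y → f x ≤ f y)
argmin {n} {P} P? f (x , px) = search (suc (f x)) x px ≤-refl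
  where
  search : ∀ fuel x → P x → f x < fuel → ∃ λ x → P x × (∀ y → P y → f x ≤ f y)
  search (suc fuel) x px (s≤s lt) with any? (λ y → P? y ×-dec (f y <? f x))
  ... | yes (y , py , fy<fx) = search fuel y py (<-≤-trans fy<fx lt)
  ... | no none = x , px , λ y py → ≮⇒≥ (λ fy<fx → none (y , py , fy<fx))

module GroupFacts (G : FiniteGroup) where
  open FiniteGroup G renaming (order to n; e to ε; inv to infix 8 _⁻; _·_ to infixl 7 _·_) public

  group : Group _ _
  group = record { isGroup = isGroup }

  open Group group using (assoc; identityˡ; identityʳ; inverseˡ; inverseʳ) public
  open Algebra.Properties.Group group using (⁻¹-anti-homo-∙; ⁻¹-involutive; ε⁻¹≈ε; ∙-cancelˡ; \\-leftDividesˡ; \\-leftDividesʳ) public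

  pow : Fin n → ℕ → Fin n
  pow w zero = ε
  pow w (suc j) = w · pow w j

  pow-+ : ∀ w i j → pow w (i + j) ≡ pow w i · pow w j
  pow-+ w zero j = sym (identityˡ _)
  pow-+ w (suc i) j = trans (cong (w ·_) (pow-+ w i j)) (sym (assoc w _ _))

  pow-multiple : ∀ w c {j} → pow w j ≡ ε → pow w (c * j) ≡ ε
  pow-multiple w zero eq = refl
  pow-multiple w (suc c) {j} eq = trans (pow-+ w j (c * j)) (trans (cong₂ _·_ eq (pow-multiple w c eq)) (identityˡ ε))

  -- With the exponent n ! instead of n the pigeonhole principle is enough.
  pow-! : ∀ w → pow w (n !) ≡ ε
  pow-! w with pigeonhole (n<1+n n) (λ (j : Fin (suc n)) → pow w (toℕ j))
  ... | i , j , i<j , eq = trans (cong (pow w) (m∣n⇒n≡quotient*m D∣n!)) (pow-multiple w (quotient D∣n!) pow-D)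
    where
    D = toℕ j ∸ toℕ i
    D>0 : 0 < D
    D>0 = m<n⇒0<n∸m i<j
    D≤n : D ≤ n
    D≤n = ≤-trans (m∸n≤m (toℕ j) (toℕ i)) (≤-pred (toℕ<n j))
    pow-D : pow w D ≡ ε
    pow-D = ∙-cancelˡ (pow w (toℕ i)) _ _ (trans (sym (pow-+ w (toℕ i) D))
      (trans (cong (pow w) (m+[n∸m]≡n (<⇒≤ i<j))) (trans (sym eq) (sym (identityʳ _)))))
    ∣! : ∀ d → 0 < d → d ∣ d !
    ∣! (suc d) _ = m∣m*n (d !)
    D∣n! : D ∣ n !
    D∣n! = ∣-trans (∣! D D>0) (m≤n⇒m!∣n! D≤n)

-- κ d is the e-th power of a coordinate of d, namely of the coordinate g for which the code of the function
-- x ↦ d (g x) / d g is smallest; two such coordinates differ by a root of unity whose e-th power is 1.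
module Normalisation {q : ℕ} (F : FiniteField q) (G : FiniteGroup) (e-1 e' : ℕ)
  (e≡ : suc e-1 ≡ FiniteGroup.order G ! * e') where
  open Field F
  open Fermat F using (𝟘^suc)
  open GroupFacts G using (n; ε; _⁻; _·_; assoc; identityˡ; identityʳ; inverseˡ; inverseʳ; \\-leftDividesˡ; \\-leftDividesʳ; pow; pow-!)

  e : ℕ
  e = suc e-1

  Vector : Set
  Vector = Fin n → Fin q

  shift : Fin n → Vector → Vector
  shift a d x = d (a ⁻ · x)

  -- Unchanged when `d` is scaled and carried along when `d` is shifted, so selecting coordinates by
  -- its code is compatible with both.
  ν : Vector → Fin n → Vector
  ν d g x = d (g · x) ⊗ (d g) ⁻¹

  code : Vector → Fin n → ℕ
  code d g = toℕ (funToFin (ν d g))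

  Least : Vector → Fin n → Set
  Least d g = d g ≢ 𝟘 × (∀ g' → d g' ≢ 𝟘 → code d g ≤ code d g')

  nonzero? : ∀ (d : Vector) g → Dec (d g ≢ 𝟘)
  nonzero? d g = ¬? (d g ≟ᶠ 𝟘)

  code-≡ : ∀ d d' g g' → (∀ x → ν d g x ≡ ν d' g' x) → code d g ≡ code d' g'
  code-≡ d d' g g' eq = cong toℕ (funToFin-cong eq)

  value : ∀ (d : Vector) → Dec (∃ λ g → d g ≢ 𝟘) → Fin q
  value d (no _) = 𝟘
  value d (yes p) = d (proj₁ (argmin (nonzero? d) (code d) p)) ^ᶠ e

  κ : Vector → Fin q
  κ d = value d (any? (nonzero? d))

  private
    ratio : ∀ d g g' → d g ≢ 𝟘 → (∀ x → ν d g x ≡ ν d g' x) → ∀ x → d (g · x) ≡ (d g ⊗ (d g') ⁻¹) ⊗ d (g' · x)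
    ratio d g g' nz eq x = ⊗-cancelʳ ((d g) ⁻¹) (⁻¹-≢𝟘 nz) (begin
      d (g · x) ⊗ (d g) ⁻¹ ≡⟨ eq x ⟩
      d (g' · x) ⊗ (d g') ⁻¹ ≡⟨ sym (⊗-𝟙ˡ _) ⟩
      𝟙 ⊗ (d (g' · x) ⊗ (d g') ⁻¹) ≡⟨ cong (_⊗ (d (g' · x) ⊗ (d g') ⁻¹)) (sym (inverseʳ' (d g) nz)) ⟩
      (d g ⊗ (d g) ⁻¹) ⊗ (d (g' · x) ⊗ (d g') ⁻¹) ≡⟨ arrange (d g) ((d g) ⁻¹) (d (g' · x)) ((d g') ⁻¹) ⟩
      (d g ⊗ (d g') ⁻¹) ⊗ d (g' · x) ⊗ (d g) ⁻¹ ∎)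
      where
      open ≡-Reasoning
      inverseʳ' = FiniteField.inverseʳ F
      arrange : ∀ a b u v → (a ⊗ b) ⊗ (u ⊗ v) ≡ (a ⊗ v) ⊗ u ⊗ b
      arrange = solve 4 (λ a b u v → (a :* b) :* (u :* v) := (a :* v) :* u :* b) refl

    -- Each step by `g' ⁻ · g` multiplies the value by `s`; since the steps return after `n !` of
    -- them, `s ^ᶠ (n !)` will be 1.
    orbit : ∀ d g g' s → (∀ x → d (g · x) ≡ s ⊗ d (g' · x)) → ∀ j → d (g' · pow (g' ⁻ · g) j) ≡ s ^ᶠ j ⊗ d g'
    orbit d g g' s eq zero = trans (cong d (identityʳ g')) (sym (⊗-𝟙ˡ _))
    orbit d g g' s eq (suc j) = begin
      d (g' · (g' ⁻ · g · pow w j)) ≡⟨ cong d (trans (sym (assoc g' _ _)) (cong (_· pow w j) (\\-leftDividesˡ g' g))) ⟩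
      d (g · pow w j) ≡⟨ eq (pow w j) ⟩
      s ⊗ d (g' · pow w j) ≡⟨ cong (s ⊗_) (orbit d g g' s eq j) ⟩
      s ⊗ (s ^ᶠ j ⊗ d g') ≡⟨ sym (⊗-assoc s _ _) ⟩
      s ^ᶠ suc j ⊗ d g' ∎
      where
      open ≡-Reasoning
      w = g' ⁻ · g

    -- Equal codes give equal functions `ν`, so `orbit` applies to the ratio `s` of the two values;
    -- `e` is a multiple of `n !`.
    least-class : ∀ d g g' → Least d g → Least d g' → d g ^ᶠ e ≡ d g' ^ᶠ e
    least-class d g g' (nz , le) (nz' , le') = begin
      d g ^ᶠ e ≡⟨ cong (_^ᶠ e) (trans (cong d (sym (identityʳ g))) (trans (scaled ε) (cong (λ x → s ⊗ d x) (identityʳ g')))) ⟩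
      (s ⊗ d g') ^ᶠ e ≡⟨ ^-distrib-⊗ s (d g') e ⟩
      s ^ᶠ e ⊗ d g' ^ᶠ e ≡⟨ cong (_⊗ d g' ^ᶠ e) s^e ⟩
      𝟙 ⊗ d g' ^ᶠ e ≡⟨ ⊗-𝟙ˡ _ ⟩
      d g' ^ᶠ e ∎
      where
      open ≡-Reasoning
      s = d g ⊗ (d g') ⁻¹
      same-ν : ∀ x → ν d g x ≡ ν d g' x
      same-ν = funToFin-injective (toℕ-injective (≤-antisym (le g' nz') (le' g nz)))
      scaled : ∀ x → d (g · x) ≡ s ⊗ d (g' · x)
      scaled = ratio d g g' nz same-ν
      s^n! : s ^ᶠ (n !) ≡ 𝟙
      s^n! = ⊗-cancelʳ (d g') nz' (trans (sym (orbit d g g' s scaled (n !)))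
        (trans (cong (λ u → d (g' · u)) (pow-! (g' ⁻ · g))) (trans (cong d (identityʳ g')) (sym (⊗-𝟙ˡ _)))))
      s^e : s ^ᶠ e ≡ 𝟙
      s^e = trans (cong (s ^ᶠ_) e≡) (trans (^-* s (n !) e') (trans (cong (_^ᶠ e') s^n!) (^-𝟙 e')))

    κ-least : ∀ d g → Least d g → κ d ≡ d g ^ᶠ e
    κ-least d g least = go (any? (nonzero? d))
      where
      go : (p : Dec (∃ λ g → d g ≢ 𝟘)) → value d p ≡ d g ^ᶠ e
      go (no none) = contradiction (g , proj₁ least) none
      go (yes p) = least-class d _ g (proj₂ (argmin (nonzero? d) (code d) p)) least

    κ-zero : ∀ d → (∀ x → d x ≡ 𝟘) → κ d ≡ 𝟘
    κ-zero d zero-d = go (any? (nonzero? d))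
      where
      go : (p : Dec (∃ λ g → d g ≢ 𝟘)) → value d p ≡ 𝟘
      go (no none) = refl
      go (yes (g , nz)) = contradiction (zero-d g) nz

    least-or-zero : ∀ d → (∃ λ g → Least d g) ⊎ (∀ x → d x ≡ 𝟘)
    least-or-zero d with any? (nonzero? d)
    ... | yes p = inj₁ (argmin (nonzero? d) (code d) p)
    ... | no none = inj₂ λ x → zero-at x (d x ≟ᶠ 𝟘)
      where
      zero-at : ∀ x → Dec (d x ≡ 𝟘) → d x ≡ 𝟘
      zero-at x (yes z) = z
      zero-at x (no nz) = contradiction (x , nz) none

  κ-cong : ∀ {d d'} → (∀ x → d x ≡ d' x) → κ d ≡ κ d'
  κ-cong {d} {d'} eq with least-or-zero d
  ... | inj₂ z = trans (κ-zero d z) (sym (κ-zero d' (λ x → trans (sym (eq x)) (z x))))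
  ... | inj₁ (g , nz , le) = trans (κ-least d g (nz , le)) (trans (cong (_^ᶠ e) (eq g)) (sym (κ-least d' g
          ((λ z → nz (trans (eq g) z)) , λ g' nz' → subst₂ _≤_ (codes g) (codes g') (le g' (λ z → nz' (trans (sym (eq g')) z)))))))
    where
    codes : ∀ g → code d g ≡ code d' g
    codes g = code-≡ d d' g g (λ x → cong₂ (λ u v → u ⊗ v ⁻¹) (eq (g · x)) (eq g))

  κ-scale : ∀ s d → s ≢ 𝟘 → κ (λ x → s ⊗ d x) ≡ s ^ᶠ e ⊗ κ d
  κ-scale s d ns with least-or-zero d
  ... | inj₂ z = trans (κ-zero (λ x → s ⊗ d x) (λ x → trans (cong (s ⊗_) (z x)) (⊗-𝟘ʳ s)))
          (sym (trans (cong (s ^ᶠ e ⊗_) (κ-zero d z)) (⊗-𝟘ʳ _)))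
  ... | inj₁ (g , nz , le) = trans (κ-least sd g (⊗-≢𝟘 ns nz , least)) (trans (^-distrib-⊗ s (d g) e)
          (cong (s ^ᶠ e ⊗_) (sym (κ-least d g (nz , le)))))
    where
    sd : Vector
    sd x = s ⊗ d x
    codes : ∀ g → d g ≢ 𝟘 → code d g ≡ code sd g
    codes g nz = code-≡ d sd g g λ x → ⊗-cancelʳ (s ⊗ d g) (⊗-≢𝟘 ns nz) (begin
      d (g · x) ⊗ (d g) ⁻¹ ⊗ (s ⊗ d g) ≡⟨ solve 4 (λ u v s w → u :* v :* (s :* w) := s :* u :* (v :* w)) refl (d (g · x)) ((d g) ⁻¹) s (d g) ⟩
      s ⊗ d (g · x) ⊗ ((d g) ⁻¹ ⊗ d g) ≡⟨ cong (s ⊗ d (g · x) ⊗_) (trans (Field.inverseˡ F (d g) nz) (sym (Field.inverseˡ F (s ⊗ d g) (⊗-≢𝟘 ns nz)))) ⟩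
      s ⊗ d (g · x) ⊗ ((s ⊗ d g) ⁻¹ ⊗ (s ⊗ d g)) ≡⟨ sym (⊗-assoc _ _ _) ⟩
      s ⊗ d (g · x) ⊗ (s ⊗ d g) ⁻¹ ⊗ (s ⊗ d g) ∎)
      where open ≡-Reasoning
    least : ∀ g' → sd g' ≢ 𝟘 → code sd g ≤ code sd g'
    least g' nz' = subst₂ _≤_ (codes g nz) (codes g' d≢) (le g' d≢)
      where
      d≢ : d g' ≢ 𝟘
      d≢ z = nz' (trans (cong (s ⊗_) z) (⊗-𝟘ʳ s))

  -- The code of the shifted vector at `a · g` is that of `d` at `g`, so least coordinates are moved
  -- along.
  κ-shift : ∀ a d → κ (shift a d) ≡ κ d
  κ-shift a d with least-or-zero d
  ... | inj₂ z = trans (κ-zero (shift a d) (λ x → z (a ⁻ · x))) (sym (κ-zero d z))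
  ... | inj₁ (g , nz , le) = trans (κ-least (shift a d) (a · g) (nz ∘ trans (sym at-g) , least))
          (trans (cong (_^ᶠ e) at-g) (sym (κ-least d g (nz , le))))
    where
    at-g : shift a d (a · g) ≡ d g
    at-g = cong d (\\-leftDividesʳ a g)
    codes : ∀ g → code (shift a d) g ≡ code d (a ⁻ · g)
    codes g = code-≡ (shift a d) d g (a ⁻ · g) (λ x → cong (λ y → d y ⊗ (d (a ⁻ · g)) ⁻¹) (sym (assoc (a ⁻) g x)))
    least : ∀ g' → shift a d g' ≢ 𝟘 → code (shift a d) (a · g) ≤ code (shift a d) g'
    least g' nz' = subst₂ _≤_ (trans (cong (code d) (sym (\\-leftDividesʳ a g))) (sym (codes (a · g)))) (sym (codes g')) (le (a ⁻ · g') nz')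

  κ-value : ∀ d → ¬ (∀ x → d x ≡ 𝟘) → ∃ λ t → t ≢ 𝟘 × κ d ≡ t ^ᶠ e
  κ-value d nd with least-or-zero d
  ... | inj₁ (g , nz , le) = d g , nz , κ-least d g (nz , le)
  ... | inj₂ z = contradiction z nd

  invariant : Invariant F n e
  invariant = record { κ = κ ; κ-cong = κ-cong ; κ-scale = κ-scale ; κ-value = κ-value }

subgroup : ∀ {v k} (D : Design v k) (G : FiniteGroup) (φ : Fin (FiniteGroup.order G) → Permutation′ v) →
  (∀ g → IsAutomorphism D (φ g)) →
  (∀ g h x → φ (FiniteGroup._·_ G g h) ⟨$⟩ʳ x ≡ φ g ⟨$⟩ʳ (φ h ⟨$⟩ʳ x)) →
  (∀ g h → (∀ x → φ g ⟨$⟩ʳ x ≡ φ h ⟨$⟩ʳ x) → g ≡ h) → HasSubgroupIso D G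
subgroup D G φ automorphic homomorphic faithful = φ , automorphic , homomorphic , faithful

module Action {q : ℕ} (F : FiniteField q) (G : FiniteGroup) (c k : ℕ) (hole : TupleDesign c k)
  (B : BaseFamily F (FiniteGroup.order G) c k)
  (Λ-shift : ∀ a d → BaseFamily.Λ B d → BaseFamily.Λ B (λ x → d (FiniteGroup._·_ G (FiniteGroup.inv G a) x))) (i₀ : Fin c) where
  open Field F using (_⊕_; _⊗_; 𝟘; 𝟙; 𝟙≢𝟘)
  open GroupFacts G using (n; ε; _⁻; _·_; assoc; identityˡ; identityʳ; inverseˡ; inverseʳ; ⁻¹-anti-homo-∙; ⁻¹-involutive; ε⁻¹≈ε; \\-leftDividesˡ)
  open BaseFamily B using (Λ; Λ-cong; lay; coe)
  open Development F n c k hole B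

  v : ℕ
  v = c * q ^ n

  shift : Fin n → (Fin n → Fin q) → Fin n → Fin q
  shift a d x = d (a ⁻ · x)

  act : Fin n → Fin v → Fin v
  act a x = point (layer x) (shift a (vector x))

  act-point : ∀ a i u → act a (point i u) ≡ point i (shift a u)
  act-point a i u = point-cong (layer-point i u) (λ x → vector-point i u (a ⁻ · x))

  act-· : ∀ a b x → act (a · b) x ≡ act a (act b x)
  act-· a b x = sym (trans (act-point a (layer x) (shift b (vector x)))
    (point-cong refl (λ y → cong (vector x) (trans (sym (assoc (b ⁻) (a ⁻) y)) (cong (_· y) (sym (⁻¹-anti-homo-∙ a b)))))))

  act-ε : ∀ x → act ε x ≡ x
  act-ε x = trans (point-cong refl (λ y → cong (vector x) (trans (cong (_· y) ε⁻¹≈ε) (identityˡ y)))) (point-layer x)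

  perm : Fin n → Permutation′ v
  perm a = permutation (act a) (act (a ⁻))
    (λ x → trans (sym (act-· a (a ⁻) x)) (trans (cong (λ g → act g x) (inverseʳ a)) (act-ε x)))
    (λ x → trans (sym (act-· (a ⁻) a x)) (trans (cong (λ g → act g x) (inverseˡ a)) (act-ε x)))

  move : ∀ a ι → ι ∈ indices → ∃ λ ι' → ι' ∈ indices × ∀ l → tuple ι' l ≡ act a (tuple ι l)
  move a (inj₁ (D , u)) ι∈ = inj₁ (D , funToFin (shift a ⟨ u ⟩)) , hole∈ D _ , λ l →
    trans (point-cong refl (finToFun-funToFin (shift a ⟨ u ⟩))) (sym (act-point a _ ⟨ u ⟩))
  move a (inj₂ (b , u , d)) ι∈ = inj₂ (b , funToFin (shift a ⟨ u ⟩) , funToFin (shift a ⟨ d ⟩))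
    , base∈ b _ _ (Λ-cong (λ x → sym (finToFun-funToFin (shift a ⟨ d ⟩) x)) (Λ-shift a ⟨ d ⟩ (base-Λ b u d ι∈)))
    , λ l → trans (point-cong refl (λ x → cong₂ (λ s t → s ⊕ coe b l ⊗ t) (finToFun-funToFin (shift a ⟨ u ⟩) x) (finToFun-funToFin (shift a ⟨ d ⟩) x)))
        (sym (act-point a (lay b l) (along u (coe b l) d)))

  δ : Fin n → Fin q
  δ x with x ≟ᶠ ε
  ... | yes _ = 𝟙
  ... | no _ = 𝟘

  δ-ε : δ ε ≡ 𝟙
  δ-ε with ε ≟ᶠ ε
  ... | yes _ = refl
  ... | no ne = contradiction refl ne

  δ-𝟙 : ∀ x → δ x ≡ 𝟙 → x ≡ ε
  δ-𝟙 x eq with x ≟ᶠ ε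
  ... | yes x≡ε = x≡ε
  ... | no _ = contradiction (sym eq) 𝟙≢𝟘

  -- The indicator `δ` of the neutral element, placed on one layer, has pairwise distinct
  -- translates.
  faithful : ∀ g h → (∀ x → act g x ≡ act h x) → g ≡ h
  faithful g h eq = begin
    g ≡⟨ sym (\\-leftDividesˡ h g) ⟩
    h · (h ⁻ · g) ≡⟨ cong (h ·_) (δ-𝟙 (h ⁻ · g) at-g) ⟩
    h · ε ≡⟨ identityʳ h ⟩
    h ∎
    where
    open ≡-Reasoning
    same : ∀ y → shift g δ y ≡ shift h δ y
    same = proj₂ (point-injective {i₀} {i₀} (trans (sym (act-point g i₀ δ)) (trans (eq (point i₀ δ)) (act-point h i₀ δ))))
    at-g : δ (h ⁻ · g) ≡ 𝟙
    at-g = trans (sym (same g)) (trans (cong δ (inverseˡ g)) δ-ε)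

  design : Design v k
  design = Family.design family

  automorphisms : ∀ a → IsAutomorphism design (perm a)
  automorphisms a = Family.automorphism family (perm a) (move a) (move (a ⁻))

  homomorphism : ∀ g h x → perm (g · h) ⟨$⟩ʳ x ≡ perm g ⟨$⟩ʳ (perm h ⟨$⟩ʳ x)
  homomorphism g h x = act-· g h x

  faithfulness : ∀ g h → (∀ x → perm g ⟨$⟩ʳ x ≡ perm h ⟨$⟩ʳ x) → g ≡ h
  faithfulness g h eq = faithful g h eq

  hasSubgroup : HasSubgroupIso design G
  hasSubgroup = subgroup design G perm automorphisms homomorphism faithfulness

-- Assembling the designs

-- In characteristic 2 the polynomial x^2 - 1 is the square of x - 1 and has a single root.
two-from-roots : ∀ {q} (F : FiniteField q) → Fermat.Roots F 2 → Field._⊕_ F (Field.𝟙 F) (Field.𝟙 F) ≢ Field.𝟘 F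
two-from-roots F Z two = 0≢1 (root-injective (trans (root≡𝟙 zero) (sym (root≡𝟙 (suc zero)))))
  where
  open Field F
  open Fermat.Roots Z
  0≢1 : (zero {1}) ≢ suc zero
  0≢1 ()
  minus : 𝟙 ≡ ⊖ 𝟙
  minus = ⊝-≡𝟘 (trans (cong (𝟙 ⊕_) (⊖-involutive 𝟙)) two)
  factor : ∀ x → (x ⊝ 𝟙) ⊗ (x ⊝ ⊖ 𝟙) ≡ x ⊗ (x ⊗ 𝟙) ⊝ 𝟙
  factor x = solve 1 (λ x → (x :- con (pos 1)) :* (x :- (:- con (pos 1))) := x :* (x :* con (pos 1)) :- con (pos 1)) refl x
  cases : ∀ x → x ⊝ 𝟙 ≡ 𝟘 ⊎ x ⊝ ⊖ 𝟙 ≡ 𝟘 → x ≡ 𝟙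
  cases x (inj₁ eq) = ⊝-≡𝟘 eq
  cases x (inj₂ eq) = trans (⊝-≡𝟘 eq) (sym minus)
  root≡𝟙 : ∀ r → root r ≡ 𝟙
  root≡𝟙 r = cases (root r) (⊗-≡𝟘 (trans (factor (root r)) (trans (cong (_⊝ 𝟙) (root-^ r)) (⊝-self 𝟙))))

roots-for : ∀ {M N} (R : RootField M N) d c → 0 < d → d * c ≡ M → Fermat.Roots (RootField.F R) d
roots-for R (suc d) c _ eq = RootField.roots R d c eq

exponent>0 : ∀ {M N} (R : RootField M N) → 0 < N → 0 < RootField.e R
exponent>0 {M} {N} R N>0 = n≢0⇒n>0 λ e≡0 → <⇒≱ (≤-<-trans N>0 (RootField.large R))
  (≤-reflexive (trans (RootField.q≡ R) (cong suc (trans (cong (M *_) e≡0) (*-zeroʳ M)))))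

-- The 2 in `2 * g` makes the exponent `(q - 1) / pairs k` even, which puts -1 into the kernel of
-- the power map.
firstDesign : ∀ {M N} (R : RootField M N) k g → pairs k * (2 * g) ≡ M → 0 < pairs k → 0 < g → 0 < N →
  threshold (pairs k) k 1 ≤ N → TupleDesign (1 * RootField.q R ^ 1) k
firstDesign R k g eq pk>0 g>0 N>0 thr = DifferenceFamily.tupleDesign F
  (two-from-roots F (roots-for R 2 (pairs k * g) (s≤s z≤n) (trans (sym (double (pairs k) g)) eq)))
  k f (pred (2 * f)) 1+pred q≡' (roots-for R (pairs k) (2 * g) pk>0 eq) (≤-<-trans thr large)
  where
  open RootField R
  f : ℕ
  f = g * e
  double : ∀ p g → p * (2 * g) ≡ 2 * (p * g)
  double = solve-∀
  2f>0 : 0 < 2 * f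
  2f>0 = *-mono-< {0} {2} (s≤s z≤n) (*-mono-< g>0 (exponent>0 R N>0))
  1+pred : suc (pred (2 * f)) ≡ 2 * f
  1+pred = suc-pred (2 * f) ⦃ >-nonZero 2f>0 ⦄
  q≡' : q ≡ suc (pairs k * suc (pred (2 * f)))
  q≡' = trans q≡ (cong suc (trans (cong (_* e) (sym eq)) (trans (regroup (pairs k) g e) (cong (pairs k *_) (sym 1+pred)))))
    where
    regroup : ∀ p g e → p * (2 * g) * e ≡ p * (2 * (g * e))
    regroup = solve-∀

module Assembly {q : ℕ} (F : FiniteField q) (G : FiniteGroup) (c h-1 m₂ m' f e-1 e₂-1 e' : ℕ)
  (big : TupleDesign c (suc h-1 * 2)) (small : TupleDesign c (suc h-1)) (h-1>0 : 0 < h-1) (i₀ : Fin c)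
  (c≡ : c ≡ suc (h-1 * suc (suc m₂))) (m≡ : suc (suc m₂) ≡ 2 * m') (e≡ : suc e-1 ≡ 2 * f)
  (e₂≡ : suc e₂-1 ≡ suc e-1 * m') (e!≡ : suc e-1 ≡ FiniteGroup.order G ! * e')
  (q≡ : q ≡ suc (suc (suc m₂) * suc e-1)) (q≡₂ : q ≡ suc (2 * suc e₂-1))
  (Z : Fermat.Roots F (suc (suc m₂))) (Z₂ : Fermat.Roots F 2)
  (large : threshold (suc (suc m₂)) (suc h-1 * 2) 1 < q)
  (large₁ : 4 * suc (suc m₂) * suc (suc m₂) * 1 + 4 * suc (suc m₂) < q)
  (large₂ : threshold 2 (suc h-1) (4 * suc (suc m₂)) < q) where
  open Field F using (_^ᶠ_; _⊝_)

  m : ℕ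
  m = suc (suc m₂)

  n : ℕ
  n = FiniteGroup.order G

  two : Field._⊕_ F (Field.𝟙 F) (Field.𝟙 F) ≢ Field.𝟘 F
  two = two-from-roots F Z₂

  Blocks : Set
  Blocks = ∀ i → Enumeration (λ S → ∃ λ l → TupleDesign.pt small S l ≡ i) m

  AllScalars : Blocks → Set
  AllScalars blocksOn = ∀ S → Scalars F Z (suc e-1) (λ l → Enumeration.index (blocksOn (TupleDesign.pt small S l)) S (l , refl))

  Transversal : Set
  Transversal = (lab : ∀ (s t : Fin (suc h-1 * 2)) → s Fin.< t → Fin m) →
    ∃ λ (y : Fin (suc h-1 * 2) → Fin q) → ∀ s t lt → (y t ⊝ y s) ^ᶠ suc e-1 ≡ Fermat.Roots.root Z (lab s t lt)

  blocksOn : Blocks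
  blocksOn = Replication.blocksOn small h-1>0 m c≡

  scalars : AllScalars blocksOn
  scalars S = SymmetricBlock.scalars F two m m' f e-1 e₂-1 m≡ e≡ e₂≡ q≡ q≡₂ Z Z₂ _ large₁ large₂

  transversal : Transversal
  transversal lab = drop (Wilson.choose F m e-1 q≡ Z (suc h-1 * 2) (λ _ _ → yes tt) 1
      (λ _ → ≤-reflexive (trans (sym (count-all {q} (λ _ → yes tt) (λ _ → tt))) (sym (*-identityʳ _)))) large lab)
    where
    drop : (∃ λ (y : Fin (suc h-1 * 2) → Fin q) → (∀ i → ⊤) × (∀ s t (lt : s Fin.< t) → (y t ⊝ y s) ^ᶠ suc e-1 ≡ Fermat.Roots.root Z (lab s t lt))) →
      ∃ λ (y : Fin (suc h-1 * 2) → Fin q) → ∀ s t lt → (y t ⊝ y s) ^ᶠ suc e-1 ≡ Fermat.Roots.root Z (lab s t lt)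
    drop (y , _ , class) = y , class

  invariant : Invariant F n (suc e-1)
  invariant = Normalisation.invariant F G e-1 e' e!≡

  module _
    (blocksOn : Blocks) (scalars : AllScalars blocksOn) (transversal : Transversal)
    (I : Invariant F n (suc e-1))
    (κ-shift : ∀ a d → Invariant.κ I (λ x → d (FiniteGroup._·_ G (FiniteGroup.inv G a) x)) ≡ Invariant.κ I d) where

    family : BaseFamily F n c (suc h-1 * 2)
    family = LayeredFamily.baseFamily F two n c (suc h-1) m₂ f e-1 e≡ q≡ Z big small blocksOn scalars transversal I

    Λ-shift : ∀ a d → BaseFamily.Λ family d → BaseFamily.Λ family (λ x → d (FiniteGroup._·_ G (FiniteGroup.inv G a) x))
    Λ-shift a d (nd , κd) = (λ z → nd λ x → trans (cong d (sym (\\-leftDividesʳ a x))) (z (a · x))) , trans (κ-shift a d) κd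
      where open GroupFacts G using (_·_; \\-leftDividesʳ)

    construction : Σ (Design (c * q ^ n) (suc h-1 * 2)) λ D → HasSubgroupIso D G
    construction = Action.design F G c (suc h-1 * 2) big family Λ-shift i₀ , Action.hasSubgroup F G c (suc h-1 * 2) big family Λ-shift i₀

  result : Σ (Design (c * q ^ n) (suc h-1 * 2)) λ D → HasSubgroupIso D G
  result = construction blocksOn scalars transversal invariant (Normalisation.κ-shift F G e-1 e' e!≡)

pairs>0 : ∀ k → 2 ≤ k → 0 < pairs k
pairs>0 (suc zero) (s≤s ())
pairs>0 (suc (suc k)) _ = s≤s z≤n

SubgroupDesigns : ℕ → FiniteGroup → Set
SubgroupDesigns k G = ∀ N → Σ ℕ λ v → N ≤ v × Σ (Design v k) λ D → HasSubgroupIso D G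

module Second (G : FiniteGroup) (N c h-1 m₂ m' : ℕ) (big : TupleDesign c (suc h-1 * 2)) (small : TupleDesign c (suc h-1))
  (h-1>0 : 0 < h-1) (i₀ : Fin c) (c≡ : c ≡ suc (h-1 * suc (suc m₂))) (m≡ : suc (suc m₂) ≡ 2 * m') where

  m : ℕ
  m = suc (suc m₂)

  n : ℕ
  n = FiniteGroup.order G

  -- `bound₁` is for the transversal blocks, `bound₂` for the density `1 / (4 * m)` of the
  -- admissible squares, `bound₃` for choosing squares of this density with nonsquare differences.
  bound₁ bound₂ bound₃ bound : ℕ
  bound₁ = threshold m (suc h-1 * 2) 1
  bound₂ = 4 * m * m * 1 + 4 * m
  bound₃ = threshold 2 (suc h-1) (4 * m)
  bound = suc N + (bound₁ + (bound₂ + bound₃))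

  -- The modulus gives `(q - 1) / m` the factor `2 * n !`: the 2 puts -1 into the kernel of the
  -- power map, and `n !` makes `κ` well defined.
  design : RootField (m * (2 * n !)) bound → Σ ℕ λ v → N ≤ v × Σ (Design v (suc h-1 * 2)) λ D → HasSubgroupIso D G
  design R = c * q ^ n , N≤v ,
    Assembly.result F G c h-1 m₂ m' f (pred E) (pred E₂) (2 * e) big small h-1>0 i₀ c≡ m≡ 1+e (trans 1+e₂ (cong (_* m') (sym 1+e)))
      (trans 1+e (swap (n !) e)) q≡m q≡2 Z Z₂
      (≤-<-trans (≤-trans (m≤m+n bound₁ _) (m≤n+m _ (suc N))) large)
      (≤-<-trans (≤-trans (≤-trans (m≤m+n bound₂ bound₃) (m≤n+m _ bound₁)) (m≤n+m _ (suc N))) large)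
      (≤-<-trans (≤-trans (≤-trans (m≤n+m bound₃ bound₂) (m≤n+m _ bound₁)) (m≤n+m _ (suc N))) large)
    where
    open RootField R
    f E E₂ : ℕ
    f = n ! * e
    E = 2 * f
    E₂ = E * m'
    e>0 : 0 < e
    e>0 = exponent>0 R (s≤s z≤n)
    E>0 : 0 < E
    E>0 = *-mono-< {0} {2} (s≤s z≤n) (*-mono-< (>-nonZero⁻¹ (n !) ⦃ n !≢0 ⦄) e>0)
    m'>0 : 0 < m'
    m'>0 = n≢0⇒n>0 λ m'≡0 → contradiction (trans m≡ (trans (cong (2 *_) m'≡0) (*-zeroʳ 2))) λ ()
    1+e : suc (pred E) ≡ E
    1+e = suc-pred E ⦃ >-nonZero E>0 ⦄
    1+e₂ : suc (pred E₂) ≡ E₂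
    1+e₂ = suc-pred E₂ ⦃ >-nonZero (*-mono-< E>0 m'>0) ⦄
    swap : ∀ a e → 2 * (a * e) ≡ a * (2 * e)
    swap = solve-∀
    q≡E : q ≡ suc (m * E)
    q≡E = trans q≡ (cong suc (regroup m (n !) e))
      where
      regroup : ∀ m a e → m * (2 * a) * e ≡ m * (2 * (a * e))
      regroup = solve-∀
    q≡m : q ≡ suc (m * suc (pred E))
    q≡m = trans q≡E (cong (λ t → suc (m * t)) (sym 1+e))
    q≡2 : q ≡ suc (2 * suc (pred E₂))
    q≡2 = trans q≡E (cong suc (trans (cong (_* E) m≡) (trans (regroup m' E) (cong (2 *_) (sym 1+e₂)))))
      where
      regroup : ∀ m E → 2 * m * E ≡ 2 * (E * m)
      regroup = solve-∀
    Z : Fermat.Roots F m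
    Z = roots-for R m (2 * n !) (s≤s z≤n) refl
    Z₂ : Fermat.Roots F 2
    Z₂ = roots-for R 2 (m' * (2 * n !)) (s≤s z≤n) (trans (sym (*-assoc 2 m' _)) (cong (_* (2 * n !)) (sym m≡)))
    n>0 : 0 < n
    n>0 = ≤-<-trans z≤n (toℕ<n (FiniteGroup.e G))
    q>0 : 0 < q
    q>0 = ≤-<-trans z≤n large
    N≤v : N ≤ c * q ^ n
    N≤v = begin
      N ≤⟨ ≤-trans (n≤1+n N) (m≤m+n (suc N) _) ⟩
      bound ≤⟨ <⇒≤ large ⟩
      q ≤⟨ q≤q^ n n>0 ⟩
      q ^ n ≤⟨ m≤n*m (q ^ n) c ⦃ >-nonZero (≤-<-trans z≤n (toℕ<n i₀)) ⦄ ⟩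
      c * q ^ n ∎
      where
      open ≤-Reasoning
      q≤q^ : ∀ n → 0 < n → q ≤ q ^ n
      q≤q^ (suc n) _ = m≤m*n q (q ^ n) ⦃ m^n≢0 q n ⦃ >-nonZero q>0 ⦄ ⦄

  designs : Σ ℕ λ v → N ≤ v × Σ (Design v (suc h-1 * 2)) λ D → HasSubgroupIso D G
  designs = design (rootField (m * (2 * n !)) bound (*-mono-< {0} {m} (s≤s z≤n) (*-mono-< {0} {2} (s≤s z≤n) (>-nonZero⁻¹ (n !) ⦃ n !≢0 ⦄))))

module First (h-1 : ℕ) (h-1>0 : 0 < h-1) (G : FiniteGroup) where
  h k : ℕ
  h = suc h-1
  k = h * 2

  2≤h : 2 ≤ h
  2≤h = s≤s h-1>0

  2≤k : 2 ≤ k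
  2≤k = ≤-trans 2≤h (m≤m*n h 2)

  M bound : ℕ
  -- `pairs k` and `pairs h` are the numbers of classes of the two difference families on the same
  -- points, `h-1` has to divide `c - 1`, and the factors 2 make both exponents and the replication
  -- number `(c - 1) / h-1` even.
  M = pairs k * (2 * (pairs h * (2 * h-1)))
  bound = suc (threshold (pairs k) k 1 + threshold (pairs h) h 1)

  designs : RootField M bound → SubgroupDesigns k G
  designs R N = Second.designs G N c h-1 (pred m' + pred m') m' big small h-1>0 (subst Fin (sym c≡) zero) c≡ m≡
    where
    open RootField R
    c m' : ℕ
    c = 1 * q ^ 1
    m' = pairs k * (2 * pairs h) * e
    big : TupleDesign c k
    big = firstDesign R k (pairs h * (2 * h-1)) refl (pairs>0 k 2≤k)
      (*-mono-< (pairs>0 h 2≤h) (*-mono-< {0} {2} (s≤s z≤n) h-1>0)) (s≤s z≤n)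
      (≤-trans (m≤m+n (threshold (pairs k) k 1) (threshold (pairs h) h 1)) (n≤1+n _))
    small : TupleDesign c h
    small = firstDesign R h (pairs k * (2 * h-1)) (exchange (pairs k) (pairs h) h-1) (pairs>0 h 2≤h)
      (*-mono-< (pairs>0 k 2≤k) (*-mono-< {0} {2} (s≤s z≤n) h-1>0)) (s≤s z≤n)
      (≤-trans (m≤n+m (threshold (pairs h) h 1) (threshold (pairs k) k 1)) (n≤1+n _))
      where
      exchange : ∀ a b h → b * (2 * (a * (2 * h))) ≡ a * (2 * (b * (2 * h)))
      exchange = solve-∀
    m'>0 : 0 < m'
    m'>0 = *-mono-< (*-mono-< (pairs>0 k 2≤k) (*-mono-< {0} {2} (s≤s z≤n) (pairs>0 h 2≤h))) (exponent>0 R (s≤s z≤n))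
    m≡ : suc (suc (pred m' + pred m')) ≡ 2 * m'
    m≡ = trans (arith (pred m')) (cong (2 *_) (suc-pred m' ⦃ >-nonZero m'>0 ⦄))
      where
      arith : ∀ x → suc (suc (x + x)) ≡ 2 * suc x
      arith = solve-∀
    c≡ : c ≡ suc (h-1 * suc (suc (pred m' + pred m')))
    c≡ = trans (trans (*-identityˡ (q ^ 1)) (*-identityʳ q)) (trans q≡ (cong suc (trans (regroup (pairs k) (pairs h) h-1 e)
      (cong (h-1 *_) (sym m≡)))))
      where
      regroup : ∀ a b h e → a * (2 * (b * (2 * h))) * e ≡ h * (2 * (a * (2 * b) * e))
      regroup = solve-∀

  subgroupDesigns : SubgroupDesigns k G
  subgroupDesigns = designs (rootField M bound (*-mono-< (pairs>0 k 2≤k)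
    (*-mono-< {0} {2} (s≤s z≤n) (*-mono-< (pairs>0 h 2≤h) (*-mono-< {0} {2} (s≤s z≤n) h-1>0)))))

theorem1p3 : (k : ℕ) → 4 ≤ k → 2 ∣ k → (G : FiniteGroup) →
    2 ∣ FiniteGroup.order G → PrimePowerCondition (FiniteGroup.order G) k →
    ∀ (N : ℕ) → Σ ℕ λ v → N ≤ v × Σ (Design v k) λ D → HasSubgroupIso D G
-- With `k = h * 2`, the bound on `k` leaves `h ≥ 2`, so that blocks of size `h` contain pairs of
-- layers.
theorem1p3 _ 4≤k (divides-refl zero) G _ _ = contradiction 4≤k λ ()
theorem1p3 _ 4≤k (divides-refl (suc zero)) G _ _ = contradiction 4≤k λ { (s≤s (s≤s ())) }
theorem1p3 _ 4≤k (divides-refl (suc (suc h-2))) G _ _ = First.subgroupDesigns (suc h-2) (s≤s z≤n) G
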